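{- The following decision problem TRIPLE ROM-DOM is NP-complete when restricted to bipartite graphs: given a graph $\Gamma=(V,E)$ and a positive integer $k\le |V|$, decide whether $\Gamma$ has a triple Roman dominating function of weight at most $k$.
   Context: For a graph $\Gamma=(V,E)$ and a function $h:V\to\{0,1,2,3,4\}$, the active neighbourhood of a vertex $v$ is $AN(v)=\{w\in N(v): h(w)\ge 1\}$, where $N(v)$ is the open neighbourhood of $v$, and $AN[v]=AN(v)\cup\{v\}$; for $S\subseteq V$ write $h(S)=\sum_{u\in S}h(u)$. The function $h$ is a triple Roman dominating function (3RDF) of $\Gamma$ if every vertex $v$ with $h(v)<3$ satisfies $h(AN[v])\ge |AN(v)|+3$. Its weight is $h(V)$. -}

module Defs where

open import Data.Bool using (Bool; true; false; T; _∧_; if_then_else_)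
open import Data.Fin using (Fin; toℕ; _≟_)
open import Data.Fin.Subset using (Subset; ⊤; ⁅_⁆; _∪_; ∣_∣)
open import Data.List as List using (List; []; _∷_; _++_; length; replicate; concat)
open import Data.Nat using (ℕ; suc; _+_; _*_; _≤_; _<_; _≥_; _≤ᵇ_)
open import Data.Nat.Properties using (+-0-commutativeMonoid)
open import Data.Product using (Σ; ∃-syntax; _×_; _,_; proj₁; proj₂)
open import Data.Sum using (_⊎_)
open import Data.Unit using (tt) renaming (⊤ to Unit)
open import Data.Vec as Vec using (Vec; []; _∷_; lookup)
open import Function using (_∘_; _⇔_)
open import Relation.Binary.PropositionalEquality using (_≡_; _≢_)
open import Relation.Nullary using (Dec; does)
open import Relation.Nullary.Decidable using (_⊎-dec_)

open import Algebra.Properties.CommutativeMonoid.Sum +-0-commutativeMonoid using (sum)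

data Symbol (s : ℕ) : Set where
  blank : Symbol s
  bit   : Bool → Symbol s
  work  : Fin s → Symbol s

data Move : Set where
  left stay right : Move

-- A two-way infinite tape. Both lists start with the cell adjacent to the
-- head; all cells beyond the lists are blank.
record Tape (s : ℕ) : Set where
  constructor tape
  field
    before : List (Symbol s)
    head   : Symbol s
    after  : List (Symbol s)

module _ {s : ℕ} where

  move : Move → Tape s → Tape s
  move left  (tape []       h rs)       = tape [] blank (h ∷ rs)
  move left  (tape (l ∷ ls) h rs)       = tape ls l (h ∷ rs)
  move stay  t                          = t
  move right (tape ls       h [])       = tape (h ∷ ls) blank []
  move right (tape ls       h (r ∷ rs)) = tape (h ∷ ls) r rs

  write : Symbol s → Tape s → Tape s
  write a (tape ls _ rs) = tape ls a rs

  act : Symbol s × Move → Tape s → Tape s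
  act (a , m) t = move m (write a t)

  empty : Tape s
  empty = tape [] blank []

  load : List Bool → Tape s
  load []       = empty
  load (b ∷ bs) = tape [] (bit b) (List.map bit bs)

  leadingBits : List (Symbol s) → List Bool
  leadingBits (bit b ∷ as) = b ∷ leadingBits as
  leadingBits _            = []

  -- The output word starts under the head and extends to the right up to
  -- the first cell that does not hold a bit.
  read : Tape s → List Bool
  read (tape _ h rs) = leadingBits (h ∷ rs)

-- A machine has one transition function for each element of C, and every
-- step picks one of them: C = Unit gives deterministic machines, C = Bool
-- nondeterministic ones.
record Machine (C : Set) : Set where
  field
    states workSymbols extraTapes : ℕ
    start accept reject : Fin states
    accept≢reject       : accept ≢ reject

  tapes : ℕ
  tapes = suc extraTapes

  field
    δ : C → Fin states → Vec (Symbol workSymbols) tapes →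
        Fin states × Vec (Symbol workSymbols × Move) tapes

  record Config : Set where
    constructor config
    field
      state    : Fin states
      contents : Vec (Tape workSymbols) tapes

  open Config public

  -- The input is on the first tape, with the head on its first symbol.
  initial : List Bool → Config
  initial x = config start (load x ∷ Vec.replicate extraTapes empty)

  Accepting Halted : Config → Set
  Accepting c = state c ≡ accept
  Halted    c = state c ≡ accept ⊎ state c ≡ reject

  halted? : ∀ c → Dec (Halted c)
  halted? c = (state c ≟ accept) ⊎-dec (state c ≟ reject)

  -- Halted configurations are left unchanged, so that "halts within t
  -- steps" is "is halted after t steps".
  step : C → Config → Config
  step i c =
    if does (halted? c)
    then c
    else config (proj₁ next) (Vec.zipWith act (proj₂ next) (contents c))
    where
    next = δ i (state c) (Vec.map Tape.head (contents c))

  run : ∀ {t} → Vec C t → Config → Config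
  run []       c = c
  run (i ∷ is) c = run is (step i c)

  output : Config → List Bool
  output c = read (Vec.head (contents c))

DTM NTM : Set
DTM = Machine Unit
NTM = Machine Bool

-- Coefficients, constant term first.
Polynomial : Set
Polynomial = List ℕ

eval : Polynomial → ℕ → ℕ
eval []      n = 0
eval (a ∷ p) n = a + n * eval p n

Language : Set₁
Language = List Bool → Set

module _ (M : DTM) (p : Polynomial) where
  open Machine M

  ComputesInTime : (List Bool → List Bool) → Set
  ComputesInTime f = ∀ x →
    let c = run (Vec.replicate (eval p (length x)) tt) (initial x)
    in  Halted c × output c ≡ f x

PolyTimeComputable : (List Bool → List Bool) → Set
PolyTimeComputable f = ∃[ M ] ∃[ p ] ComputesInTime M p f

module _ (M : NTM) (p : Polynomial) where
  open Machine M

  -- All branches halt within the time bound, and a word is accepted if at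
  -- least one branch accepts.
  DecidesInTime : Language → Set
  DecidesInTime L = ∀ x →
    (∀ (cs : Vec Bool (eval p (length x))) → Halted (run cs (initial x))) ×
    (L x ⇔ (∃[ cs ] Accepting (run {eval p (length x)} cs (initial x))))

NP : Language → Set
NP L = ∃[ M ] ∃[ p ] DecidesInTime M p L

_≤ₚ_ : Language → Language → Set
L ≤ₚ L′ = ∃[ f ] PolyTimeComputable f × (∀ x → L x ⇔ L′ (f x))

NPHard : Language → Set₁
NPHard L = ∀ L′ → NP L′ → L′ ≤ₚ L

NPComplete : Language → Set₁
NPComplete L = NP L × NPHard L

record DecisionProblem : Set₁ where
  field
    Instance : Set
    Yes      : Instance → Set
    encode   : Instance → List Bool

  language : Language
  language x = ∃[ I ] encode I ≡ x × Yes I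

open DecisionProblem using (language) public

_restrictedTo_ : (Π : DecisionProblem) → (DecisionProblem.Instance Π → Set) →
                 DecisionProblem
Π restrictedTo P = record
  { Instance = Σ Instance P
  ; Yes      = Yes ∘ proj₁
  ; encode   = encode ∘ proj₁
  }
  where open DecisionProblem Π

record Graph : Set where
  field
    order  : ℕ
    adj    : Fin order → Fin order → Bool
    sym    : ∀ u v → adj u v ≡ adj v u
    irrefl : ∀ v → adj v v ≡ false

  Vertex : Set
  Vertex = Fin order

Bipartite : Graph → Set
Bipartite Γ =
  Σ (Vertex → Bool) λ side → ∀ u v → T (adj u v) → side u ≢ side v
  where open Graph Γ

module _ (Γ : Graph) where
  open Graph Γ

  Labelling : Set
  Labelling = Vertex → Fin 5

  module _ (h : Labelling) where

    AN AN[_] : Vertex → Subset order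
    AN v    = Vec.tabulate λ w → adj v w ∧ (1 ≤ᵇ toℕ (h w))
    AN[ v ] = AN v ∪ ⁅ v ⁆

    total : Subset order → ℕ
    total S = sum λ u → if lookup S u then toℕ (h u) else 0

    weight : ℕ
    weight = total ⊤

    Is3RDF : Set
    Is3RDF = ∀ v → toℕ (h v) < 3 → total AN[ v ] ≥ ∣ AN v ∣ + 3

record GraphWithBound : Set where
  field
    graph   : Graph
    k       : ℕ
    k-pos   : 1 ≤ k
    k≤order : k ≤ Graph.order graph

-- The order and the bound in unary, each terminated by false, then the
-- adjacency matrix row by row. Since k is at most the order, writing it in
-- unary does not affect polynomial-time solvability.
encodeGraphWithBound : GraphWithBound → List Bool
encodeGraphWithBound I =
  replicate order true ++ false ∷
  replicate k true ++ false ∷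
  concat (List.tabulate λ u → List.tabulate (adj u))
  where
  open GraphWithBound I
  open Graph graph

TripleRomDom : DecisionProblem
TripleRomDom = record
  { Instance = GraphWithBound
  ; Yes      = λ I → let open GraphWithBound I in
                 ∃[ h ] Is3RDF graph h × weight graph h ≤ k
  ; encode   = encodeGraphWithBound
  }

{-# OPTIONS --safe #-}
module Submission where

-- Membership: a guessed word lists the labels and the sides of the vertices
-- in unary, and whether it fits is a bounded arithmetic formula over the two
-- words, since h(AN[v]) ≥ |AN(v)| + 3 says that h(v) and the differences
-- h(w) − 1 of the active neighbours w sum up to at least 3. Such formulas are
-- compiled to Turing machines with unary counters.
--
-- Hardness: an accepting run of a nondeterministic machine in D steps is a
-- tableau of (D + 1)² cells, each with one of a constant number of values,
-- subject to constraints on single cells and on quintuples of cells. Every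
-- cell gets a gadget of weight at least 8, in which weight exactly 8 means
-- that the hub and a single admissible value have label 4, and a vertex for
-- each forbidden quintuple has to see a value that deviates from it. So the
-- tableau exists exactly if the graph has a triple Roman dominating function
-- of weight at most 8 (D + 1)². Adjacency in this graph is again a bounded
-- arithmetic formula, so the reduction is computed by a compiled machine.

open import Data.Bool using (Bool; true; false; T; if_then_else_; _∧_; _∨_)
import Data.Bool.Properties as Boolₚ
open import Data.Empty using (⊥; ⊥-elim)
open import Data.Fin as Fin using (Fin; zero; suc; toℕ; fromℕ<; _↑ˡ_; _↑ʳ_; splitAt; join; combine; remQuot; finToFun; funToFin; #_)
open import Data.Fin.Properties as Finₚ
  using (toℕ-fromℕ<; toℕ<n; toℕ-injective; toℕ≤pred[n]; toℕ-combine; splitAt-↑ˡ; splitAt-↑ʳ; join-splitAt;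
         remQuot-combine; combine-remQuot; combine-injective; finToFun-funToFin; ¬∀⟶∃¬; all?)
open import Data.Fin.Subset using (Subset; ∣_∣; ⁅_⁆; _∪_)
open import Data.Fin.Subset.Properties using (∪-identityʳ)
open import Data.List as List
  using (List; []; _∷_; _++_; [_]; length; concat; cartesianProduct; cartesianProductWith; allFin)
open import Data.List.Membership.Propositional using (_∈_)
open import Data.List.Membership.Propositional.Properties
  using (∈-cartesianProduct⁺; ∈-cartesianProductWith⁺; ∈-allFin; ∈-map⁺; ∈-++⁺ˡ; ∈-++⁺ʳ)
open import Data.List.Properties using (length-++; length-replicate; length-tabulate; ++-assoc; ++-identityʳ)
open import Data.List.Relation.Unary.Any as Any using (here; there)
open import Data.List.Relation.Unary.Any.Properties using (lookup-index)
open import Data.Maybe as Maybe using (Maybe; just; nothing; maybe)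
open import Data.Maybe.Properties using (just-injective)
open import Data.Nat
open import Data.Nat.Properties
open import Data.Nat.Tactic.RingSolver using (solve-∀)
open import Data.Product
open import Data.Product.Function.NonDependent.Propositional using (_×-⇔_)
import Data.Product.Properties as Productₚ
open import Data.Sum as Sum using (_⊎_; inj₁; inj₂; [_,_]′)
open import Data.Sum.Function.Propositional using (_⊎-⇔_)
open import Data.Unit using (tt) renaming (⊤ to Unit)
open import Data.Vec as Vec using (Vec; []; _∷_; toList; lookup; tabulate; replicate)
open import Data.Vec.Properties as Vecₚ
  using (lookup-zipWith; lookup∘tabulate; lookup-map; lookup-replicate; tabulate-cong; toList-++)
open import Function
open import Relation.Binary using (tri<; tri≈; tri>)
open import Relation.Binary.Definitions using (DecidableEquality)
open import Relation.Binary.PropositionalEquality hiding ([_])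
open import Relation.Nullary
open import Relation.Nullary.Decidable using (True; toWitness; map′; _⊎-dec_; ¬?)
open import Algebra.Properties.CommutativeMonoid.Sum +-0-commutativeMonoid using (sum; sum-cong-≗; ∑-distrib-+)
open import Defs

-- Polynomials

-- The model of computation is concrete, so membership and hardness both need an explicit machine
-- with an explicit polynomial clock. One compiler serves both: a verifier evaluates one formula on
-- input and guess, and the reduction evaluates one formula at each position to obtain the output
-- bit there.
--
-- The numbers 8 and 9 belong together. A cell has nine guards and nine leaves, so weight at most 8
-- leaves a guard and a leaf with label 0. The leaf sees only the hub and forces label 4 on it; the
-- guard needs surplus 3 from the options, whose labels then sum up to at least 4. Since every cell
-- costs at least 8, the total budget is tight in each cell, and nothing remains for the clauses,
-- which have to be dominated by options. Surplus 3 out of label sum 4 is possible only on a single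
-- option, hence a cell has one value. The guards also make the order exceed the bound, as instances
-- require.
--
-- A square tableau does not determine the whole computation, because a cell depends on its right
-- neighbour in the previous row. It determines the triangle t + j ≤ D, whose corner (D , 0) holds
-- the final state.

infixl 6 _⊕_
infixl 7 _⊗_

_⊕_ _⊗_ _⊚_ : Polynomial → Polynomial → Polynomial
[]      ⊕ q       = q
(a ∷ p) ⊕ []      = a ∷ p
(a ∷ p) ⊕ (b ∷ q) = (a + b) ∷ (p ⊕ q)
[]      ⊗ q = []
(a ∷ p) ⊗ q = List.map (a *_) q ⊕ (0 ∷ p ⊗ q)
[]      ⊚ q = []
(a ∷ p) ⊚ q = (a ∷ []) ⊕ (q ⊗ (p ⊚ q))

eval-⊕ : ∀ p q n → eval (p ⊕ q) n ≡ eval p n + eval q n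
eval-⊕ []      q       n = refl
eval-⊕ (a ∷ p) []      n = sym (+-identityʳ _)
eval-⊕ (a ∷ p) (b ∷ q) n rewrite eval-⊕ p q n = lemma a b n (eval p n) (eval q n)
  where
  lemma : ∀ a b n x y → a + b + n * (x + y) ≡ a + n * x + (b + n * y)
  lemma = solve-∀

eval-scale : ∀ a q n → eval (List.map (a *_) q) n ≡ a * eval q n
eval-scale a []      n = sym (*-zeroʳ a)
eval-scale a (b ∷ q) n rewrite eval-scale a q n = lemma a b n (eval q n)
  where
  lemma : ∀ a b n x → a * b + n * (a * x) ≡ a * (b + n * x)
  lemma = solve-∀

eval-⊗ : ∀ p q n → eval (p ⊗ q) n ≡ eval p n * eval q n
eval-⊗ []      q n = refl
eval-⊗ (a ∷ p) q n
  rewrite eval-⊕ (List.map (a *_) q) (0 ∷ p ⊗ q) n | eval-scale a q n | eval-⊗ p q n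
  = lemma a n (eval p n) (eval q n)
  where
  lemma : ∀ a n x y → a * y + n * (x * y) ≡ (a + n * x) * y
  lemma = solve-∀

eval-⊚ : ∀ p q n → eval (p ⊚ q) n ≡ eval p (eval q n)
eval-⊚ []      q n = refl
eval-⊚ (a ∷ p) q n
  rewrite eval-⊕ (a ∷ []) (q ⊗ (p ⊚ q)) n | eval-⊗ q (p ⊚ q) n | eval-⊚ p q n | *-zeroʳ n
        | +-identityʳ a = refl

-- Time bounds are written as ordinary functions and only converted to coefficient lists where the
-- definition of polynomial time asks for one.
record IsPoly (g : ℕ → ℕ) : Set where
  constructor isPoly
  field
    poly   : Polynomial
    agrees : ∀ n → g n ≡ eval poly n

open IsPoly public

module _ {g h : ℕ → ℕ} (G : IsPoly g) (H : IsPoly h) where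

  poly-+ : IsPoly (λ n → g n + h n)
  poly-+ = isPoly (poly G ⊕ poly H) λ n →
    trans (cong₂ _+_ (agrees G n) (agrees H n)) (sym (eval-⊕ (poly G) (poly H) n))

  poly-* : IsPoly (λ n → g n * h n)
  poly-* = isPoly (poly G ⊗ poly H) λ n →
    trans (cong₂ _*_ (agrees G n) (agrees H n)) (sym (eval-⊗ (poly G) (poly H) n))

  poly-∘ : IsPoly (λ n → g (h n))
  poly-∘ = isPoly (poly G ⊚ poly H) λ n →
    trans (trans (agrees G (h n)) (cong (eval (poly G)) (agrees H n))) (sym (eval-⊚ (poly G) (poly H) n))

poly-const : ∀ c → IsPoly (λ _ → c)
poly-const c = isPoly (c ∷ []) λ n → sym (trans (cong (c +_) (*-zeroʳ n)) (+-identityʳ c))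

poly-id : IsPoly (λ n → n)
poly-id = isPoly (0 ∷ 1 ∷ []) λ n → sym (trans (cong (n *_) (cong suc (*-zeroʳ n))) (*-identityʳ n))

poly-suc : ∀ {g} → IsPoly g → IsPoly (λ n → suc (g n))
poly-suc G = poly-+ (poly-const 1) G

-- Structured programs for Turing machines

Sym : Set
Sym = Symbol 1

pattern marker = work zero

module Programs (C : Set) (K : ℕ) where

  Syms Acts Tapes : Set
  Syms  = Vec Sym (suc K)
  Acts  = Vec (Sym × Move) (suc K)
  Tapes = Vec (Tape 1) (suc K)

  heads : Tapes → Syms
  heads = Vec.map Tape.head

  perform : Acts → Tapes → Tapes
  perform = Vec.zipWith act

  idle : Syms → Acts
  idle = Vec.map (_, stay)

  -- Tests see only the scanned symbols. A test of `while` is a step of its own, whereas sequencing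
  -- is free, since the exit of the first program is redirected to the entry of the second.
  data Prog : Set where
    op    : (C → Syms → Acts) → Prog
    _⨟_   : Prog → Prog → Prog
    while : (Syms → Bool) → Prog → Prog

  infixr 5 _⨟_

  infix 4 _⊢_⇓[_]_

  -- The list holds the choices that are consumed, one for each step.
  data _⊢_⇓[_]_ : Prog → Tapes → List C → Tapes → Set where
    op    : ∀ {f c T} → op f ⊢ T ⇓[ c ∷ [] ] perform (f c (heads T)) T
    _⨟_   : ∀ {p q T T′ T″ cs ds} → p ⊢ T ⇓[ cs ] T′ → q ⊢ T′ ⇓[ ds ] T″ →
            p ⨟ q ⊢ T ⇓[ cs ++ ds ] T″
    stop  : ∀ {g p T c} → g (heads T) ≡ false → while g p ⊢ T ⇓[ c ∷ [] ] T
    again : ∀ {g p T T′ T″ c cs ds} → g (heads T) ≡ true →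
            p ⊢ T ⇓[ cs ] T′ → while g p ⊢ T′ ⇓[ ds ] T″ →
            while g p ⊢ T ⇓[ c ∷ cs ++ ds ] T″

  size : Prog → ℕ
  size (op _)      = 1
  size (p ⨟ q)     = size p + size q
  size (while _ p) = suc (size p)

  entry : ∀ p → Fin (size p)
  entry (op _)      = zero
  entry (p ⨟ q)     = entry p ↑ˡ size q
  entry (while _ _) = zero

  -- The target `nothing` means that control leaves the program; each enclosing construct decides
  -- where it goes from there.
  next : ∀ p → Fin (size p) → C → Syms → Maybe (Fin (size p)) × Acts
  next (op f)      _       c a = nothing , f c a
  next (p ⨟ q)     i       c a =
    [ (λ i′ → map₁ (just ∘ maybe (_↑ˡ size q) (size p ↑ʳ entry q)) (next p i′ c a))
    , (λ i′ → map₁ (Maybe.map (size p ↑ʳ_)) (next q i′ c a))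
    ]′ (splitAt (size p) i)
  next (while g p) zero    c a = (if g a then just (suc (entry p)) else nothing) , idle a
  next (while g p) (suc i) c a = map₁ (just ∘ maybe suc zero) (next p i c a)

  perform-idle : ∀ {n} (T : Vec (Tape 1) n) → Vec.zipWith act (Vec.map (_, stay) (Vec.map Tape.head T)) T ≡ T
  perform-idle []      = refl
  perform-idle (t ∷ T) = cong (t ∷_) (perform-idle T)

  module _ (main : Prog) (verdict : Syms → Bool) where

    -- Three states precede those of `main`: accept, reject, and the exit of `main`, where the
    -- scanned symbols are turned into a verdict.
    machine : Machine C
    machine = record
      { states = 3 + size main ; workSymbols = 1 ; extraTapes = K
      ; start = suc (suc (suc (entry main))) ; accept = zero ; reject = suc zero
      ; accept≢reject = λ ()
      ; δ = δ
      }
      where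
      δ : C → Fin (3 + size main) → Syms → Fin (3 + size main) × Acts
      δ c zero                a = zero , idle a
      δ c (suc zero)          a = zero , idle a
      δ c (suc (suc zero))    a = (if verdict a then zero else suc zero) , idle a
      δ c (suc (suc (suc i))) a = map₁ (maybe (3 ↑ʳ_) (suc (suc zero))) (next main i c a)

    open Machine machine

    runList : List C → Config → Config
    runList []       = id
    runList (c ∷ cs) = runList cs ∘ step c

    runList-++ : ∀ cs ds k → runList (cs ++ ds) k ≡ runList ds (runList cs k)
    runList-++ []       ds k = refl
    runList-++ (c ∷ cs) ds k = runList-++ cs ds (step c k)

    run-toList : ∀ {t} (cs : Vec C t) k → run cs k ≡ runList (toList cs) k
    run-toList []       k = refl
    run-toList (c ∷ cs) k = run-toList cs (step c k)

    -- p occupies the states κ i of the machine and leaves to the state b.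
    record Placed (p : Prog) (κ : Fin (size p) → Fin (size main)) (b : Fin (3 + size main)) : Set where
      constructor placed
      field
        transitions : ∀ i c a → δ c (3 ↑ʳ κ i) a ≡ map₁ (maybe ((3 ↑ʳ_) ∘ κ) b) (next p i c a)

    step-placed : ∀ {p κ b} → Placed p κ b → ∀ i c T →
      let n = next p i c (heads T) in
      step c (config (3 ↑ʳ κ i) T) ≡ config (maybe ((3 ↑ʳ_) ∘ κ) b (proj₁ n)) (perform (proj₂ n) T)
    step-placed (placed pl) i c T = cong (λ n → config (proj₁ n) (perform (proj₂ n) T)) (pl i c (heads T))

    placed-left : ∀ {p q κ b} → Placed (p ⨟ q) κ b → Placed p (κ ∘ (_↑ˡ size q)) (3 ↑ʳ κ (size p ↑ʳ entry q))
    placed-left {p} {q} {κ} {b} (placed pl) = placed λ i c a → trans (pl (i ↑ˡ size q) c a) (lemma i c a)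
      where
      lemma : ∀ i c a → map₁ (maybe ((3 ↑ʳ_) ∘ κ) b) (next (p ⨟ q) (i ↑ˡ size q) c a)
              ≡ map₁ (maybe ((3 ↑ʳ_) ∘ κ ∘ (_↑ˡ size q)) (3 ↑ʳ κ (size p ↑ʳ entry q))) (next p i c a)
      lemma i c a rewrite splitAt-↑ˡ (size p) i (size q) with next p i c a
      ... | just j  , _ = refl
      ... | nothing , _ = refl

    placed-right : ∀ {p q κ b} → Placed (p ⨟ q) κ b → Placed q (κ ∘ (size p ↑ʳ_)) b
    placed-right {p} {q} {κ} {b} (placed pl) = placed λ i c a → trans (pl (size p ↑ʳ i) c a) (lemma i c a)
      where
      lemma : ∀ i c a → map₁ (maybe ((3 ↑ʳ_) ∘ κ) b) (next (p ⨟ q) (size p ↑ʳ i) c a)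
              ≡ map₁ (maybe ((3 ↑ʳ_) ∘ κ ∘ (size p ↑ʳ_)) b) (next q i c a)
      lemma i c a rewrite splitAt-↑ʳ (size p) (size q) i with next q i c a
      ... | just j  , _ = refl
      ... | nothing , _ = refl

    placed-body : ∀ {g p κ b} → Placed (while g p) κ b → Placed p (κ ∘ suc) (3 ↑ʳ κ zero)
    placed-body {g} {p} {κ} {b} (placed pl) = placed λ i c a → trans (pl (suc i) c a) (lemma i c a)
      where
      lemma : ∀ i c a → map₁ (maybe ((3 ↑ʳ_) ∘ κ) b) (next (while g p) (suc i) c a)
              ≡ map₁ (maybe ((3 ↑ʳ_) ∘ κ ∘ suc) (3 ↑ʳ κ zero)) (next p i c a)
      lemma i c a with next p i c a
      ... | just j  , _ = refl
      ... | nothing , _ = refl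

    -- Induction on the derivation. The exit state of the first half of a sequence is the entry of
    -- the second half, and the exit state of a loop body is the loop test, so the intermediate
    -- configurations fit together.
    run-placed : ∀ {p κ b T T′ cs} → Placed p κ b → p ⊢ T ⇓[ cs ] T′ →
                 runList cs (config (3 ↑ʳ κ (entry p)) T) ≡ config b T′
    run-placed pl (op {c = c} {T}) = step-placed pl zero c T
    run-placed {p ⨟ q} pl (_⨟_ {cs = cs} {ds} d e) =
      trans (runList-++ cs ds _)
        (trans (cong (runList ds) (run-placed (placed-left pl) d)) (run-placed (placed-right {p} {q} pl) e))
    run-placed {while g p} {κ} {b} pl (stop {T = T} {c} fail) = trans (step-placed pl zero c T)
      (cong₂ (λ t → config (maybe ((3 ↑ʳ_) ∘ κ) b (if t then just (suc (entry p)) else nothing))) fail (perform-idle T))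
    run-placed {while g p} {κ} {b} pl (again {T = T} {T′} {T″} {c} {cs} {ds} pass d e) = begin
      runList (cs ++ ds) (step c (config (3 ↑ʳ κ zero) T))
        ≡⟨ runList-++ cs ds _ ⟩
      runList ds (runList cs (step c (config (3 ↑ʳ κ zero) T)))
        ≡⟨ cong (runList ds ∘ runList cs) (trans (step-placed pl zero c T) lemma) ⟩
      runList ds (runList cs (config (3 ↑ʳ κ (suc (entry p))) T))
        ≡⟨ cong (runList ds) (run-placed (placed-body pl) d) ⟩
      runList ds (config (3 ↑ʳ κ zero) T′)
        ≡⟨ run-placed pl e ⟩
      config b T″ ∎
      where
      open ≡-Reasoning
      lemma = cong₂ (λ t → config (maybe ((3 ↑ʳ_) ∘ κ) b (if t then just (suc (entry p)) else nothing)))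
                    pass (perform-idle T)

    run-halted : ∀ cs {k} → Halted k → runList cs k ≡ k
    run-halted []       _           = refl
    run-halted (c ∷ cs) (inj₁ refl) = run-halted cs (inj₁ refl)
    run-halted (c ∷ cs) (inj₂ refl) = run-halted cs (inj₂ refl)

    -- One more step applies the verdict, and the rest of the time is idle.
    run-main : ∀ {T T′ cs} c ds → main ⊢ T ⇓[ cs ] T′ →
      runList (cs ++ c ∷ ds) (config start T) ≡ config (if verdict (heads T′) then zero else suc zero) T′
    run-main {T} {T′} {cs} c ds d = begin
      runList (cs ++ c ∷ ds) (config start T)
        ≡⟨ runList-++ cs (c ∷ ds) _ ⟩
      runList (c ∷ ds) (runList cs (config start T))
        ≡⟨ cong (runList (c ∷ ds)) (run-placed {κ = id} (placed λ _ _ _ → refl) d) ⟩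
      runList ds (config fin (perform (idle (heads T′)) T′))
        ≡⟨ cong (λ T → runList ds (config fin T)) (perform-idle T′) ⟩
      runList ds (config fin T′)
        ≡⟨ run-halted ds (halt (verdict (heads T′))) ⟩
      config fin T′ ∎
      where
      open ≡-Reasoning
      fin : Fin (3 + size main)
      fin = if verdict (heads T′) then zero else suc zero
      halt : ∀ b → Halted (config (if b then zero else suc zero) T′)
      halt true  = inj₁ refl
      halt false = inj₂ refl

-- Tapes as registers and words

-- Assignments compare registers by `_≡ᵇ_`. Splitting on this view together with the Boolean reduces
-- the assignment and yields the equation at the same time.
data Same (q r : ℕ) : Bool → Set where
  same   : q ≡ r → Same q r true
  differ : q ≢ r → Same q r false

same? : ∀ q r → Same q r (q ≡ᵇ r)
same? q r with q ≡ᵇ r in eq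
... | true  = same (≡ᵇ⇒≡ q r (subst T (sym eq) _))
... | false = differ λ q≡r → subst T eq (≡⇒≡ᵇ q r q≡r)

nth : {A : Set} → List A → ℕ → Maybe A
nth []       _       = nothing
nth (a ∷ as) zero    = just a
nth (a ∷ as) (suc i) = nth as i

nth-length : {A : Set} (as bs : List A) {a : A} → nth (as ++ a ∷ bs) (length as) ≡ just a
nth-length []       bs = refl
nth-length (_ ∷ as) bs = nth-length as bs

nth-≥ : {A : Set} (as : List A) {i : ℕ} → length as ≤ i → nth as i ≡ nothing
nth-≥ []       _       = refl
nth-≥ (_ ∷ as) (s≤s p) = nth-≥ as p

nth-++ˡ : {A : Set} (as bs : List A) {i : ℕ} → i < length as → nth (as ++ bs) i ≡ nth as i
nth-++ˡ (_ ∷ as) bs {zero}  _       = refl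
nth-++ˡ (_ ∷ as) bs {suc i} (s≤s p) = nth-++ˡ as bs p

at : {A : Set} → A → List A → ℕ → A
at d as i = Maybe.fromMaybe d (nth as i)

-- A tape is a counter and a word at once: the register value is the head position, and the marker
-- at position 0 makes zero visible to a test. The word is therefore shifted by one cell.
cells : List Bool → ℕ → Sym
cells w zero    = marker
cells w (suc i) = maybe bit blank (nth w i)

prefix : {A : Set} → (ℕ → A) → ℕ → List A
prefix f zero    = []
prefix f (suc p) = f p ∷ prefix f p

prefix-cong : {A : Set} {f g : ℕ → A} (p : ℕ) → (∀ {i} → i < p → f i ≡ g i) → prefix f p ≡ prefix g p
prefix-cong zero    _ = refl
prefix-cong (suc p) e = cong₂ _∷_ (e ≤-refl) (prefix-cong p λ q → e (m<n⇒m<1+n q))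

-- The cells of t, from the leftmost visited one on, are f 0, f 1, … and the
-- head is on f p.
record Rep (f : ℕ → Sym) (p : ℕ) (t : Tape 1) : Set where
  constructor rep
  field
    before≡ : Tape.before t ≡ prefix f p
    head≡   : Tape.head t ≡ f p
    after≡  : ∀ i → at blank (Tape.after t) i ≡ f (suc p + i)

rep-resp : ∀ {f g p t} → (∀ i → f i ≡ g i) → Rep f p t → Rep g p t
rep-resp {p = p} e (rep b h a) =
  rep (trans b (prefix-cong p λ _ → e _)) (trans h (e _)) λ i → trans (a i) (e _)

rep-write : ∀ {f g p t a} → Rep f p t → g p ≡ a → (∀ {i} → i ≢ p → f i ≡ g i) → Rep g p (write a t)
rep-write {p = p} (rep b h af) ga e =
  rep (trans b (prefix-cong p λ i<p → e (<⇒≢ i<p))) (sym ga)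
      λ i → trans (af i) (e (<⇒≢ (s≤s (m≤m+n p i)) ∘ sym))

rep-right : ∀ {f p t} → Rep f p t → Rep f (suc p) (move right t)
rep-right {f} {p} {tape _ _ []}      (rep b h a) = rep (cong₂ _∷_ h b) (trans (a 0) (cong f (+-identityʳ _)))
  λ i → trans (a (suc i)) (cong f (+-suc (suc p) i))
rep-right {f} {p} {tape _ _ (_ ∷ _)} (rep b h a) = rep (cong₂ _∷_ h b) (trans (a 0) (cong f (+-identityʳ _)))
  λ i → trans (a (suc i)) (cong f (+-suc (suc p) i))

rep-left : ∀ {f p t} → Rep f (suc p) t → Rep f p (move left t)
rep-left {f} {p} {tape (_ ∷ _) h as} (rep refl h≡ a) = rep refl refl λ where
  zero    → trans h≡ (cong f (sym (+-identityʳ _)))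
  (suc i) → trans (a i) (cong f (sym (+-suc (suc p) i)))

-- Words and registers are indexed by all numbers, although there are only `K` tapes; this keeps
-- register arithmetic out of `Fin`. The output tape is kept literally, as its contents have to be
-- read off in the end.
record Store : Set where
  constructor store
  field
    out   : Tape 1
    words : ℕ → List Bool
    regs  : ℕ → ℕ

open Store public

infixl 9 _[_≔_]

_[_≔_] : Store → ℕ → ℕ → Store
S [ r ≔ v ] = record S { regs = λ q → if q ≡ᵇ r then v else regs S q }

regs-same : ∀ S r {v} → regs (S [ r ≔ v ]) r ≡ v
regs-same S r with r ≡ᵇ r | same? r r
... | true  | _        = refl
... | false | differ d = ⊥-elim (d refl)

regs-other : ∀ S {r q v} → q ≢ r → regs (S [ r ≔ v ]) q ≡ regs S q
regs-other S {r} {q} d with q ≡ᵇ r | same? q r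
... | true  | same e = ⊥-elim (d e)
... | false | _      = refl

infix 4 _≈_

-- Stores contain functions, so without extensionality they can only be compared pointwise.
record _≈_ (S S′ : Store) : Set where
  constructor same-store
  field
    out-≈   : out S ≡ out S′
    words-≈ : ∀ q → words S q ≡ words S′ q
    regs-≈  : ∀ q → regs S q ≡ regs S′ q

positive : Sym → Bool
positive marker = false
positive _      = true

positive-cells : ∀ w p → positive (cells w (suc p)) ≡ true
positive-cells w p with nth w p
... | just _  = refl
... | nothing = refl

-- Specifications of programs by their effect on stores

module Stores (C : Set) (K : ℕ) where
  open Programs C K public

  infix 4 _∼_

  record _∼_ (T : Tapes) (S : Store) : Set where
    constructor rel
    field
      out≡ : lookup T zero ≡ out S
      reps : ∀ τ → Rep (cells (words S (toℕ τ))) (regs S (toℕ τ)) (lookup T (suc τ))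

  ∼-resp : ∀ {T S S′} → S ≈ S′ → T ∼ S → T ∼ S′
  ∼-resp {T} {S} {S′} (same-store o w r) (rel o′ reps) = rel (trans o′ o) λ τ →
    subst (λ p → Rep (cells (words S′ (toℕ τ))) p (lookup T (suc τ))) (r _)
      (rep-resp (λ i → cong (λ v → cells v i) (w _)) (reps τ))

  -- The step count and the final tapes are fixed before the choices are quantified. So a specified
  -- program behaves deterministically even in a nondeterministic machine.
  Spec : Prog → Store → Store → ℕ → Set
  Spec p S S′ t = ∀ {T} → T ∼ S → ∃[ n ] n ≤ t × ∃[ T′ ] T′ ∼ S′ ×
                  ((cs : Vec C n) → p ⊢ T ⇓[ toList cs ] T′)

  spec-resp : ∀ {p S S′ S″ t} → S′ ≈ S″ → Spec p S S′ t → Spec p S S″ t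
  spec-resp e s T∼S with n , n≤ , T′ , T′∼ , d ← s T∼S = n , n≤ , T′ , ∼-resp e T′∼ , d

  spec-≤ : ∀ {p S S′ t u} → t ≤ u → Spec p S S′ t → Spec p S S′ u
  spec-≤ t≤u s T∼S with n , n≤ , rest ← s T∼S = n , ≤-trans n≤ t≤u , rest

  infixr 5 _⨟ₛ_

  _⨟ₛ_ : ∀ {p q S S′ S″ t u} → Spec p S S′ t → Spec q S′ S″ u → Spec (p ⨟ q) S S″ (t + u)
  (_⨟ₛ_ {p} {q} s s′) {T} T∼S
    with n , n≤ , T′ , T′∼ , d ← s T∼S
    with m , m≤ , T″ , T″∼ , e ← s′ T′∼ = n + m , +-mono-≤ n≤ m≤ , T″ , T″∼ , λ cs → lemma cs
    where
    lemma : (cs : Vec C (n + m)) → p ⨟ q ⊢ T ⇓[ toList cs ] T″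
    lemma cs with xs , ys , refl ← Vec.splitAt n cs =
      subst (p ⨟ q ⊢ T ⇓[_] T″) (sym (toList-++ xs ys)) (d xs ⨟ e ys)

  spec-stop : ∀ {g p S} → (∀ {T} → T ∼ S → g (heads T) ≡ false) → Spec (while g p) S S 1
  spec-stop fail T∼S = 1 , ≤-refl , _ , T∼S , λ { (c ∷ []) → stop (fail T∼S) }

  spec-again : ∀ {g p S S′ S″ t u} → (∀ {T} → T ∼ S → g (heads T) ≡ true) →
               Spec p S S′ t → Spec (while g p) S′ S″ u → Spec (while g p) S S″ (suc (t + u))
  spec-again {g} {p} pass s s′ {T} T∼S
    with n , n≤ , T′ , T′∼ , d ← s T∼S
    with m , m≤ , T″ , T″∼ , e ← s′ T′∼ = suc (n + m) , s≤s (+-mono-≤ n≤ m≤) , T″ , T″∼ , λ cs → lemma cs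
    where
    lemma : (cs : Vec C (suc (n + m))) → while g p ⊢ T ⇓[ toList cs ] T″
    lemma (c ∷ cs) with xs , ys , refl ← Vec.splitAt n cs =
      subst (λ zs → while g p ⊢ T ⇓[ c ∷ zs ] T″) (sym (toList-++ xs ys)) (again (pass T∼S) (d xs) (e ys))

  symbol : Syms → ℕ → Sym
  symbol a r = at blank (toList a) (suc r)

  at-toList : ∀ {n} (a : Vec Sym n) i → at blank (toList a) (toℕ i) ≡ lookup a i
  at-toList (_ ∷ _) zero    = refl
  at-toList (_ ∷ a) (suc i) = at-toList a i

  symbol-∼ : ∀ {T S r} → r < K → T ∼ S → symbol (heads T) r ≡ cells (words S r) (regs S r)
  symbol-∼ {T} {S} {r} r<K (rel _ reps)
    with head≡ ← Rep.head≡ (reps (fromℕ< r<K)) = begin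
    symbol (heads T) r                 ≡⟨ cong (symbol (heads T)) (toℕ-fromℕ< r<K) ⟨
    symbol (heads T) (toℕ τ)           ≡⟨ at-toList (heads T) (suc τ) ⟩
    lookup (heads T) (suc τ)           ≡⟨ lookup-map (suc τ) Tape.head T ⟩
    Tape.head (lookup T (suc τ))       ≡⟨ head≡ ⟩
    cells (words S (toℕ τ)) (regs S (toℕ τ)) ≡⟨ cong (λ q → cells (words S q) (regs S q)) (toℕ-fromℕ< r<K) ⟩
    cells (words S r) (regs S r)       ∎
    where
    open ≡-Reasoning
    τ = fromℕ< r<K

  Action : Set
  Action = Syms → ℕ → Sym → Sym × Move

  -- Tape 0 is the output tape, register r lives on tape r + 1.
  oper : (C → Action) → Prog
  oper φ = op λ c a → tabulate λ i → φ c a (toℕ i) (lookup a i)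

  lookup-perform : ∀ (φ : Action) T i →
    lookup (perform (tabulate λ i → φ (heads T) (toℕ i) (lookup (heads T) i)) T) i ≡
    act (φ (heads T) (toℕ i) (Tape.head (lookup T i))) (lookup T i)
  lookup-perform φ T i = trans (lookup-zipWith act i (tabulate λ i → φ (heads T) (toℕ i) (lookup (heads T) i)) T)
    (cong (λ a → act a (lookup T i)) (trans (lookup∘tabulate (λ i → φ (heads T) (toℕ i) (lookup (heads T) i)) i)
      (cong (φ (heads T) (toℕ i)) (lookup-map i Tape.head T))))

  perform-∼ : ∀ {φ : Action} {T S S′} → T ∼ S →
    (∀ t → t ≡ out S → act (φ (heads T) 0 (Tape.head t)) t ≡ out S′) →
    (∀ (τ : Fin K) t → Rep (cells (words S (toℕ τ))) (regs S (toℕ τ)) t →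
       Rep (cells (words S′ (toℕ τ))) (regs S′ (toℕ τ)) (act (φ (heads T) (suc (toℕ τ)) (Tape.head t)) t)) →
    perform (tabulate λ i → φ (heads T) (toℕ i) (lookup (heads T) i)) T ∼ S′
  perform-∼ {φ} {T} {S} {S′} (rel o reps) ho hr =
    rel (trans (lookup-perform φ T zero) (ho _ o)) λ τ →
      subst (Rep _ _) (sym (lookup-perform φ T (suc τ))) (hr τ _ (reps τ))

  spec-oper : ∀ {φ : Action} {S S′} →
    (∀ {T} → T ∼ S → ∀ t → t ≡ out S → act (φ (heads T) 0 (Tape.head t)) t ≡ out S′) →
    (∀ {T} → T ∼ S → ∀ (τ : Fin K) t → Rep (cells (words S (toℕ τ))) (regs S (toℕ τ)) t →
       Rep (cells (words S′ (toℕ τ))) (regs S′ (toℕ τ)) (act (φ (heads T) (suc (toℕ τ)) (Tape.head t)) t)) →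
    Spec (oper λ _ → φ) S S′ 1
  spec-oper {φ} ho hr T∼S = 1 , ≤-refl , _ , perform-∼ {φ} T∼S (ho T∼S) (hr T∼S) , λ { (c ∷ []) → op }

  skipping : Action
  skipping _ _ x = x , stay

  skip : Prog
  skip = oper λ _ → skipping

  spec-skip : ∀ {S} → Spec skip S S 1
  spec-skip = spec-oper {skipping} (λ _ _ e → e) λ _ _ _ r → r

  -- The marker stops the head at position 0, which turns a move to the left into the truncated
  -- predecessor.
  clip : Sym → Sym × Move
  clip marker = marker , stay
  clip x      = x , left

  clip-cells : ∀ w p → clip (cells w (suc p)) ≡ (cells w (suc p) , left)
  clip-cells w p with nth w p
  ... | just _  = refl
  ... | nothing = refl

  incrementing decrementing : ℕ → Action
  incrementing r _ zero    x = x , stay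
  incrementing r _ (suc q) x = x , (if q ≡ᵇ r then right else stay)
  decrementing r _ zero    x = x , stay
  decrementing r _ (suc q) x = if q ≡ᵇ r then clip x else (x , stay)

  -- Tests on a word enter the registers as a conditional increment, which replaces a branching
  -- construct.
  flagging : ℕ → (Sym → Bool) → ℕ → Action
  flagging w g r _ zero    x = x , stay
  flagging w g r a (suc q) x = x , (if (q ≡ᵇ r) ∧ g (symbol a w) then right else stay)

  inc dec : ℕ → Prog
  inc r = oper λ _ → incrementing r
  dec r = oper λ _ → decrementing r

  flag : ℕ → (Sym → Bool) → ℕ → Prog
  flag w g r = oper λ _ → flagging w g r

  spec-inc : ∀ {S r v} → suc (regs S r) ≡ v → Spec (inc r) S (S [ r ≔ v ]) 1
  spec-inc {S} {r} refl = spec-oper {incrementing r} (λ _ _ e → e) λ _ τ t → go τ t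
    where
    go : ∀ (τ : Fin K) t → Rep (cells (words S (toℕ τ))) (regs S (toℕ τ)) t →
         Rep (cells (words S (toℕ τ))) (regs (S [ r ≔ suc (regs S r) ]) (toℕ τ))
             (act (Tape.head t , (if toℕ τ ≡ᵇ r then right else stay)) t)
    go τ t p with toℕ τ ≡ᵇ r | same? (toℕ τ) r
    ... | true  | same refl = rep-right p
    ... | false | _         = p

  spec-dec : ∀ {S r v} → pred (regs S r) ≡ v → Spec (dec r) S (S [ r ≔ v ]) 1
  spec-dec {S} {r} refl = spec-oper {decrementing r} (λ _ _ e → e) λ _ τ t → go τ t
    where
    clipped : ∀ {w p t} → Rep (cells w) p t → Rep (cells w) (pred p) (act (clip (Tape.head t)) t)
    clipped {p = zero}  {t} (rep b refl a) = rep b refl a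
    clipped {w} {suc p} {t} r@(rep _ h≡ _) =
      subst (λ c → Rep (cells w) p (act c t))
        (sym (trans (cong clip h≡) (trans (clip-cells w p) (cong (_, left) (sym h≡))))) (rep-left r)
    go : ∀ (τ : Fin K) t → Rep (cells (words S (toℕ τ))) (regs S (toℕ τ)) t →
         Rep (cells (words S (toℕ τ))) (regs (S [ r ≔ pred (regs S r) ]) (toℕ τ))
             (act (if toℕ τ ≡ᵇ r then clip (Tape.head t) else (Tape.head t , stay)) t)
    go τ t p with toℕ τ ≡ᵇ r | same? (toℕ τ) r
    ... | true  | same refl = clipped p
    ... | false | _         = p

  spec-flag : ∀ {S w g r v} → w < K → (if g (cells (words S w) (regs S w)) then 1 else 0) + regs S r ≡ v →
              Spec (flag w g r) S (S [ r ≔ v ]) 1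
  spec-flag {S} {w} {g} {r} w<K refl = spec-oper {flagging w g r} (λ _ _ e → e) λ {T} T∼S τ t p →
    subst (λ x → Rep _ _ (act (Tape.head t , (if (toℕ τ ≡ᵇ r) ∧ g x then right else stay)) t))
      (sym (symbol-∼ w<K T∼S)) (go τ t p)
    where
    c : Sym
    c = cells (words S w) (regs S w)
    go : ∀ (τ : Fin K) t → Rep (cells (words S (toℕ τ))) (regs S (toℕ τ)) t →
         Rep (cells (words S (toℕ τ))) (regs (S [ r ≔ (if g c then 1 else 0) + regs S r ]) (toℕ τ))
             (act (Tape.head t , (if (toℕ τ ≡ᵇ r) ∧ g c then right else stay)) t)
    go τ t p with toℕ τ ≡ᵇ r | same? (toℕ τ) r | g c
    ... | true  | same refl | true  = rep-right p
    ... | true  | same refl | false = p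
    ... | false | _         | _     = p

  loop : ℕ → Prog → Prog
  loop r = while λ a → positive (symbol a r)

  -- S i is the store after i rounds.
  spec-loop : ∀ {r p t} (S : ℕ → Store) n → r < K → (∀ i → i ≤ n → regs (S i) r ≡ n ∸ i) →
              (∀ i → i < n → Spec p (S i) (S (suc i)) t) →
              Spec (loop r p) (S 0) (S n) (suc (n * suc t))
  spec-loop {r} S zero r<K c _ = spec-stop λ T∼S →
    cong positive (trans (symbol-∼ r<K T∼S) (cong (cells _) (c 0 z≤n)))
  spec-loop {r} {p} {t} S (suc n) r<K c s = spec-≤ (≤-reflexive (cong suc (+-suc t _)))
    (spec-again
      (λ T∼S → trans (cong positive (trans (symbol-∼ r<K T∼S) (cong (cells _) (c 0 z≤n))))
                     (positive-cells (words (S 0) r) n))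
      (s 0 (s≤s z≤n))
      (spec-loop (S ∘ suc) n r<K (λ i i≤n → c (suc i) (s≤s i≤n)) (λ i i<n → s (suc i) (s≤s i<n))))

-- Arithmetic terms and their evaluation by machines

sumTo : ℕ → (ℕ → ℕ) → ℕ
sumTo zero    f = 0
sumTo (suc n) f = sumTo n f + f n

sumTo-cong : ∀ n {f g : ℕ → ℕ} → (∀ i → i < n → f i ≡ g i) → sumTo n f ≡ sumTo n g
sumTo-cong zero    e = refl
sumTo-cong (suc n) e = cong₂ _+_ (sumTo-cong n λ i i<n → e i (m<n⇒m<1+n i<n)) (e n ≤-refl)

sumTo-const : ∀ n c → sumTo n (λ _ → c) ≡ n * c
sumTo-const zero    c = refl
sumTo-const (suc n) c = trans (cong (_+ c) (sumTo-const n c)) (+-comm (n * c) c)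

sumTo-≤ : ∀ n {f : ℕ → ℕ} {c} → (∀ i → i < n → f i ≤ c) → sumTo n f ≤ n * c
sumTo-≤ zero    _ = z≤n
sumTo-≤ (suc n) {f} {c} h = ≤-trans
  (+-mono-≤ (sumTo-≤ n λ i i<n → h i (m<n⇒m<1+n i<n)) (h n ≤-refl)) (≤-reflexive (+-comm (n * c) c))

infix 4 _==_

_==_ : Maybe Bool → Maybe Bool → Bool
nothing    == nothing    = true
just true  == just true  = true
just false == just false = true
_          == _          = false

==⇒≡ : ∀ a b → T (a == b) → a ≡ b
==⇒≡ nothing      nothing      _ = refl
==⇒≡ (just true)  (just true)  _ = refl
==⇒≡ (just false) (just false) _ = refl
==⇒≡ nothing      (just true)  ()
==⇒≡ nothing      (just false) ()
==⇒≡ (just true)  nothing      ()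
==⇒≡ (just false) nothing      ()
==⇒≡ (just true)  (just false) ()
==⇒≡ (just false) (just true)  ()

==-refl : ∀ a → T (a == a)
==-refl nothing      = _
==-refl (just true)  = _
==-refl (just false) = _

reading : Sym → Maybe Bool
reading (bit b) = just b
reading _       = nothing

reading-cells : ∀ w p → reading (cells w (suc p)) ≡ nth w p
reading-cells w p with nth w p
... | just _  = refl
... | nothing = refl

-- The words are the input (0) and, in nondeterministic machines, the guess (1).
data Term : ℕ → Set where
  var         : ∀ {n} → Fin n → Term n
  lit         : ∀ {n} → ℕ → Term n
  _⊞_ _⊟_ _⊠_ : ∀ {n} → Term n → Term n → Term n
  cell        : ∀ {n} → Fin 2 → Maybe Bool → Term n → Term n
  ∑           : ∀ {n} → Term n → Term (suc n) → Term n
  wk          : ∀ {n} → Term n → Term (suc n)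

infixl 6 _⊞_ _⊟_
infixl 7 _⊠_

⟦_⟧ : ∀ {n} → Term n → (ℕ → List Bool) → Vec ℕ n → ℕ
⟦ var i ⟧      W v       = lookup v i
⟦ lit c ⟧      W v       = c
⟦ a ⊞ b ⟧      W v       = ⟦ a ⟧ W v + ⟦ b ⟧ W v
⟦ a ⊟ b ⟧      W v       = ⟦ a ⟧ W v ∸ ⟦ b ⟧ W v
⟦ a ⊠ b ⟧      W v       = ⟦ a ⟧ W v * ⟦ b ⟧ W v
⟦ cell w o a ⟧ W v       = if o == nth (W (toℕ w)) (⟦ a ⟧ W v) then 1 else 0
⟦ ∑ a b ⟧      W v       = sumTo (⟦ a ⟧ W v) λ i → ⟦ b ⟧ W (i ∷ v)
⟦ wk a ⟧       W (_ ∷ v) = ⟦ a ⟧ W v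

-- Here b bounds the values of the variables.
valueBound timeBound : ∀ {n} → Term n → ℕ → ℕ

valueBound (var i)      b = b
valueBound (lit c)      b = c
valueBound (s ⊞ t)      b = valueBound s b + valueBound t b
valueBound (s ⊟ t)      b = valueBound s b
valueBound (s ⊠ t)      b = valueBound s b * valueBound t b
valueBound (cell _ _ t) b = 1
-- The new variable stays below the value of `s`. The sum bounds it together with the old variables;
-- a maximum would do too but is not a polynomial.
valueBound (∑ s t)      b = valueBound s b * valueBound t (b + valueBound s b)
valueBound (wk t)       b = valueBound t b

-- The cost of `sumProg`: computing the number of rounds, then in each round a test, the body,
-- draining its result at three steps per unit and two counter updates, and finally clearing the
-- index.
sumTime : ℕ → ℕ → ℕ → ℕ → ℕ
sumTime rounds time body result =
  time + (suc (rounds * suc (body + (suc (result * 3) + (1 + 1)))) + suc (rounds * 2))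

timeBound (var i)      b = suc (b * 4) + suc (b * 3)
timeBound (lit c)      b = suc c
timeBound (s ⊞ t)      b = timeBound s b + (timeBound t b + suc (valueBound t b * 3))
timeBound (s ⊟ t)      b = timeBound s b + (timeBound t b + suc (valueBound t b * 3))
timeBound (s ⊠ t)      b = sumTime (valueBound s b) (timeBound s b) (timeBound t b) (valueBound t b)
timeBound (cell _ _ t) b =
  timeBound t b + (1 + (suc (valueBound t b * 3) + (1 + suc (suc (valueBound t b) * 2))))
timeBound (∑ s t)      b =
  sumTime (valueBound s b) (timeBound s b) (timeBound t (b + valueBound s b)) (valueBound t (b + valueBound s b))
timeBound (wk t)       b = timeBound t b

poly-sumTime : ∀ {f g h k} → IsPoly f → IsPoly g → IsPoly h → IsPoly k →
               IsPoly (λ b → sumTime (f b) (g b) (h b) (k b))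
poly-sumTime f g h k =
  poly-+ g (poly-+ (poly-suc (poly-* f (poly-suc (poly-+ h (poly-+ (poly-suc (poly-* k (poly-const 3))) (poly-const 2))))))
                   (poly-suc (poly-* f (poly-const 2))))

poly-value : ∀ {n} (t : Term n) → IsPoly (valueBound t)
poly-value (var i)      = poly-id
poly-value (lit c)      = poly-const c
poly-value (s ⊞ t)      = poly-+ (poly-value s) (poly-value t)
poly-value (s ⊟ t)      = poly-value s
poly-value (s ⊠ t)      = poly-* (poly-value s) (poly-value t)
poly-value (cell _ _ t) = poly-const 1
poly-value (∑ s t)      = poly-* (poly-value s) (poly-∘ (poly-value t) (poly-+ poly-id (poly-value s)))
poly-value (wk t)       = poly-value t

poly-time : ∀ {n} (t : Term n) → IsPoly (timeBound t)
poly-time (var i)      = poly-+ (poly-suc (poly-* poly-id (poly-const 4))) (poly-suc (poly-* poly-id (poly-const 3)))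
poly-time (lit c)      = poly-const (suc c)
poly-time (s ⊞ t)      = poly-+ (poly-time s) (poly-+ (poly-time t) (poly-suc (poly-* (poly-value t) (poly-const 3))))
poly-time (s ⊟ t)      = poly-+ (poly-time s) (poly-+ (poly-time t) (poly-suc (poly-* (poly-value t) (poly-const 3))))
poly-time (s ⊠ t)      = poly-sumTime (poly-value s) (poly-time s) (poly-time t) (poly-value t)
poly-time (cell _ _ t) =
  poly-+ (poly-time t) (poly-suc (poly-+ (poly-suc (poly-* (poly-value t) (poly-const 3)))
    (poly-suc (poly-suc (poly-* (poly-suc (poly-value t)) (poly-const 2))))))
poly-time (∑ s t)      =
  poly-sumTime (poly-value s) (poly-time s) (poly-∘ (poly-time t) b) (poly-∘ (poly-value t) b)
  where b = poly-+ poly-id (poly-value s)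
poly-time (wk t)       = poly-time t

infix 4 _≼*_

_≼*_ : ∀ {n} → Vec ℕ n → ℕ → Set
v ≼* b = ∀ i → lookup v i ≤ b

value-≤ : ∀ {n} (t : Term n) {W v b} → v ≼* b → ⟦ t ⟧ W v ≤ valueBound t b
value-≤ (var i)      h = h i
value-≤ (lit c)      h = ≤-refl
value-≤ (s ⊞ t)      h = +-mono-≤ (value-≤ s h) (value-≤ t h)
value-≤ (s ⊟ t) {W} {v} h = ≤-trans (m∸n≤m (⟦ s ⟧ W v) (⟦ t ⟧ W v)) (value-≤ s h)
value-≤ (s ⊠ t)      h = *-mono-≤ (value-≤ s h) (value-≤ t h)
value-≤ (cell w o t) {W} {v} h with o == nth (W (toℕ w)) (⟦ t ⟧ W v)
... | true  = ≤-refl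
... | false = z≤n
value-≤ (∑ s t) {W} {v} {b} h = ≤-trans
  (sumTo-≤ (⟦ s ⟧ W v) λ i i<n → value-≤ t λ where
    zero    → ≤-trans (<⇒≤ i<n) (≤-trans (value-≤ s h) (m≤n+m _ b))
    (suc j) → ≤-trans (h j) (m≤m+n b _))
  (*-monoˡ-≤ _ (value-≤ s h))
value-≤ (wk t) {v = _ ∷ v} h = value-≤ t (h ∘ suc)

regs-≡ : ∀ {S ρ ρ′} → (∀ q → ρ q ≡ ρ′ q) → store (out S) (words S) ρ ≈ store (out S) (words S) ρ′
regs-≡ e = same-store refl (λ _ → refl) e

≈-sym : ∀ {S S′} → S ≈ S′ → S′ ≈ S
≈-sym (same-store o w r) = same-store (sym o) (λ q → sym (w q)) λ q → sym (r q)

-- Loop invariants are written as assignments to the initial store. This identifies the invariant of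
-- round 0 with that store, and removes assignments that restore a register.
≔-own : ∀ S {r v} → v ≡ regs S r → S [ r ≔ v ] ≈ S
≔-own S {r} refl = regs-≡ {S} λ q → lemma q
  where
  lemma : ∀ q → (if q ≡ᵇ r then regs S r else regs S q) ≡ regs S q
  lemma q with q ≡ᵇ r | same? q r
  ... | true  | same refl = refl
  ... | false | _         = refl

≔-value : ∀ S {r v w} → v ≡ w → S [ r ≔ v ] ≈ S [ r ≔ w ]
≔-value S refl = same-store refl (λ _ → refl) λ _ → refl

≔-cong : ∀ {S S′ r v} → S ≈ S′ → S [ r ≔ v ] ≈ S′ [ r ≔ v ]
≔-cong {r = r} (same-store o w e) = same-store o w λ q → cong (if q ≡ᵇ r then _ else_) (e q)

≈-trans : ∀ {S S′ S″} → S ≈ S′ → S′ ≈ S″ → S ≈ S″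
≈-trans (same-store o w r) (same-store o′ w′ r′) =
  same-store (trans o o′) (λ q → trans (w q) (w′ q)) λ q → trans (r q) (r′ q)

-- The number of registers that the evaluation uses from its base on.
need : ∀ {n} → Term n → ℕ
need (var i)      = 2
need (lit c)      = 1
need (s ⊞ t)      = 2 + (need s + need t)
need (s ⊟ t)      = 2 + (need s + need t)
need (s ⊠ t)      = 4 + (need s + need t)
need (cell w o t) = 2 + need t
need (∑ s t)      = 4 + (need s + need t)
need (wk t)       = need t

need-pos : ∀ {n} (t : Term n) → 0 < need t
need-pos (var i)      = s≤s z≤n
need-pos (lit c)      = s≤s z≤n
need-pos (s ⊞ t)      = s≤s z≤n
need-pos (s ⊟ t)      = s≤s z≤n
need-pos (s ⊠ t)      = s≤s z≤n
need-pos (cell w o t) = s≤s z≤n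
need-pos (∑ s t)      = s≤s z≤n
need-pos (wk t)       = need-pos t

-- Compilation of terms and its correctness

module Compile (C : Set) (K : ℕ) where
  open Stores C K public

  spec-from : ∀ {p S S′ S″ t} → S ≈ S′ → Spec p S′ S″ t → Spec p S S″ t
  spec-from e s T∼S = s (∼-resp e T∼S)

  clear : ℕ → Prog
  clear r = loop r (dec r)

  spec-clear : ∀ {S r} → r < K → Spec (clear r) S (S [ r ≔ 0 ]) (suc (regs S r * 2))
  spec-clear {S} {r} r<K =
    spec-from (≈-sym (≔-own S refl))
      (spec-resp (≔-value S (n∸n≡0 n))
        (spec-loop (λ i → S [ r ≔ n ∸ i ]) n r<K (λ i _ → regs-same S r) λ i _ →
          spec-resp (regs-≡ {S} λ q → over q i)
            (spec-dec (trans (cong pred (regs-same S r)) (pred[m∸n]≡m∸[1+n] n i)))))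
    where
    n : ℕ
    n = regs S r
    over : ∀ q i → regs (S [ r ≔ n ∸ i ] [ r ≔ n ∸ suc i ]) q ≡ regs (S [ r ≔ n ∸ suc i ]) q
    over q i with q ≡ᵇ r
    ... | true  = refl
    ... | false = refl

  drain : ℕ → ℕ → Prog
  drain r d = loop r (dec r ⨟ inc d)

  spec-drain : ∀ {S r d} → r < K → r ≢ d →
               Spec (drain r d) S (S [ r ≔ 0 ] [ d ≔ regs S d + regs S r ]) (suc (regs S r * 3))
  spec-drain {S} {r} {d} r<K r≢d =
    spec-from (≈-sym (≈-trans (≔-own (S [ r ≔ n ∸ 0 ]) (trans (+-identityʳ m) (sym (regs-other S (r≢d ∘ sym))))) (≔-own S refl)))
      (spec-resp (≔-cong (≔-value S (n∸n≡0 n)))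
        (spec-loop S′ n r<K (λ i _ → counter i) λ i _ →
          spec-resp (regs-≡ {S} (over i))
            (spec-dec (trans (cong pred (counter i)) (pred[m∸n]≡m∸[1+n] n i)) ⨟ₛ
             spec-inc (trans (cong suc (trans (regs-other (S′ i) (r≢d ∘ sym)) (regs-same (S [ r ≔ n ∸ i ]) d))) (sym (+-suc m i))))))
    where
    n m : ℕ
    n = regs S r
    m = regs S d
    S′ : ℕ → Store
    S′ i = S [ r ≔ n ∸ i ] [ d ≔ m + i ]
    counter : ∀ i → regs (S′ i) r ≡ n ∸ i
    counter i = trans (regs-other (S [ r ≔ n ∸ i ]) r≢d) (regs-same S r)
    over : ∀ i q → regs (S′ i [ r ≔ n ∸ suc i ] [ d ≔ m + suc i ]) q ≡ regs (S′ (suc i)) q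
    over i q with q ≡ᵇ r | q ≡ᵇ d
    ... | _     | true  = refl
    ... | true  | false = refl
    ... | false | false = refl

  incs : ℕ → ℕ → Prog
  incs zero    k = skip
  incs (suc c) k = inc k ⨟ incs c k

  -- Register `k` accumulates the sum, `1 + k` counts the remaining rounds, `2 + k` is the summation
  -- index, and the body leaves its value in `3 + k`.
  sumProg : ℕ → Prog → Prog → Prog
  sumProg k rounds body =
    rounds ⨟ loop (1 + k) (body ⨟ drain (3 + k) k ⨟ inc (2 + k) ⨟ dec (1 + k)) ⨟ clear (2 + k)

  -- Variable i lives in register lookup σ i. The value is left in register
  -- k, and the registers from k on are zero before.
  compile : ∀ {n} → Term n → Vec ℕ n → ℕ → Prog
  -- A loop destroys the counter that it runs on, so the variable is moved into two registers at
  -- once and one of the copies is moved back.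
  compile (var i)      σ k =
    loop (lookup σ i) (dec (lookup σ i) ⨟ inc k ⨟ inc (suc k)) ⨟ drain (suc k) (lookup σ i)
  compile (lit c)      σ k = incs c k
  compile (s ⊞ t)      σ k = compile s σ k ⨟ compile t σ (suc k) ⨟ drain (suc k) k
  compile (s ⊟ t)      σ k = compile s σ k ⨟ compile t σ (suc k) ⨟ loop (suc k) (dec (suc k) ⨟ dec k)
  compile (s ⊠ t)      σ k = sumProg k (compile s σ (1 + k)) (compile t σ (3 + k))
  -- The head of the word tape is itself a register. The single `inc` before the loop skips the
  -- marker, and the final `clear` rewinds the head for the next access.
  compile (cell w o t) σ k =
    compile t σ (suc k) ⨟ inc (toℕ w) ⨟ loop (suc k) (dec (suc k) ⨟ inc (toℕ w)) ⨟
    flag (toℕ w) ((o ==_) ∘ reading) k ⨟ clear (toℕ w)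
  compile (∑ s t)      σ k = sumProg k (compile s σ (1 + k)) (compile t (2 + k ∷ σ) (3 + k))
  compile (wk t)       σ k = compile t (Vec.tail σ) k

  -- Registers 0 and 1 are the heads of the two word tapes and have to rest on the marker. The
  -- variables live strictly between them and the scratch registers, so no evaluation overwrites
  -- them.
  record Ready {n} (S : Store) (k : ℕ) (σ v : Vec ℕ n) : Set where
    constructor ready
    field
      fresh   : ∀ r → k ≤ r → regs S r ≡ 0
      rewound : ∀ (w : Fin 2) → regs S (toℕ w) ≡ 0
      values  : ∀ i → regs S (lookup σ i) ≡ lookup v i
      bounds  : ∀ i → 2 ≤ lookup σ i × lookup σ i < k
      base    : 2 ≤ k

  open Ready

  ready-next : ∀ {n S k} {σ v : Vec ℕ n} → Ready S k σ v → Ready S (suc k) σ v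
  ready-next (ready f w v b k) =
    ready (λ r k<r → f r (<⇒≤ k<r)) w v (λ i → proj₁ (b i) , m<n⇒m<1+n (proj₂ (b i))) (m≤n⇒m≤1+n k)

  ready-set : ∀ {n S k x} {σ v : Vec ℕ n} → Ready S k σ v → Ready (S [ k ≔ x ]) (suc k) σ v
  ready-set {S = S} (ready f w v b k) =
    ready (λ r k<r → trans (regs-other S (<⇒≢ k<r ∘ sym)) (f r (<⇒≤ k<r)))
          (λ z → trans (regs-other S (<⇒≢ (<-≤-trans (toℕ<n z) k))) (w z))
          (λ i → trans (regs-other S (<⇒≢ (proj₂ (b i)))) (v i))
          (λ i → proj₁ (b i) , m<n⇒m<1+n (proj₂ (b i))) (m≤n⇒m≤1+n k)

  ready-bind : ∀ {n S k x} {σ v : Vec ℕ n} → Ready S k σ v → Ready (S [ k ≔ x ]) (suc k) (k ∷ σ) (x ∷ v)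
  ready-bind {S = S} {k} R with ready f w v b k′ ← ready-set {S = S} R =
    ready f w (λ { zero → regs-same S k ; (suc i) → v i }) (λ { zero → base R , ≤-refl ; (suc i) → b i }) k′

  room : ∀ {a b} c → a + c ≡ b → b ≤ K → a ≤ K
  room {a} c refl = ≤-trans (m≤m+n a c)

  spec-incs : ∀ {S k} c → Spec (incs c k) S (S [ k ≔ c + regs S k ]) (suc c)
  spec-incs {S} zero = spec-resp (≈-sym (≔-own S refl)) spec-skip
  spec-incs {S} {k} (suc c) = spec-resp (regs-≡ {S} over) (spec-inc refl ⨟ₛ spec-incs c)
    where
    over : ∀ q → regs (S [ k ≔ suc (regs S k) ] [ k ≔ c + regs (S [ k ≔ suc (regs S k) ]) k ]) q ≡
                 regs (S [ k ≔ suc (c + regs S k) ]) q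
    over q with q ≡ᵇ k
    ... | true  = trans (cong (c +_) (regs-same S k)) (+-suc c _)
    ... | false = refl

  -- The invariant `S′ i` has the partial sum, `n ∸ i` and `i` in the first three registers.
  -- Register `3 + k` is zero again between rounds because `drain` empties it, and after the last
  -- round the counter has run out by itself.
  spec-sumProg : ∀ {S k n f p q b t₁ t₂ m} → 3 + k < K → (∀ r → k ≤ r → regs S r ≡ 0) →
    Spec p S (S [ 1 + k ≔ n ]) t₁ → n ≤ m → (∀ i → i < n → f i ≤ b) →
    (∀ i → i < n → let S′ = S [ k ≔ sumTo i f ] [ 1 + k ≔ n ∸ i ] [ 2 + k ≔ i ] in
                   Spec q S′ (S′ [ 3 + k ≔ f i ]) t₂) →
    Spec (sumProg k p q) S (S [ k ≔ sumTo n f ]) (sumTime m t₁ t₂ b)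
  spec-sumProg {S} {k} {n} {f} {p} {q} {b} {t₁} {t₂} {m} 3+k<K fresh P n≤m f≤b Q =
    P ⨟ₛ spec-from start (spec-≤ (s≤s (*-monoˡ-≤ _ n≤m)) (spec-loop S′ n (<-trans (s≤s (s≤s (n≤1+n k))) 3+k<K) counter body))
      ⨟ₛ spec-≤ (s≤s (*-monoˡ-≤ 2 (≤-trans (≤-reflexive (regs-same (S [ k ≔ sumTo n f ] [ 1 + k ≔ n ∸ n ]) (2 + k))) n≤m)))
           (spec-resp finish (spec-clear (<⇒≤ 3+k<K)))
    where
    S′ : ℕ → Store
    S′ i = S [ k ≔ sumTo i f ] [ 1 + k ≔ n ∸ i ] [ 2 + k ≔ i ]
    start : S [ 1 + k ≔ n ] ≈ S′ 0
    start = regs-≡ {S} eq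
      where
      eq : ∀ r → regs (S [ 1 + k ≔ n ]) r ≡ regs (S′ 0) r
      eq r with r ≡ᵇ 2 + k | same? r (2 + k) | r ≡ᵇ 1 + k | same? r (1 + k) | r ≡ᵇ k | same? r k
      ... | true  | same refl | true  | same () | _ | _
      ... | true  | same refl | false | _ | _ | _ = fresh (2 + k) (m≤n+m k 2)
      ... | false | _ | true  | _ | _ | _ = refl
      ... | false | _ | false | _ | true  | same refl = fresh k ≤-refl
      ... | false | _ | false | _ | false | _ = refl
    counter : ∀ i → i ≤ n → regs (S′ i) (1 + k) ≡ n ∸ i
    counter i _ = trans (regs-other (S [ k ≔ sumTo i f ] [ 1 + k ≔ n ∸ i ]) {2 + k} {1 + k} (<⇒≢ ≤-refl))
                        (regs-same (S [ k ≔ sumTo i f ]) (1 + k))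
    finish : S′ n [ 2 + k ≔ 0 ] ≈ S [ k ≔ sumTo n f ]
    finish = regs-≡ {S} eq
      where
      eq : ∀ r → regs (S′ n [ 2 + k ≔ 0 ]) r ≡ regs (S [ k ≔ sumTo n f ]) r
      eq r with r ≡ᵇ 2 + k | same? r (2 + k) | r ≡ᵇ 1 + k | same? r (1 + k) | r ≡ᵇ k | same? r k
      ... | true  | same refl | _ | _ | true | same ()
      ... | true  | same refl | _ | _ | false | _ = sym (fresh (2 + k) (m≤n+m k 2))
      ... | false | _ | true  | same refl | true  | same ()
      ... | false | _ | true  | same refl | false | _ = trans (n∸n≡0 n) (sym (fresh (1 + k) (n≤1+n k)))
      ... | false | _ | false | _ | _ | _ = refl
    body : ∀ i → i < n → Spec (q ⨟ drain (3 + k) k ⨟ inc (2 + k) ⨟ dec (1 + k)) (S′ i) (S′ (suc i))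
                              (t₂ + (suc (b * 3) + (1 + 1)))
    body i i<n = spec-resp (regs-≡ {S} eq)
      (Q i i<n ⨟ₛ
       spec-≤ (s≤s (*-monoˡ-≤ 3 (≤-trans (≤-reflexive (regs-same (S′ i) (3 + k))) (f≤b i i<n))))
         (spec-resp (≔-value _ acc) (spec-drain 3+k<K (<⇒≢ (s≤s (m≤n+m k 2)) ∘ sym))) ⨟ₛ
       spec-inc {v = suc i} (cong suc idx) ⨟ₛ
       spec-dec {v = n ∸ suc i} (trans (cong pred ctr) (pred[m∸n]≡m∸[1+n] n i)))
      where
      A B D : Store
      A = S′ i [ 3 + k ≔ f i ]
      B = A [ 3 + k ≔ 0 ] [ k ≔ sumTo (suc i) f ]
      D = B [ 2 + k ≔ suc i ]
      k≢ : ∀ c → k ≢ suc c + k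
      k≢ c = <⇒≢ (s≤s (m≤n+m k c))
      acc : regs A k + regs A (3 + k) ≡ sumTo (suc i) f
      acc = cong₂ _+_
        (trans (regs-other (S′ i) (k≢ 2)) (trans (regs-other (S [ k ≔ sumTo i f ] [ 1 + k ≔ n ∸ i ]) (k≢ 1))
          (trans (regs-other (S [ k ≔ sumTo i f ]) (k≢ 0)) (regs-same S k))))
        (regs-same (S′ i) (3 + k))
      idx : regs B (2 + k) ≡ i
      idx = trans (regs-other (A [ 3 + k ≔ 0 ]) (k≢ 1 ∘ sym)) (trans (regs-other A {3 + k} {2 + k} (<⇒≢ ≤-refl))
        (trans (regs-other (S′ i) {3 + k} {2 + k} (<⇒≢ ≤-refl)) (regs-same (S [ k ≔ sumTo i f ] [ 1 + k ≔ n ∸ i ]) (2 + k))))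
      ctr : regs D (1 + k) ≡ n ∸ i
      ctr = trans (regs-other B {2 + k} {1 + k} (<⇒≢ ≤-refl)) (trans (regs-other (A [ 3 + k ≔ 0 ]) (k≢ 0 ∘ sym))
        (trans (regs-other A {3 + k} {1 + k} (<⇒≢ (n≤1+n _))) (trans (regs-other (S′ i) {3 + k} {1 + k} (<⇒≢ (n≤1+n _))) (counter i (<⇒≤ i<n)))))
      eq : ∀ r → regs (D [ 1 + k ≔ n ∸ suc i ]) r ≡ regs (S′ (suc i)) r
      eq r with r ≡ᵇ 3 + k | same? r (3 + k) | r ≡ᵇ 2 + k | same? r (2 + k) | r ≡ᵇ 1 + k | same? r (1 + k) | r ≡ᵇ k | same? r k
      ... | true | same refl | true | same () | _ | _ | _ | _
      ... | true | same refl | _ | _ | true | same () | _ | _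
      ... | true | same refl | _ | _ | _ | _ | true | same ()
      ... | true | same refl | false | _ | false | _ | false | _ = sym (fresh (3 + k) (m≤n+m k 3))
      ... | false | _ | true | same refl | true | same () | _ | _
      ... | false | _ | true | same refl | false | _ | _ | _ = refl
      ... | false | _ | false | _ | true | _ | _ | _ = refl
      ... | false | _ | false | _ | false | _ | true | _ = refl
      ... | false | _ | false | _ | false | _ | false | _ = refl

  module _ {n S k} {σ v : Vec ℕ n} (R : Ready S k σ v) (i : Fin n) where

    private
      r x : ℕ
      r = lookup σ i
      x = lookup v i

      r<k : r < k
      r<k = proj₂ (bounds R i)

      S′ : ℕ → Store
      -- The invariant of the copying loop: what has left `r` is present in both copies.
      S′ j = S [ r ≔ x ∸ j ] [ k ≔ j ] [ suc k ≔ j ]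

    spec-var : ∀ {b} → 2 + k ≤ K → x ≤ b →
               Spec (compile (var i) σ k) S (S [ k ≔ x ]) (suc (b * 4) + suc (b * 3))
    spec-var {b} 2+k≤K x≤b =
      spec-≤ (s≤s (*-monoˡ-≤ 4 x≤b))
        (spec-from start (spec-loop S′ x (<-trans r<k (<⇒≤ 2+k≤K)) (λ j _ → counter j) body)) ⨟ₛ
      spec-≤ (s≤s (*-monoˡ-≤ 3 (≤-trans (≤-reflexive last) x≤b)))
        (spec-resp finish (spec-drain 2+k≤K (<⇒≢ (m<n⇒m<1+n r<k) ∘ sym)))
      where
      r≢k : r ≢ k
      r≢k = <⇒≢ r<k
      r≢1+k : r ≢ suc k
      r≢1+k = <⇒≢ (m<n⇒m<1+n r<k)
      k≢1+k : k ≢ suc k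
      k≢1+k = <⇒≢ ≤-refl
      start : S ≈ S′ 0
      start = ≈-sym (≈-trans (≔-own (S [ r ≔ x ] [ k ≔ 0 ])
          (sym (trans (regs-other (S [ r ≔ x ]) (k≢1+k ∘ sym)) (trans (regs-other S (r≢1+k ∘ sym)) (fresh R _ (n≤1+n k))))))
        (≈-trans (≔-own (S [ r ≔ x ]) (sym (trans (regs-other S (r≢k ∘ sym)) (fresh R _ ≤-refl)))) (≔-own S (sym (values R i)))))
      counter : ∀ j → regs (S′ j) r ≡ x ∸ j
      counter j = trans (regs-other (S [ r ≔ x ∸ j ] [ k ≔ j ]) r≢1+k)
                        (trans (regs-other (S [ r ≔ x ∸ j ]) r≢k) (regs-same S r))
      last : regs (S′ x) (suc k) ≡ x
      last = regs-same (S [ r ≔ x ∸ x ] [ k ≔ x ]) (suc k)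
      finish : S′ x [ suc k ≔ 0 ] [ r ≔ regs (S′ x) r + regs (S′ x) (suc k) ] ≈ S [ k ≔ x ]
      finish = regs-≡ {S} eq
        where
        eq : ∀ q → regs (S′ x [ suc k ≔ 0 ] [ r ≔ regs (S′ x) r + regs (S′ x) (suc k) ]) q ≡ regs (S [ k ≔ x ]) q
        eq q with q ≡ᵇ r | same? q r | q ≡ᵇ k | same? q k | q ≡ᵇ suc k | same? q (suc k)
        ... | true | same e | true | same f | _ | _ = ⊥-elim (r≢k (trans (sym e) f))
        ... | true | same refl | false | _ | _ | _ =
          trans (cong₂ _+_ (trans (counter x) (n∸n≡0 x)) last) (sym (values R i))
        ... | false | _ | true | same refl | true | same e = ⊥-elim (k≢1+k e)
        ... | false | _ | true | same refl | false | _ = refl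
        ... | false | _ | false | _ | true | same refl = sym (fresh R _ (n≤1+n k))
        ... | false | _ | false | _ | false | _ = refl
      body : ∀ j → j < x → Spec (dec r ⨟ inc k ⨟ inc (suc k)) (S′ j) (S′ (suc j)) 3
      body j _ = spec-resp (regs-≡ {S} eq)
        (spec-dec {v = x ∸ suc j} (trans (cong pred (counter j)) (pred[m∸n]≡m∸[1+n] x j)) ⨟ₛ
         spec-inc {v = suc j} (cong suc (trans (regs-other (S′ j) (r≢k ∘ sym))
           (trans (regs-other (S [ r ≔ x ∸ j ] [ k ≔ j ]) k≢1+k) (regs-same (S [ r ≔ x ∸ j ]) k)))) ⨟ₛ
         spec-inc {v = suc j} (cong suc (trans (regs-other (S′ j [ r ≔ x ∸ suc j ]) (k≢1+k ∘ sym))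
           (trans (regs-other (S′ j) (r≢1+k ∘ sym)) (regs-same (S [ r ≔ x ∸ j ] [ k ≔ j ]) (suc k))))))
        where
        eq : ∀ q → regs (S′ j [ r ≔ x ∸ suc j ] [ k ≔ suc j ] [ suc k ≔ suc j ]) q ≡ regs (S′ (suc j)) q
        eq q with q ≡ᵇ r | q ≡ᵇ k | q ≡ᵇ suc k
        ... | _     | _     | true  = refl
        ... | _     | true  | false = refl
        ... | true  | false | false = refl
        ... | false | false | false = refl

  module _ {S k} (x y : ℕ) (fresh : ∀ r → k ≤ r → regs S r ≡ 0) where

    private
      S₀ : Store
      S₀ = S [ k ≔ x ] [ suc k ≔ y ]

      k≢1+k : k ≢ suc k
      k≢1+k = <⇒≢ ≤-refl

      first : regs S₀ k ≡ x
      first = trans (regs-other (S [ k ≔ x ]) k≢1+k) (regs-same S k)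

      second : regs S₀ (suc k) ≡ y
      second = regs-same (S [ k ≔ x ]) (suc k)

    spec-add : ∀ {b} → 2 + k ≤ K → y ≤ b → Spec (drain (suc k) k) S₀ (S [ k ≔ x + y ]) (suc (b * 3))
    spec-add 2+k≤K y≤b = spec-≤ (s≤s (*-monoˡ-≤ 3 (≤-trans (≤-reflexive second) y≤b)))
      (spec-resp (regs-≡ {S} eq) (spec-drain 2+k≤K (k≢1+k ∘ sym)))
      where
      eq : ∀ q → regs (S₀ [ suc k ≔ 0 ] [ k ≔ regs S₀ k + regs S₀ (suc k) ]) q ≡ regs (S [ k ≔ x + y ]) q
      eq q with q ≡ᵇ k | q ≡ᵇ suc k | same? q (suc k)
      ... | true  | _     | _         = cong₂ _+_ first second
      ... | false | true  | same refl = sym (fresh (suc k) (n≤1+n k))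
      ... | false | false | _         = refl

    -- Truncated subtraction comes for free, since `dec` leaves zero unchanged.
    spec-monus : ∀ {b} → 2 + k ≤ K → y ≤ b →
                 Spec (loop (suc k) (dec (suc k) ⨟ dec k)) S₀ (S [ k ≔ x ∸ y ]) (suc (b * 3))
    spec-monus 2+k≤K y≤b = spec-≤ (s≤s (*-monoˡ-≤ 3 y≤b)) (spec-resp finish
      (spec-loop (λ i → S [ k ≔ x ∸ i ] [ suc k ≔ y ∸ i ]) y 2+k≤K
        (λ i _ → regs-same (S [ k ≔ x ∸ i ]) (suc k))
        λ i _ → spec-resp (regs-≡ {S} (over i))
          (spec-dec (trans (cong pred (regs-same (S [ k ≔ x ∸ i ]) (suc k))) (pred[m∸n]≡m∸[1+n] y i)) ⨟ₛ
           spec-dec (trans (cong pred (trans (regs-other (S [ k ≔ x ∸ i ] [ suc k ≔ y ∸ i ]) k≢1+k)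
             (trans (regs-other (S [ k ≔ x ∸ i ]) k≢1+k) (regs-same S k)))) (pred[m∸n]≡m∸[1+n] x i)))))
      where
      over : ∀ i q → regs (S [ k ≔ x ∸ i ] [ suc k ≔ y ∸ i ] [ suc k ≔ y ∸ suc i ] [ k ≔ x ∸ suc i ]) q ≡
                     regs (S [ k ≔ x ∸ suc i ] [ suc k ≔ y ∸ suc i ]) q
      over i q with q ≡ᵇ k | same? q k | q ≡ᵇ suc k | same? q (suc k)
      ... | true  | same refl | true  | same e = ⊥-elim (k≢1+k e)
      ... | true  | _ | false | _ = refl
      ... | false | _ | true  | _ = refl
      ... | false | _ | false | _ = refl
      finish : S [ k ≔ x ∸ y ] [ suc k ≔ y ∸ y ] ≈ S [ k ≔ x ∸ y ]
      finish = ≔-own (S [ k ≔ x ∸ y ]) (trans (n∸n≡0 y)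
        (sym (trans (regs-other S (k≢1+k ∘ sym)) (fresh (suc k) (n≤1+n k)))))

  spec-read : ∀ {S k w o} x {b} → 2 + k ≤ K → w < k → (∀ r → k ≤ r → regs S r ≡ 0) → regs S w ≡ 0 → x ≤ b →
    Spec (inc w ⨟ loop (suc k) (dec (suc k) ⨟ inc w) ⨟ flag w ((o ==_) ∘ reading) k ⨟ clear w)
      (S [ suc k ≔ x ]) (S [ k ≔ (if o == nth (words S w) x then 1 else 0) ])
      (1 + (suc (b * 3) + (1 + suc (suc b * 2))))
  spec-read {S} {k} {w} {o} x {b} 2+k≤K w<k fresh w≡0 x≤b =
    spec-inc {v = 1} (cong suc (trans (regs-other S w≢1+k) w≡0)) ⨟ₛ
    spec-≤ (s≤s (*-monoˡ-≤ 3 x≤b)) (spec-loop S′ x 2+k≤K (λ i _ → counter i) body) ⨟ₛ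
    spec-flag {g = g} {v = answer} w<K (trans (cong₂ _+_ bit≡ (trans (regs-other (S [ suc k ≔ x ∸ x ]) k≢w)
      (trans (regs-other S k≢1+k) (fresh k ≤-refl)))) (+-identityʳ answer)) ⨟ₛ
    spec-≤ (s≤s (*-monoˡ-≤ 2 (≤-trans (≤-reflexive (trans (regs-other (S′ x) (k≢w ∘ sym)) (head x))) (s≤s x≤b))))
      (spec-resp (regs-≡ {S} finish) (spec-clear w<K))
    where
    w<K : w < K
    w<K = <-trans w<k (<⇒≤ 2+k≤K)
    w≢1+k : w ≢ suc k
    w≢1+k = <⇒≢ (m<n⇒m<1+n w<k)
    k≢1+k : k ≢ suc k
    k≢1+k = <⇒≢ ≤-refl
    k≢w : k ≢ w
    k≢w = <⇒≢ w<k ∘ sym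
    g : Sym → Bool
    g = (o ==_) ∘ reading
    answer : ℕ
    answer = if o == nth (words S w) x then 1 else 0
    S′ : ℕ → Store
    S′ i = S [ suc k ≔ x ∸ i ] [ w ≔ suc i ]
    counter : ∀ i → regs (S′ i) (suc k) ≡ x ∸ i
    counter i = trans (regs-other (S [ suc k ≔ x ∸ i ]) (w≢1+k ∘ sym)) (regs-same S (suc k))
    head : ∀ i → regs (S′ i) w ≡ suc i
    head i = regs-same (S [ suc k ≔ x ∸ i ]) w
    bit≡ : (if g (cells (words S w) (regs (S′ x) w)) then 1 else 0) ≡ answer
    bit≡ = trans (cong (λ p → if g (cells (words S w) p) then 1 else 0) (head x))
      (cong (λ m → if o == m then 1 else 0) (reading-cells (words S w) x))
    body : ∀ i → i < x → Spec (dec (suc k) ⨟ inc w) (S′ i) (S′ (suc i)) 2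
    body i _ = spec-resp (regs-≡ {S} over)
      (spec-dec {v = x ∸ suc i} (trans (cong pred (counter i)) (pred[m∸n]≡m∸[1+n] x i)) ⨟ₛ
       spec-inc {v = 2 + i} (cong suc (trans (regs-other (S′ i) w≢1+k) (head i))))
      where
      over : ∀ q → regs (S′ i [ suc k ≔ x ∸ suc i ] [ w ≔ 2 + i ]) q ≡ regs (S′ (suc i)) q
      over q with q ≡ᵇ w | q ≡ᵇ suc k
      ... | true  | _     = refl
      ... | false | true  = refl
      ... | false | false = refl
    finish : ∀ q → regs (S′ x [ k ≔ answer ] [ w ≔ 0 ]) q ≡ regs (S [ k ≔ answer ]) q
    finish q with q ≡ᵇ w | same? q w | q ≡ᵇ k | same? q k | q ≡ᵇ suc k | same? q (suc k)
    ... | true | same refl | true | same e | _ | _ = ⊥-elim (k≢w (sym e))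
    ... | true | same refl | false | _ | _ | _ = sym w≡0
    ... | false | _ | true | _ | _ | _ = refl
    ... | false | _ | false | _ | true | same refl = trans (n∸n≡0 x) (sym (fresh (suc k) (n≤1+n k)))
    ... | false | _ | false | _ | false | _ = refl

  private
    two₁ : ∀ k a b → k + a + (2 + b) ≡ k + (2 + (a + b))
    two₁ = solve-∀

    two₂ : ∀ k a b → suc k + b + (1 + a) ≡ k + (2 + (a + b))
    two₂ = solve-∀

    two₃ : ∀ k a b → 2 + k + (a + b) ≡ k + (2 + (a + b))
    two₃ = solve-∀

    four₁ : ∀ k a b → 4 + k + (a + b) ≡ k + (4 + (a + b))
    four₁ = solve-∀

    four₂ : ∀ k a b → 1 + k + a + (3 + b) ≡ k + (4 + (a + b))
    four₂ = solve-∀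

    four₃ : ∀ k a b → 3 + k + b + (1 + a) ≡ k + (4 + (a + b))
    four₃ = solve-∀

  spec-compile : ∀ {n S k b} (t : Term n) {σ v : Vec ℕ n} → Ready S k σ v → k + need t ≤ K → v ≼* b →
                 Spec (compile t σ k) S (S [ k ≔ ⟦ t ⟧ (words S) v ]) (timeBound t b)
  spec-compile {k = k} (var i) R fit h = spec-var R i (≤-trans (≤-reflexive (+-comm 2 k)) fit) (h i)
  spec-compile {S = S} {k} (lit c) R fit h =
    spec-resp (≔-value S (trans (cong (c +_) (fresh R k ≤-refl)) (+-identityʳ c))) (spec-incs c)
  spec-compile {S = S} {k} (s ⊞ t) {v = v} R fit h =
    spec-compile s R (room (2 + need t) (two₁ k (need s) (need t)) fit) h ⨟ₛ
    spec-compile t (ready-set {S = S} R) (room (1 + need s) (two₂ k (need s) (need t)) fit) h ⨟ₛ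
    spec-add (⟦ s ⟧ (words S) v) _ (fresh R) (room (need s + need t) (two₃ k (need s) (need t)) fit) (value-≤ t h)
  spec-compile {S = S} {k} (s ⊟ t) {v = v} R fit h =
    spec-compile s R (room (2 + need t) (two₁ k (need s) (need t)) fit) h ⨟ₛ
    spec-compile t (ready-set {S = S} R) (room (1 + need s) (two₂ k (need s) (need t)) fit) h ⨟ₛ
    spec-monus (⟦ s ⟧ (words S) v) _ (fresh R) (room (need s + need t) (two₃ k (need s) (need t)) fit) (value-≤ t h)
  -- A product is the sum of a constant; `t` is evaluated anew in every round.
  spec-compile {S = S} {k} {b} (s ⊠ t) {v = v} R fit h =
    spec-resp (≔-value S (sumTo-const (⟦ s ⟧ (words S) v) _))
      (spec-sumProg (room (need s + need t) (four₁ k (need s) (need t)) fit) (fresh R)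
        (spec-compile s (ready-next R) (room (3 + need t) (four₂ k (need s) (need t)) fit) h)
        (value-≤ s h) (λ _ _ → value-≤ t h)
        λ i i<n → spec-compile t
          (ready-set {S = S [ k ≔ _ ] [ 1 + k ≔ _ ]} (ready-set {S = S [ k ≔ _ ]} (ready-set {S = S} R)))
          (room (1 + need s) (four₃ k (need s) (need t)) fit) h)
  spec-compile {S = S} {k} (cell w o t) {v = v} R fit h =
    spec-compile t (ready-next R) (room 1 (lemma k (need t)) fit) h ⨟ₛ
    spec-read (⟦ t ⟧ (words S) v) (room (need t) (lemma′ k (need t)) fit) (<-≤-trans (toℕ<n w) (base R))
      (fresh R) (rewound R w) (value-≤ t h)
    where
    lemma : ∀ k a → suc k + a + 1 ≡ k + (2 + a)
    lemma = solve-∀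
    lemma′ : ∀ k a → 2 + k + a ≡ k + (2 + a)
    lemma′ = solve-∀
  spec-compile {S = S} {k} {b} (∑ s t) {v = v} R fit h =
      (spec-sumProg (room (need s + need t) (four₁ k (need s) (need t)) fit) (fresh R)
        (spec-compile s (ready-next R) (room (3 + need t) (four₂ k (need s) (need t)) fit) h)
        (value-≤ s h) (λ i i<n → value-≤ t (below i i<n))
        λ i i<n → spec-compile t
          (ready-bind {S = S [ k ≔ _ ] [ 1 + k ≔ _ ]} (ready-set {S = S [ k ≔ _ ]} (ready-set {S = S} R)))
          (room (1 + need s) (four₃ k (need s) (need t)) fit) (below i i<n))
    where
    below : ∀ i → i < ⟦ s ⟧ (words S) v → (i ∷ v) ≼* (b + valueBound s b)
    below i i<n zero    = ≤-trans (<⇒≤ i<n) (≤-trans (value-≤ s h) (m≤n+m _ b))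
    below i i<n (suc j) = ≤-trans (h j) (m≤m+n b _)
  spec-compile (wk t) {_ ∷ σ} {_ ∷ v} (ready f w vs bs k) fit h =
    spec-compile t (ready f w (vs ∘ suc) (bs ∘ suc) k) fit (h ∘ suc)

-- Bounded formulas

-- The bounded quantifiers range over numbers that depend on the input. In contrast, `⋁` ranges over
-- a finite set that is fixed with the formula, such as the kinds of vertices.
data Formula : ℕ → Set where
  _≐_ _≼_   : ∀ {n} → Term n → Term n → Formula n
  reads     : ∀ {n} → Fin 2 → Term n → Maybe Bool → Formula n
  _⋏_ _⋎_   : ∀ {n} → Formula n → Formula n → Formula n
  neg       : ∀ {n} → Formula n → Formula n
  ∃< ∀<     : ∀ {n} → Term n → Formula (suc n) → Formula n
  ⋁         : ∀ {n} m → (Fin m → Formula n) → Formula n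

infix  5 _≐_ _≼_
infixr 4 _⋏_
infixr 3 _⋎_

⟦_⟧ᶠ : ∀ {n} → Formula n → (ℕ → List Bool) → Vec ℕ n → Set
⟦ s ≐ t ⟧ᶠ       W v = ⟦ s ⟧ W v ≡ ⟦ t ⟧ W v
⟦ s ≼ t ⟧ᶠ       W v = ⟦ s ⟧ W v ≤ ⟦ t ⟧ W v
⟦ reads w t o ⟧ᶠ W v = nth (W (toℕ w)) (⟦ t ⟧ W v) ≡ o
⟦ φ ⋏ ψ ⟧ᶠ       W v = ⟦ φ ⟧ᶠ W v × ⟦ ψ ⟧ᶠ W v
⟦ φ ⋎ ψ ⟧ᶠ       W v = ⟦ φ ⟧ᶠ W v ⊎ ⟦ ψ ⟧ᶠ W v
⟦ neg φ ⟧ᶠ       W v = ¬ ⟦ φ ⟧ᶠ W v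
⟦ ∃< t φ ⟧ᶠ      W v = ∃[ i ] i < ⟦ t ⟧ W v × ⟦ φ ⟧ᶠ W (i ∷ v)
⟦ ∀< t φ ⟧ᶠ      W v = ∀ i → i < ⟦ t ⟧ W v → ⟦ φ ⟧ᶠ W (i ∷ v)
⟦ ⋁ m φ ⟧ᶠ       W v = ∃[ i ] ⟦ φ i ⟧ᶠ W v

sumOver : ∀ {n} m → (Fin m → Term n) → Term n
sumOver zero    t = lit 0
sumOver (suc m) t = t zero ⊞ sumOver m (t ∘ suc)

-- A formula counts as true if its value is positive rather than 1. Hence disjunctions and
-- existential quantifiers are plain sums, conjunctions are products, and `∀<` says that the number
-- of counterexamples is 0.
truth : ∀ {n} → Formula n → Term n
truth (s ≐ t)       = (lit 1 ⊟ (s ⊟ t)) ⊠ (lit 1 ⊟ (t ⊟ s))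
truth (s ≼ t)       = lit 1 ⊟ (s ⊟ t)
truth (reads w t o) = cell w o t
truth (φ ⋏ ψ)       = truth φ ⊠ truth ψ
truth (φ ⋎ ψ)       = truth φ ⊞ truth ψ
truth (neg φ)       = lit 1 ⊟ truth φ
truth (∃< t φ)      = ∑ t (truth φ)
truth (∀< t φ)      = lit 1 ⊟ ∑ t (lit 1 ⊟ truth φ)
truth (⋁ m φ)       = sumOver m (truth ∘ φ)

sumTo-pos : ∀ n {f} → 0 < sumTo n f → ∃[ i ] i < n × 0 < f i
sumTo-pos (suc n) {f} p with sumTo n f in eq
... | zero  = n , ≤-refl , p
... | suc _ with i , i<n , q ← sumTo-pos n {f} (subst (0 <_) (sym eq) (s≤s z≤n)) = i , m<n⇒m<1+n i<n , q

sumTo-term : ∀ n {f i} → i < n → f i ≤ sumTo n f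
sumTo-term (suc n) {f} {i} i<1+n with i ≟ n
... | yes refl = m≤n+m (f n) _
... | no i≢n = ≤-trans (sumTo-term n (≤∧≢⇒< (s≤s⁻¹ i<1+n) i≢n)) (m≤m+n _ _)

1∸-pos : ∀ {k} → 0 < 1 ∸ k → k ≡ 0
1∸-pos {zero}        _ = refl
1∸-pos {suc zero}    ()
1∸-pos {suc (suc _)} ()

*-pos : ∀ {a b} → 0 < a → 0 < b → 0 < a * b
*-pos p q = *-mono-≤ p q

*-pos⁻ : ∀ a {b} → 0 < a * b → 0 < a × 0 < b
*-pos⁻ (suc a) {zero}  p with () ← subst (0 <_) (*-zeroʳ a) p
*-pos⁻ (suc a) {suc b} _ = s≤s z≤n , s≤s z≤n

≤-pos : ∀ {a b} → 0 < 1 ∸ (a ∸ b) → a ≤ b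
≤-pos {a} p = m∸n≡0⇒m≤n (1∸-pos p)

≤-pos⁻ : ∀ {a b} → a ≤ b → 0 < 1 ∸ (a ∸ b)
≤-pos⁻ p rewrite m≤n⇒m∸n≡0 p = ≤-refl

0<⊎≡0 : ∀ n → 0 < n ⊎ n ≡ 0
0<⊎≡0 zero    = inj₂ refl
0<⊎≡0 (suc n) = inj₁ (s≤s z≤n)

sumOver-pos : ∀ {n} m (t : Fin m → Term n) {W v} → 0 < ⟦ sumOver m t ⟧ W v → ∃[ i ] 0 < ⟦ t i ⟧ W v
sumOver-pos (suc m) t {W} {v} p with 0<⊎≡0 (⟦ t zero ⟧ W v)
... | inj₁ q = zero , q
... | inj₂ e with i , h ← sumOver-pos m (t ∘ suc) {W} {v} (subst (λ k → 0 < k + ⟦ sumOver m (t ∘ suc) ⟧ W v) e p) = suc i , h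

sumOver-term : ∀ {n} m (t : Fin m → Term n) {W v} i → ⟦ t i ⟧ W v ≤ ⟦ sumOver m t ⟧ W v
sumOver-term (suc m) t         zero    = m≤m+n _ _
sumOver-term (suc m) t {W} {v} (suc i) = ≤-trans (sumOver-term m (t ∘ suc) {W} {v} i) (m≤n+m _ _)

-- The two directions are proved together, because negation exchanges them. Case distinctions on a
-- formula go through its value, which is zero or positive.
sound    : ∀ {n} (φ : Formula n) {W v} → 0 < ⟦ truth φ ⟧ W v → ⟦ φ ⟧ᶠ W v
complete : ∀ {n} (φ : Formula n) {W v} → ⟦ φ ⟧ᶠ W v → 0 < ⟦ truth φ ⟧ W v

sound (s ≐ t) {W} {v} p with q , r ← *-pos⁻ (1 ∸ (⟦ s ⟧ W v ∸ ⟦ t ⟧ W v)) p =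
  ≤-antisym (≤-pos q) (≤-pos {⟦ t ⟧ W v} r)
sound (s ≼ t) p = ≤-pos p
sound (reads w t o) {W} {v} p with o == nth (W (toℕ w)) (⟦ t ⟧ W v) in eq
... | true = sym (==⇒≡ _ _ (subst T (sym eq) _))
sound (φ ⋏ ψ) {W} {v} p = map (sound φ) (sound ψ) (*-pos⁻ (⟦ truth φ ⟧ W v) p)
sound (φ ⋎ ψ) {W} {v} p with 0<⊎≡0 (⟦ truth φ ⟧ W v)
... | inj₁ q = inj₁ (sound φ q)
... | inj₂ e = inj₂ (sound ψ (subst (λ k → 0 < k + ⟦ truth ψ ⟧ W v) e p))
sound (neg φ) p h = n≮n 0 (subst (0 <_) (1∸-pos p) (complete φ h))
sound (∃< t φ) {W} {v} p with i , i<n , q ← sumTo-pos (⟦ t ⟧ W v) p = i , i<n , sound φ q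
sound (∀< t φ) {W} {v} p i i<n with 0<⊎≡0 (⟦ truth φ ⟧ W (i ∷ v))
... | inj₁ q = sound φ q
... | inj₂ e with () ← ≤-trans (≤-reflexive (sym (cong (1 ∸_) e)))
                     (≤-trans (sumTo-term (⟦ t ⟧ W v) {λ j → 1 ∸ ⟦ truth φ ⟧ W (j ∷ v)} i<n) (≤-reflexive (1∸-pos p)))
sound (⋁ m φ) {W} {v} p with i , q ← sumOver-pos m (truth ∘ φ) {W} {v} p = i , sound (φ i) q

complete (s ≐ t) {W} {v} h = *-pos (≤-pos⁻ {⟦ s ⟧ W v} (≤-reflexive h)) (≤-pos⁻ {⟦ t ⟧ W v} (≤-reflexive (sym h)))
complete (s ≼ t) {W} {v} h = ≤-pos⁻ {⟦ s ⟧ W v} h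
complete (reads w t o) {W} {v} refl with nth (W (toℕ w)) (⟦ t ⟧ W v) in eq
... | o with o == o | ==-refl o
...   | true | _ = ≤-refl
complete (φ ⋏ ψ) (h , k) = *-pos (complete φ h) (complete ψ k)
complete (φ ⋎ ψ) (inj₁ h) = ≤-trans (complete φ h) (m≤m+n _ _)
complete (φ ⋎ ψ) (inj₂ h) = ≤-trans (complete ψ h) (m≤n+m _ _)
complete (neg φ) {W} {v} h with 0<⊎≡0 (⟦ truth φ ⟧ W v)
... | inj₁ q = contradiction (sound φ q) h
... | inj₂ e = subst (λ k → 0 < 1 ∸ k) (sym e) ≤-refl
complete (∃< t φ) {W} {v} (i , i<n , h) = ≤-trans (complete φ h) (sumTo-term (⟦ t ⟧ W v) i<n)
complete (∀< t φ) {W} {v} h = subst (λ k → 0 < 1 ∸ k) (sym (sumTo-zero (⟦ t ⟧ W v)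
  λ i i<n → m≤n⇒m∸n≡0 (complete φ (h i i<n)))) ≤-refl
  where
  sumTo-zero : ∀ n {f} → (∀ i → i < n → f i ≡ 0) → sumTo n f ≡ 0
  sumTo-zero n z = trans (sumTo-cong n z) (trans (sumTo-const n 0) (*-zeroʳ n))
complete (⋁ m φ) {W} {v} (i , h) = ≤-trans (complete (φ i) h) (sumOver-term m (truth ∘ φ) {W} {v} i)

-- Machines that compute or guess words

wordsOf : List Bool → List Bool → ℕ → List Bool
wordsOf x y zero          = x
wordsOf x y (suc zero)    = y
wordsOf x y (suc (suc _)) = []

-- The heads of the input and of the guess, followed by the length of the input, which is the free
-- variable of all top-level terms.
regsOf : ℕ → ℕ → ℕ → ℕ → ℕ
regsOf p q n zero                = p
regsOf p q n (suc zero)          = q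
regsOf p q n (suc (suc zero))    = n
regsOf p q n (suc (suc (suc _))) = 0

reader : List Sym → List Bool → Tape 1
reader ls []       = tape ls blank []
reader ls (b ∷ bs) = tape ls (bit b) (List.map bit bs)

reader-right : ∀ ls b bs → move right (reader ls (b ∷ bs)) ≡ reader (bit b ∷ ls) bs
reader-right ls b []       = refl
reader-right ls b (_ ∷ bs) = refl

reader-load : ∀ bs → reader [] bs ≡ load bs
reader-load []       = refl
reader-load (_ ∷ bs) = refl

isBit : Sym → Bool
isBit (bit _) = true
isBit _       = false

cells-snoc : ∀ w b {i} → i ≢ suc (length w) → cells w i ≡ cells (w ++ [ b ]) i
cells-snoc w b {zero}  _ = refl
cells-snoc w b {suc i} d with <-cmp i (length w)
... | tri< i<n _ _ = cong (maybe bit blank) (sym (nth-++ˡ w [ b ] i<n))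
... | tri≈ _ refl _ = ⊥-elim (d refl)
... | tri> _ _ n<i = cong (maybe bit blank) (trans (nth-≥ w (<⇒≤ n<i))
  (sym (nth-≥ (w ++ [ b ]) (≤-trans (≤-reflexive (trans (length-++ w) (+-comm _ 1))) n<i))))

rep-append : ∀ w b {t} → Rep (cells w) (suc (length w)) t →
             Rep (cells (w ++ [ b ])) (2 + length w) (act (bit b , right) t)
rep-append w b r = rep-right (rep-write r (cong (maybe bit blank) (nth-length w [])) (cells-snoc w b))

module Setup (C : Set) (K : ℕ) where
  open Compile C K public

  outSymbol : Syms → Sym
  outSymbol a = at blank (toList a) 0

  outSymbol-∼ : ∀ {T S} → T ∼ S → outSymbol (heads T) ≡ Tape.head (out S)
  outSymbol-∼ {t ∷ _} (rel refl _) = refl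

  -- The input moves from tape 0, which afterwards serves for output, to the tape of word 0, while
  -- register 2 counts its length in the same steps.
  initializing copying : Action
  initializing _ zero          x = x , stay
  initializing _ (suc zero)    x = marker , right
  initializing _ (suc (suc q)) x = marker , stay
  copying a zero                      x = x , right
  copying a (suc zero)                x = outSymbol a , right
  copying a (suc (suc zero))          x = x , stay
  copying a (suc (suc (suc zero)))    x = x , right
  copying a (suc (suc (suc (suc q)))) x = x , stay

  onOut : (Syms → Sym → Sym × Move) → Action
  onOut φ a zero    x = φ a x
  onOut φ a (suc q) x = x , stay

  spec-onOut : ∀ {φ t t′ W ρ} → (∀ {T} → T ∼ store t W ρ → act (φ (heads T) (Tape.head t)) t ≡ t′) →
               Spec (oper λ _ → onOut φ) (store t W ρ) (store t′ W ρ) 1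
  spec-onOut {φ} h = spec-oper {onOut φ} (λ { T∼S _ refl → h T∼S }) λ _ _ _ r → r

  outMove : Move → Prog
  outMove m = oper λ _ → onOut λ _ x → x , m

  spec-outMove : ∀ {m t W ρ} → Spec (outMove m) (store t W ρ) (store (move m t) W ρ) 1
  spec-outMove {m} = spec-onOut {λ _ x → x , m} λ _ → refl

  initialize copy : Prog
  initialize = oper λ _ → initializing
  copy       = while (isBit ∘ outSymbol) (oper λ _ → copying)

  -- Empty tapes represent no register, as the marker is missing; one step writes all markers. It
  -- also moves the head of word 0 past its marker, where copying starts.
  initialize-∼ : ∀ x →
    let T = load x ∷ replicate K empty in
    perform (tabulate λ i → initializing (heads T) (toℕ i) (lookup (heads T) i)) T
      ∼ store (reader [] x) (wordsOf [] []) (regsOf 1 0 0)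
  initialize-∼ x = rel (trans (lookup-perform initializing (load x ∷ replicate K empty) zero) (sym (reader-load x))) λ τ →
    subst (Rep _ _) (sym (trans (lookup-perform initializing (load x ∷ replicate K empty) (suc τ))
      (cong (λ t → act (initializing (heads (load x ∷ replicate K empty)) (suc (toℕ τ)) (Tape.head t)) t)
            (lookup-replicate τ empty)))) (go (toℕ τ))
    where
    go : ∀ q → Rep (cells (wordsOf [] [] q)) (regsOf 1 0 0 q)
                   (act (initializing (heads (load x ∷ replicate K empty)) (suc q) blank) empty)
    go zero                = rep refl refl λ _ → refl
    go (suc zero)          = rep refl refl λ _ → refl
    go (suc (suc zero))    = rep refl refl λ _ → refl
    go (suc (suc (suc q))) = rep refl refl λ _ → refl

  revOnto : List Sym → List Bool → List Sym
  revOnto ls []       = ls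
  revOnto ls (b ∷ bs) = revOnto (bit b ∷ ls) bs

  spec-copying : ∀ ls w b bs →
    Spec (oper λ _ → copying) (store (reader ls (b ∷ bs)) (wordsOf w []) (regsOf (suc (length w)) 0 (length w)))
         (store (reader (bit b ∷ ls) bs) (wordsOf (w ++ [ b ]) []) (regsOf (2 + length w) 0 (suc (length w)))) 1
  spec-copying ls w b bs = spec-oper {copying} (λ { _ _ refl → reader-right ls b bs }) λ T∼S τ t r →
    subst (λ c → Rep _ _ (act c t)) (symbols T∼S (toℕ τ) (Tape.head t)) (go (toℕ τ) t r)
    where
    W = wordsOf w []
    ρ = regsOf (suc (length w)) 0 (length w)
    goal : ℕ → Sym → Sym × Move
    goal zero                x = bit b , right
    goal (suc zero)          x = x , stay
    goal (suc (suc zero))    x = x , right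
    goal (suc (suc (suc q))) x = x , stay
    symbols : ∀ {T} → T ∼ store (reader ls (b ∷ bs)) W ρ → ∀ q x → goal q x ≡ copying (heads T) (suc q) x
    symbols T∼S zero                x = cong (_, right) (sym (outSymbol-∼ T∼S))
    symbols T∼S (suc zero)          x = refl
    symbols T∼S (suc (suc zero))    x = refl
    symbols T∼S (suc (suc (suc q))) x = refl
    go : ∀ q t → Rep (cells (W q)) (ρ q) t →
         Rep (cells (wordsOf (w ++ [ b ]) [] q)) (regsOf (2 + length w) 0 (suc (length w)) q) (act (goal q (Tape.head t)) t)
    go zero                t r = rep-append w b r
    go (suc zero)          t r = r
    go (suc (suc zero))    t r = rep-right r
    go (suc (suc (suc q))) t r = r

  spec-copy : ∀ ls w bs →
    Spec copy (store (reader ls bs) (wordsOf w []) (regsOf (suc (length w)) 0 (length w)))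
      (store (tape (revOnto ls bs) blank []) (wordsOf (w ++ bs) []) (regsOf (suc (length (w ++ bs))) 0 (length (w ++ bs))))
      (suc (length bs * 2))
  spec-copy ls w []       rewrite ++-identityʳ w = spec-stop λ T∼S → cong isBit (outSymbol-∼ T∼S)
  spec-copy ls w (b ∷ bs) = spec-again (λ T∼S → cong isBit (outSymbol-∼ T∼S)) (spec-copying ls w b bs) rest
    where
    len : length (w ++ [ b ]) ≡ suc (length w)
    len = trans (length-++ w) (+-comm _ 1)
    rest : Spec copy (store (reader (bit b ∷ ls) bs) (wordsOf (w ++ [ b ]) []) (regsOf (2 + length w) 0 (suc (length w))))
      (store (tape (revOnto (bit b ∷ ls) bs) blank []) (wordsOf (w ++ b ∷ bs) [])
             (regsOf (suc (length (w ++ b ∷ bs))) 0 (length (w ++ b ∷ bs)))) (suc (length bs * 2))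
    rest with s ← spec-copy (bit b ∷ ls) (w ++ [ b ]) bs rewrite len | ++-assoc w [ b ] bs = s

  -- The move to the right leaves a blank behind, which later ends the
  -- rewinding of the output.
  setup : Prog
  setup = copy ⨟ outMove right ⨟ clear 0

  ready-setup : ∀ {t W n} → Ready (store t W (regsOf 0 0 n)) 3 (2 ∷ []) (n ∷ [])
  ready-setup {n = n} = ready fresh (λ { zero → refl ; (suc zero) → refl }) (λ { zero → refl })
    (λ { zero → ≤-refl , ≤-refl }) (s≤s (s≤s z≤n))
    where
    fresh : ∀ r → 3 ≤ r → regsOf 0 0 n r ≡ 0
    fresh (suc (suc (suc r))) _ = refl
    fresh (suc (suc zero)) (s≤s (s≤s ()))
    fresh (suc zero) (s≤s ())

  spec-setup : ∀ x → 0 < K → let n = length x in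
    Spec setup (store (reader [] x) (wordsOf [] []) (regsOf 1 0 0))
               (store (tape (blank ∷ revOnto [] x) blank []) (wordsOf x []) (regsOf 0 0 n))
               (suc (n * 2) + (1 + suc (suc n * 2)))
  spec-setup x 0<K = spec-copy [] [] x ⨟ₛ spec-outMove ⨟ₛ
    spec-resp (same-store refl (λ _ → refl) λ { zero → refl ; (suc zero) → refl ; (suc (suc zero)) → refl ; (suc (suc (suc _))) → refl })
      (spec-clear 0<K)

  n≤n* : ∀ {n} → (n ∷ []) ≼* n
  n≤n* zero = ≤-refl


holds : ℕ → Bool
holds zero    = false
holds (suc _) = true

positive-empty : ∀ p → positive (cells [] p) ≡ holds p
positive-empty zero    = refl
positive-empty (suc _) = refl

m≤n⇒split : ∀ {m n} → m ≤ n → ∃[ k ] n ≡ m + k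
m≤n⇒split m≤n = _ , sym (m+[n∸m]≡n m≤n)

-- The word is built from its last bit on, in the order in which the rewinding head passes the bits.
bitsOnto : (ℕ → Bool) → ℕ → List Bool → List Bool
bitsOnto β zero    bs = bs
bitsOnto β (suc n) bs = bitsOnto β n (β n ∷ bs)

-- A clock that exceeds the running time leaves one choice for the verdict step and further ones
-- that a halted machine ignores.
toList-split : ∀ {C : Set} {n t} (cs : Vec C t) → n < t →
  Σ (Vec C n) λ as → ∃[ c ] ∃[ bs ] toList cs ≡ toList as ++ c ∷ bs
toList-split {n = zero}  (c ∷ cs) _         = [] , c , toList cs , refl
toList-split {n = suc n} (c ∷ cs) (s≤s n<t) =
  let as , d , bs , e = toList-split cs n<t in c ∷ as , d , bs , cong (c ∷_) e

module Running (C : Set) (K : ℕ) where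
  open Setup C K public

  module _ (main : Prog) (verdict : Syms → Bool) where
    open Machine (machine main verdict)

    run-split : ∀ {T T′ n t} (cs : Vec C t) → n < t →
      ((ds : Vec C n) → main ⊢ T ⇓[ toList ds ] T′) →
      run cs (config start T) ≡ config (if verdict (heads T′) then zero else suc zero) T′
    run-split {T} cs n<t d =
      let as , c , bs , e = toList-split cs n<t
      in trans (run-toList main verdict cs (config start T))
           (trans (cong (λ l → runList main verdict l (config start T)) e) (run-main main verdict c bs (d as)))

  init-⇓ : ∀ x {p S t} → Spec p (store (reader [] x) (wordsOf [] []) (regsOf 1 0 0)) S t →
    ∃[ n ] n ≤ suc t × ∃[ T′ ] T′ ∼ S × ((cs : Vec C n) → initialize ⨟ p ⊢ load x ∷ replicate K empty ⇓[ toList cs ] T′)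
  init-⇓ x s with n , n≤ , T′ , T′∼ , d ← s (initialize-∼ x) = suc n , s≤s n≤ , T′ , T′∼ , λ { (c ∷ cs) → op ⨟ d cs }

-- Machines that output the truth values of a formula

module Output (ℓ : Term 1) (φ : Formula 2) where

  t : Term 2
  t = truth φ

  K : ℕ
  -- Besides the word heads and the input length, register 3 counts the bits still to be written and
  -- register 4 is the current position.
  K = 5 + (need ℓ + need t)

  open Running Unit K

  emit : Action
  emit = onOut λ a _ → bit (positive (symbol a 5)) , right

  produce rewind body : Prog
  produce = loop 3 (compile t (4 ∷ 2 ∷ []) 5 ⨟ oper (λ _ → emit) ⨟ clear 5 ⨟ inc 4 ⨟ dec 3)
  -- Writing ends on the cell after the last bit, and the scan to the left ends on the cell before
  -- the first one.
  rewind  = outMove left ⨟ while (isBit ∘ outSymbol) (outMove left) ⨟ outMove right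
  body    = setup ⨟ compile ℓ (2 ∷ []) 3 ⨟ produce ⨟ rewind

  pastLength bodyTime : ℕ → ℕ
  pastLength n = n + valueBound ℓ n
  bodyTime n =
    (suc (n * 2) + (1 + suc (suc n * 2))) + (timeBound ℓ n +
    (suc (valueBound ℓ n * suc (timeBound t (pastLength n) + (1 + (suc (valueBound t (pastLength n) * 2) + (1 + 1))))) +
    (1 + (suc (valueBound ℓ n * 2) + 1))))

  poly-bodyTime : IsPoly bodyTime
  poly-bodyTime =
    poly-+ (poly-+ (poly-suc (poly-* poly-id (poly-const 2))) (poly-suc (poly-suc (poly-* (poly-suc poly-id) (poly-const 2)))))
    (poly-+ (poly-time ℓ)
    (poly-+ (poly-suc (poly-* (poly-value ℓ) (poly-suc (poly-+ (poly-∘ (poly-time t) past)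
              (poly-suc (poly-+ (poly-suc (poly-* (poly-∘ (poly-value t) past) (poly-const 2))) (poly-const 2)))))))
            (poly-suc (poly-+ (poly-suc (poly-* (poly-value ℓ) (poly-const 2))) (poly-const 1)))))
    where past = poly-+ poly-id (poly-value ℓ)

  back : List Sym → (ℕ → Bool) → ℕ → List Sym → Tape 1
  back ls β zero    rs = tape ls blank rs
  back ls β (suc n) rs = tape (prefix (bit ∘ β) n ++ blank ∷ ls) (bit (β n)) rs

  back-left : ∀ ls β n rs → move left (back ls β (suc n) rs) ≡ back ls β n (bit (β n) ∷ rs)
  back-left ls β zero    rs = refl
  back-left ls β (suc n) rs = refl

  symbolsOnto : (ℕ → Bool) → ℕ → List Sym → List Sym
  symbolsOnto β zero    rs = rs
  symbolsOnto β (suc n) rs = symbolsOnto β n (bit (β n) ∷ rs)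

  leadingBits-onto : ∀ β n rs → leadingBits (symbolsOnto β n rs) ≡ bitsOnto β n (leadingBits rs)
  leadingBits-onto β zero    rs = refl
  leadingBits-onto β (suc n) rs = leadingBits-onto β n (bit (β n) ∷ rs)

  read-right : ∀ (ls rs : List Sym) → read (move right (tape ls blank rs)) ≡ leadingBits rs
  read-right ls []       = refl
  read-right ls (_ ∷ rs) = refl

  spec-rewinding : ∀ {W ρ} ls β n rs →
    Spec (while (isBit ∘ outSymbol) (outMove left)) (store (back ls β n rs) W ρ)
         (store (tape ls blank (symbolsOnto β n rs)) W ρ) (suc (n * 2))
  spec-rewinding ls β zero    rs = spec-stop λ T∼S → cong isBit (outSymbol-∼ T∼S)
  spec-rewinding ls β (suc n) rs = spec-again (λ T∼S → cong isBit (outSymbol-∼ T∼S))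
    (spec-resp (same-store (back-left ls β n rs) (λ _ → refl) λ _ → refl) spec-outMove)
    (spec-rewinding ls β n (bit (β n) ∷ rs))

  module _ (x : List Bool) where

    n L b : ℕ
    n = length x
    W : ℕ → List Bool
    W = wordsOf x []
    L = ⟦ ℓ ⟧ W (n ∷ [])
    b = pastLength n

    value : ℕ → ℕ
    value i = ⟦ t ⟧ W (i ∷ n ∷ [])

    β : ℕ → Bool
    β = holds ∘ value

    ls : List Sym
    ls = revOnto [] x

    ρ : ℕ → ℕ
    ρ = regsOf 0 0 n

    written : ℕ → Tape 1
    written i = tape (prefix (bit ∘ β) i ++ blank ∷ ls) blank []

    S′ : ℕ → Store
    S′ i = store (written i) W ρ [ 3 ≔ L ∸ i ] [ 4 ≔ i ]

    fits : 5 + need t ≤ K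
    fits = +-monoʳ-≤ 5 (m≤n+m (need t) (need ℓ))

    small : ∀ c {c<5 : True (c <? 5)} → c < K
    small c {c<5} = ≤-trans (toWitness c<5) (m≤m+n 5 _)

    round : ∀ i → i < L →
      Spec (compile t (4 ∷ 2 ∷ []) 5 ⨟ oper (λ _ → emit) ⨟ clear 5 ⨟ inc 4 ⨟ dec 3) (S′ i) (S′ (suc i))
           (timeBound t b + (1 + (suc (valueBound t b * 2) + (1 + 1))))
    round i i<L = spec-resp (same-store refl (λ _ → refl) eq)
      (spec-compile t (ready-bind {S = store (written i) W ρ [ 3 ≔ _ ]} (ready-set {S = store (written i) W ρ} ready-setup)) fits env ⨟ₛ
       spec-onOut {λ a _ → bit (positive (symbol a 5)) , right} {t′ = written (suc i)}
         (λ T∼S → cong (λ c → tape (bit c ∷ prefix (bit ∘ β) i ++ blank ∷ ls) blank [])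
           (trans (cong positive (symbol-∼ 5<K T∼S)) (positive-empty (value i)))) ⨟ₛ
       spec-≤ (s≤s (*-monoˡ-≤ 2 (value-≤ t env))) (spec-clear 5<K) ⨟ₛ
       spec-inc {v = suc i} refl ⨟ₛ
       spec-dec {v = L ∸ suc i} (pred[m∸n]≡m∸[1+n] L i))
      where
      5<K : 5 < K
      5<K = ≤-trans (+-monoʳ-≤ 5 (need-pos t)) fits
      env : (i ∷ n ∷ []) ≼* b
      env zero       = ≤-trans (<⇒≤ i<L) (≤-trans (value-≤ ℓ n≤n*) (m≤n+m _ n))
      env (suc zero) = m≤m+n n _
      eq : ∀ q → regs (S′ i [ 5 ≔ value i ] [ 5 ≔ 0 ] [ 4 ≔ suc i ] [ 3 ≔ L ∸ suc i ]) q ≡ regs (S′ (suc i)) q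
      eq 0 = refl
      eq 1 = refl
      eq 2 = refl
      eq 3 = refl
      eq 4 = refl
      eq 5 = refl
      eq (suc (suc (suc (suc (suc (suc _)))))) = refl

    spec-body : Spec body (store (reader [] x) (wordsOf [] []) (regsOf 1 0 0))
      (store (move right (tape ls blank (symbolsOnto β L (blank ∷ [])))) W (regs (S′ L))) (bodyTime n)
    spec-body =
      spec-setup x (small 0) ⨟ₛ
      spec-compile ℓ ready-setup (+-mono-≤ {3} {5} (s≤s (s≤s (s≤s z≤n))) (m≤m+n (need ℓ) (need t))) n≤n* ⨟ₛ
      spec-from start (spec-≤ (s≤s (*-monoˡ-≤ _ (value-≤ ℓ n≤n*))) (spec-loop S′ L (small 3) (λ _ _ → refl) round)) ⨟ₛ
      spec-resp (same-store (first L) (λ _ → refl) λ _ → refl) (spec-outMove {left}) ⨟ₛ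
      spec-≤ (s≤s (*-monoˡ-≤ 2 (value-≤ ℓ n≤n*))) (spec-rewinding ls β L (blank ∷ [])) ⨟ₛ
      spec-outMove
      where
      first : ∀ i → move left (written i) ≡ back ls β i (blank ∷ [])
      first zero    = refl
      first (suc i) = refl
      start : store (tape (blank ∷ ls) blank []) W ρ [ 3 ≔ L ] ≈ S′ 0
      start = same-store refl (λ _ → refl) λ { 0 → refl ; 1 → refl ; 2 → refl ; 3 → refl ; 4 → refl ; (suc (suc (suc (suc (suc _))))) → refl }

  outputs : ∀ f → (∀ x → f x ≡ bitsOnto (β x) (L x) []) → PolyTimeComputable f
  outputs f f≡ = machine main accepting , poly runtime , computes
    where
    main : Prog
    main = initialize ⨟ body
    accepting : Syms → Bool
    accepting _ = true
    runtime : IsPoly (λ n → suc (suc (bodyTime n)))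
    -- The two extra steps are the initialization and the verdict.
    runtime = poly-suc (poly-suc poly-bodyTime)
    computes : ComputesInTime (machine main accepting) (poly runtime) f
    computes x = finish (init-⇓ x (spec-body x))
      where
      open Machine (machine main accepting)
      S : Store
      S = store (move right (tape (ls x) blank (symbolsOnto (β x) (L x) (blank ∷ [])))) (W x) (regs (S′ x (L x)))
      result : ∀ T′ → T′ ∼ S → read (Vec.head T′) ≡ f x
      result (t ∷ _) (rel refl _) = trans (read-right (ls x) (symbolsOnto (β x) (L x) (blank ∷ [])))
        (trans (leadingBits-onto (β x) (L x) (blank ∷ [])) (sym (f≡ x)))
      finish : (∃[ n ] n ≤ suc (bodyTime (length x)) × ∃[ T′ ] T′ ∼ S ×
                ((cs : Vec Unit n) → main ⊢ load x ∷ replicate K empty ⇓[ toList cs ] T′)) →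
               let c = run (replicate (eval (poly runtime) (length x)) tt) (initial x) in
               Halted c × output c ≡ f x
      finish (n , n≤ , T′ , T′∼ , d) = subst (λ c → Halted c × output c ≡ f x)
        (sym (run-split main accepting (replicate (eval (poly runtime) (length x)) tt)
                (≤-trans (s≤s n≤) (≤-reflexive (agrees runtime (length x)))) d))
        (inj₁ refl , result T′ T′∼)

-- Machines that guess a word and check a formula

module Guess (q : Term 1) (φ : Formula 1) where

  t : Term 1
  t = truth φ

  K : ℕ
  K = 4 + (need q + need t)

  open Running Bool K

  guessing : Bool → Action
  guessing c a zero                x = x , stay
  guessing c a (suc zero)          x = x , stay
  guessing c a (suc (suc zero))    x = bit c , right
  guessing c a (suc (suc (suc _))) x = x , stay

  guess before check main : Prog
  guess  = loop 3 (oper guessing ⨟ dec 3)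
  -- The length of the guess is left in register 3, and the head of the guess tape is moved off its
  -- marker; `check` moves it back before the evaluation.
  before = setup ⨟ compile q (2 ∷ []) 3 ⨟ inc 1
  check  = clear 1 ⨟ compile t (2 ∷ []) 3
  main   = (initialize ⨟ before) ⨟ guess ⨟ check

  verdict : Syms → Bool
  verdict a = positive (symbol a 3)

  beforeTime checkTime guessTime : ℕ → ℕ
  beforeTime n = suc (suc (n * 2) + (1 + suc (suc n * 2)) + (timeBound q n + 1))
  guessTime m = suc (m * 3)
  checkTime n = suc (suc (valueBound q n) * 2) + timeBound t n

  abstract
    runtime : IsPoly (λ n → beforeTime n + (guessTime (valueBound q n) + suc (checkTime n)))
    runtime = poly-+
      (poly-suc (poly-+ (poly-+ (poly-suc (poly-* poly-id (poly-const 2))) (poly-suc (poly-suc (poly-* (poly-suc poly-id) (poly-const 2)))))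
                        (poly-+ (poly-time q) (poly-const 1))))
      (poly-+ (poly-suc (poly-* (poly-value q) (poly-const 3)))
        (poly-suc (poly-+ (poly-suc (poly-* (poly-suc (poly-value q)) (poly-const 2))) (poly-time t))))

  -- A round takes three steps, for the test, the writing and the decrement. Only the second choice
  -- of each triple is recorded.
  guessed : ∀ m → Vec Bool (guessTime m) → List Bool
  guessed zero    _                = []
  guessed (suc m) (_ ∷ b ∷ _ ∷ cs) = b ∷ guessed m cs

  length-guessed : ∀ m cs → length (guessed m cs) ≡ m
  length-guessed zero    _                = refl
  length-guessed (suc m) (_ ∷ b ∷ _ ∷ cs) = cong suc (length-guessed m cs)

  guessed-all : ∀ y → ∃[ cs ] guessed (length y) cs ≡ y
  guessed-all []      = false ∷ [] , refl
  guessed-all (b ∷ y) with cs , e ← guessed-all y = false ∷ b ∷ false ∷ cs , cong (b ∷_) e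

  guessed-any : ∀ y {m} → length y ≡ m → ∃[ cs ] guessed m cs ≡ y
  guessed-any y refl = guessed-all y

  module _ (x : List Bool) where

    n m : ℕ
    n = length x
    m = ⟦ q ⟧ (wordsOf x []) (n ∷ [])

    o : Tape 1
    o = tape (blank ∷ revOnto [] x) blank []

    guessStore : List Bool → ℕ → Store
    guessStore w k = store o (wordsOf x w) (regsOf 0 (suc (length w)) n) [ 3 ≔ k ]

    small : ∀ c {c<4 : True (c <? 4)} → c < K
    small c {c<4} = ≤-trans (toWitness c<4) (m≤m+n 4 _)

    spec-before : Spec before (store (reader [] x) (wordsOf [] []) (regsOf 1 0 0)) (guessStore [] m)
                              (suc (n * 2) + (1 + suc (suc n * 2)) + (timeBound q n + 1))
    spec-before =
      spec-setup x (small 0) ⨟ₛ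
      spec-compile q ready-setup (+-mono-≤ {3} {4} (s≤s (s≤s (s≤s z≤n))) (m≤m+n (need q) (need t))) n≤n* ⨟ₛ
      spec-resp (same-store refl (λ _ → refl) λ { 0 → refl ; 1 → refl ; 2 → refl ; 3 → refl ; (suc (suc (suc (suc _)))) → refl })
        (spec-inc {S = store o (wordsOf x []) (regsOf 0 0 n) [ 3 ≔ m ]} {r = 1} {v = 1} refl)

    guessing-∼ : ∀ {T} w k b → T ∼ guessStore w k →
      perform (tabulate λ i → guessing b (heads T) (toℕ i) (lookup (heads T) i)) T ∼ guessStore (w ++ [ b ]) k
    guessing-∼ {T} w k b T∼ = perform-∼ {guessing b} T∼ (λ { _ refl → refl }) λ τ t → go (toℕ τ) t
      where
      go : ∀ q t → Rep (cells (words (guessStore w k) q)) (regs (guessStore w k) q) t →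
           Rep (cells (words (guessStore (w ++ [ b ]) k) q)) (regs (guessStore (w ++ [ b ]) k) q)
               (act (guessing b (heads T) (suc q) (Tape.head t)) t)
      go zero                t r = r
      go (suc zero)          t r = subst (λ p → Rep (cells (w ++ [ b ])) (suc p) (act (bit b , right) t))
                                     (sym (trans (length-++ w) (+-comm _ 1))) (rep-append w b r)
      go (suc (suc zero))    t r = r
      go (suc (suc (suc q))) t r = r

    -- This does not fit the format of `Spec`, because the final store depends on the choices.
    guess-⇓ : ∀ k w {T} → T ∼ guessStore w k → (cs : Vec Bool (guessTime k)) →
              ∃[ T′ ] guess ⊢ T ⇓[ toList cs ] T′ × T′ ∼ guessStore (w ++ guessed k cs) 0
    guess-⇓ zero w T∼ (c ∷ []) = _ , stop (cong positive (symbol-∼ (small 3) T∼)) ,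
      subst (λ v → _ ∼ guessStore v 0) (sym (++-identityʳ w)) T∼
    guess-⇓ (suc k) w {T} T∼ (c ∷ b ∷ c′ ∷ cs)
      with spec-dec {S = guessStore (w ++ [ b ]) (suc k)} {r = 3} {v = k} refl (guessing-∼ w (suc k) b T∼)
    -- A specification bounds the number of steps only from above, but an `op` consumes exactly one
    -- choice.
    ... | zero , _ , T″ , T″∼ , d with () ← d []
    ... | suc (suc _) , s≤s () , _
    ... | suc zero , _ , T″ , T″∼ , d
      with T′ , e , T′∼ ← guess-⇓ k (w ++ [ b ])
             (∼-resp (same-store refl (λ _ → refl) λ { 0 → refl ; 1 → refl ; 2 → refl ; 3 → refl ; (suc (suc (suc (suc _)))) → refl }) T″∼) cs
      = T′ , again (trans (cong positive (symbol-∼ (small 3) T∼)) refl) (op ⨟ d (c′ ∷ [])) e ,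
        subst (λ v → T′ ∼ guessStore v 0) (++-assoc w [ b ] (guessed k cs)) T′∼

    value : List Bool → ℕ
    value y = ⟦ t ⟧ (wordsOf x y) (n ∷ [])

    spec-check : ∀ y → length y ≡ m →
      Spec check (guessStore y 0) (store o (wordsOf x y) (regsOf 0 0 n) [ 3 ≔ value y ]) (checkTime n)
    spec-check y |y| =
      spec-≤ (s≤s (*-monoˡ-≤ 2 (s≤s (≤-trans (≤-reflexive |y|) (value-≤ q n≤n*)))))
        (spec-resp (same-store refl (λ _ → refl) λ { 0 → refl ; 1 → refl ; 2 → refl ; (suc (suc (suc zero))) → refl ; (suc (suc (suc (suc _)))) → refl })
          (spec-clear {S = guessStore y 0} (small 1))) ⨟ₛ
      spec-compile t (ready-setup {o} {wordsOf x y}) (+-mono-≤ {3} {4} (s≤s (s≤s (s≤s z≤n))) (m≤n+m (need t) (need q))) n≤n*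

    open Machine (machine main verdict)

    record Outcome {t} (cs : Vec Bool t) (y : List Bool) : Set where
      constructor outcome
      field
        length≡ : length y ≡ m
        {final} : Tapes
        run≡    : run cs (initial x) ≡ config (if holds (value y) then zero else suc zero) final

    -- The number of steps before the guess is known only through a bound. The choices have to be
    -- cut exactly there, so the witness is passed on as an argument.
    Begun : Set
    Begun = ∃[ t₁ ] t₁ ≤ beforeTime n × ∃[ T₁ ] T₁ ∼ guessStore [] m ×
            ((cs : Vec Bool t₁) → initialize ⨟ before ⊢ load x ∷ replicate K empty ⇓[ toList cs ] T₁)

    begun : Begun
    begun = init-⇓ x spec-before

    run-outcome : ∀ ((t₁ , _) : Begun) {k} (as : Vec Bool t₁) (gs : Vec Bool (guessTime m)) (ds : Vec Bool k) →
                  suc (checkTime n) ≤ k → Outcome (as Vec.++ gs Vec.++ ds) (guessed m gs)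
    run-outcome (t₁ , _ , T₁ , T₁∼ , d) {k} as gs ds fits =
      let T₂ , e , T₂∼                 = guess-⇓ m [] T₁∼ gs
          t₃ , t₃≤ , T₃ , T₃∼ , f      = spec-check (guessed m gs) (length-guessed m gs) T₂∼
          bs , c , cs , ds≡            = toList-split ds (≤-trans (s≤s t₃≤) fits)
          split : toList (as Vec.++ gs Vec.++ ds) ≡ (toList as ++ toList gs ++ toList bs) ++ c ∷ cs
          split = trans (toList-++ as (gs Vec.++ ds)) (trans (cong (toList as ++_) (trans (toList-++ gs ds)
            (cong (toList gs ++_) ds≡)))
            (trans (cong (toList as ++_) (sym (++-assoc (toList gs) (toList bs) (c ∷ cs))))
                   (sym (++-assoc (toList as) (toList gs ++ toList bs) (c ∷ cs)))))
      in outcome (length-guessed m gs)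
           (trans (run-toList main verdict (as Vec.++ gs Vec.++ ds) (initial x))
           (trans (cong (λ l → runList main verdict l (initial x)) split)
           (trans (run-main main verdict c cs (d as ⨟ e ⨟ f bs))
             (cong (λ v → config (if v then zero else suc zero) T₃)
               (trans (cong positive (symbol-∼ (small 3) T₃∼)) (positive-empty (value (guessed m gs))))))))

    room-left : ∀ ((t₁ , _) : Begun) → ∃[ k ] suc (checkTime n) ≤ k × eval (poly runtime) n ≡ t₁ + (guessTime m + k)
    room-left (t₁ , t₁≤ , _) =
      let k , e = m≤n⇒split (≤-trans (+-mono-≤ t₁≤
                     (+-monoˡ-≤ (suc (checkTime n)) (s≤s (*-monoˡ-≤ 3 (value-≤ q n≤n*))))) (≤-reflexive (agrees runtime n)))
      in suc (checkTime n) + k , m≤m+n _ k , trans e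
        (trans (+-assoc t₁ (guessTime m + suc (checkTime n)) k) (cong (t₁ +_) (+-assoc (guessTime m) _ k)))

    -- Every choice sequence contains some guess in its middle part, and conversely a guess of the
    -- right length is padded with arbitrary choices on both sides.
    outcomes : ∀ ((t₁ , _) : Begun) {t} → (∃[ k ] suc (checkTime n) ≤ k × t ≡ t₁ + (guessTime m + k)) →
      ((cs : Vec Bool t) → ∃[ y ] Outcome cs y) × (∀ y → length y ≡ m → ∃[ cs ] Outcome {t} cs y)
    outcomes B@(t₁ , _) (k , fits , refl) = all , some
      where
      all : (cs : Vec Bool (t₁ + (guessTime m + k))) → ∃[ y ] Outcome cs y
      all cs =
        let as , bs , cs≡ = Vec.splitAt t₁ cs
            gs , ds , bs≡ = Vec.splitAt (guessTime m) bs
        in guessed m gs , subst (λ cs → Outcome cs (guessed m gs)) (sym (trans cs≡ (cong (as Vec.++_) bs≡)))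
                            (run-outcome B as gs ds fits)
      some : ∀ y → length y ≡ m → ∃[ cs ] Outcome {t₁ + (guessTime m + k)} cs y
      some y e =
        let gs , g = guessed-any y e
            cs     = replicate t₁ false Vec.++ gs Vec.++ replicate k false
        in cs , subst (Outcome cs) g (run-outcome B (replicate t₁ false) gs (replicate k false) fits)

  open Machine (machine main verdict)

  halted : ∀ {k b T} → k ≡ config (if b then zero else suc zero) T → Halted k
  halted {b = true}  refl = inj₁ refl
  halted {b = false} refl = inj₂ refl

  accepted : ∀ {v k T} → 0 < v → k ≡ config (if holds v then zero else suc zero) T → Accepting k
  accepted (s≤s _) refl = refl

  accepted⁻ : ∀ {v k T} → k ≡ config (if holds v then zero else suc zero) T → Accepting k → 0 < v
  accepted⁻ {suc v} _    _  = s≤s z≤n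
  accepted⁻ {zero}  refl ()

  module _ (x : List Bool) where

    all-halt : (cs : Vec Bool (eval (poly runtime) (length x))) → Halted (run cs (initial x))
    all-halt cs = halted (Outcome.run≡ (proj₂ (proj₁ (outcomes x (begun x) (room-left x (begun x))) cs)))

    some-accepts : ∀ y → length y ≡ m x → ⟦ φ ⟧ᶠ (wordsOf x y) (length x ∷ []) →
                   ∃[ cs ] Accepting (run {eval (poly runtime) (length x)} cs (initial x))
    some-accepts y |y| h =
      let cs , outcome _ e = proj₂ (outcomes x (begun x) (room-left x (begun x))) y |y|
      in cs , accepted (complete φ h) e

    accepts-some : (∃[ cs ] Accepting (run {eval (poly runtime) (length x)} cs (initial x))) →
                   ∃[ y ] length y ≡ m x × ⟦ φ ⟧ᶠ (wordsOf x y) (length x ∷ [])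
    accepts-some (cs , acc) =
      let y , outcome |y| e = proj₁ (outcomes x (begun x) (room-left x (begun x))) cs
      in y , |y| , sound φ (accepted⁻ e acc)

  decides : ∀ L → (∀ x → L x ⇔ (∃[ y ] length y ≡ m x × ⟦ φ ⟧ᶠ (wordsOf x y) (length x ∷ []))) → NP L
  decides L L⇔ = machine main verdict , poly runtime , λ x → all-halt x ,
    mk⇔ (λ Lx → let y , |y| , h = Equivalence.to (L⇔ x) Lx in some-accepts x y |y| h)
        (λ acc → Equivalence.from (L⇔ x) (accepts-some x acc))

-- Triple Roman domination and the encoding of graphs

module _ {n} (a : Fin n → Bool) (H : Fin n → ℕ) where

  active : Subset n
  active = tabulate λ w → a w ∧ (1 ≤ᵇ H w)

  -- Truncation makes inactive neighbours contribute 0, so the sum may run over all neighbours.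
  surplus : ℕ
  surplus = sum λ u → if a u then H u ∸ 1 else 0

module _ {n} (H : Fin n → ℕ) (S : Subset n) where

  summed : ℕ
  summed = sum λ u → if lookup S u then H u else 0

cons-active : ∀ b m {s c} → (if b ∧ (1 ≤ᵇ m) then m else 0) + (s + c) ≡
              ((if b then m ∸ 1 else 0) + s) + ((if b ∧ (1 ≤ᵇ m) then 1 else 0) + c)
cons-active false m           = refl
cons-active true  zero        = refl
cons-active true  (suc m) {s} {c} = lemma m s c
  where
  lemma : ∀ m s c → suc m + (s + c) ≡ (m + s) + (1 + c)
  lemma = solve-∀

∣∷∣ : ∀ b {n} (p : Subset n) → ∣ b ∷ p ∣ ≡ (if b then 1 else 0) + ∣ p ∣
∣∷∣ true  p = refl
∣∷∣ false p = refl

summed-active : ∀ {n} (a : Fin n → Bool) H → summed H (active a H) ≡ surplus a H + ∣ active a H ∣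
summed-active {zero}  a H = refl
summed-active {suc n} a H = begin
  (if b then H zero else 0) + summed (H ∘ suc) (active (a ∘ suc) (H ∘ suc))
    ≡⟨ cong ((if b then H zero else 0) +_) (summed-active (a ∘ suc) (H ∘ suc)) ⟩
  (if b then H zero else 0) + (surplus (a ∘ suc) (H ∘ suc) + ∣ active (a ∘ suc) (H ∘ suc) ∣)
    ≡⟨ cons-active (a zero) (H zero) ⟩
  surplus a H + ((if b then 1 else 0) + ∣ active (a ∘ suc) (H ∘ suc) ∣)
    ≡⟨ cong (surplus a H +_) (∣∷∣ b (active (a ∘ suc) (H ∘ suc))) ⟨
  surplus a H + ∣ active a H ∣ ∎
  where
  open ≡-Reasoning
  b : Bool
  b = a zero ∧ (1 ≤ᵇ H zero)

-- An active neighbour with label m accounts for m ∸ 1 in the surplus and 1 in the cardinality. As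
-- `v` is not its own neighbour, adjoining it adds `H v` exactly once.
summed-closed : ∀ {n} (a : Fin n → Bool) H v → a v ≡ false →
                summed H (active a H ∪ ⁅ v ⁆) ≡ H v + surplus a H + ∣ active a H ∣
summed-closed {suc n} a H zero av rewrite av | ∪-identityʳ (active (a ∘ suc) (H ∘ suc)) =
  trans (cong (H zero +_) (summed-active (a ∘ suc) (H ∘ suc))) (sym (+-assoc (H zero) _ _))
summed-closed {suc n} a H (suc v) av = begin
  (if b ∨ false then H zero else 0) + summed (H ∘ suc) (active (a ∘ suc) (H ∘ suc) ∪ ⁅ v ⁆)
    ≡⟨ cong₂ (λ c → (if c then H zero else 0) +_) (Boolₚ.∨-identityʳ b) (summed-closed (a ∘ suc) (H ∘ suc) v av) ⟩
  m + (H (suc v) + s + c)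
    ≡⟨ lemma m (H (suc v)) s c ⟩
  H (suc v) + (m + (s + c))
    ≡⟨ cong (H (suc v) +_) (cons-active (a zero) (H zero)) ⟩
  H (suc v) + (surplus a H + ((if b then 1 else 0) + c))
    ≡⟨ cong (λ k → H (suc v) + (surplus a H + k)) (∣∷∣ b (active (a ∘ suc) (H ∘ suc))) ⟨
  H (suc v) + (surplus a H + ∣ active a H ∣)
    ≡⟨ +-assoc (H (suc v)) _ _ ⟨
  H (suc v) + surplus a H + ∣ active a H ∣ ∎
  where
  open ≡-Reasoning
  b : Bool
  b = a zero ∧ (1 ≤ᵇ H zero)
  m s c : ℕ
  m = if b then H zero else 0
  s = surplus (a ∘ suc) (H ∘ suc)
  c = ∣ active (a ∘ suc) (H ∘ suc) ∣
  lemma : ∀ m h s c → m + (h + s + c) ≡ h + (m + (s + c))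
  lemma = solve-∀

module _ (Γ : Graph) (h : Labelling Γ) where
  open Graph Γ renaming (sym to adj-sym)

  -- In terms of the surplus h w − 1 of the neighbours, |AN(v)| drops out.
  Dominated : Vertex → Set
  Dominated v = toℕ (h v) < 3 → 3 ≤ toℕ (h v) + surplus (adj v) (toℕ ∘ h)

  private
    total≡ : ∀ v → total Γ h (AN[_] Γ h v) ≡ toℕ (h v) + surplus (adj v) (toℕ ∘ h) + ∣ AN Γ h v ∣
    total≡ v = summed-closed (adj v) (toℕ ∘ h) v (irrefl v)

  dominated⇒3RDF : (∀ v → Dominated v) → Is3RDF Γ h
  dominated⇒3RDF d v hv<3 = ≤-trans (≤-reflexive (+-comm _ 3))
    (≤-trans (+-monoˡ-≤ ∣ AN Γ h v ∣ (d v hv<3)) (≤-reflexive (sym (total≡ v))))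

  3RDF⇒dominated : Is3RDF Γ h → ∀ v → Dominated v
  3RDF⇒dominated r v hv<3 = +-cancelʳ-≤ ∣ AN Γ h v ∣ 3 _
    (≤-trans (≤-reflexive (+-comm 3 _)) (≤-trans (r v hv<3) (≤-reflexive (total≡ v))))

  weight≡ : weight Γ h ≡ sum (toℕ ∘ h)
  weight≡ = sum-cong-≗ {order} λ u → cong (if_then toℕ (h u) else 0) (lookup-replicate u true)

sum-sumTo : ∀ n (f : ℕ → ℕ) → sum {n} (f ∘ toℕ) ≡ sumTo n f
sum-sumTo zero    f = refl
sum-sumTo (suc n) f = trans (cong (f 0 +_) (sum-sumTo n (f ∘ suc))) (shift n f)
  where
  -- `sum` splits off the first summand and `sumTo` the last one.
  shift : ∀ n (f : ℕ → ℕ) → f 0 + sumTo n (f ∘ suc) ≡ sumTo n f + f n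
  shift zero    f = +-comm (f 0) 0
  shift (suc n) f = trans (sym (+-assoc (f 0) _ _)) (cong (_+ f (suc n)) (shift n f))

-- Codes of instances, position by position

nth-ext : {A : Set} {xs ys : List A} → (∀ i → nth xs i ≡ nth ys i) → xs ≡ ys
nth-ext {xs = []}     {[]}     e = refl
nth-ext {xs = []}     {_ ∷ _}  e with () ← e 0
nth-ext {xs = _ ∷ _}  {[]}     e with () ← e 0
nth-ext {xs = x ∷ xs} {y ∷ ys} e with refl ← e 0 = cong (x ∷_) (nth-ext (e ∘ suc))

nth-++ʳ : {A : Set} (xs ys : List A) (i : ℕ) → nth (xs ++ ys) (length xs + i) ≡ nth ys i
nth-++ʳ []       ys i = refl
nth-++ʳ (_ ∷ xs) ys i = nth-++ʳ xs ys i

nth-< : {A : Set} (xs : List A) {i : ℕ} → i < length xs → ∃[ a ] nth xs i ≡ just a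
nth-< (x ∷ xs) {zero}  _       = x , refl
nth-< (x ∷ xs) {suc i} (s≤s p) = nth-< xs p

nth-replicate : {A : Set} (a : A) (n : ℕ) {i : ℕ} → i < n → nth (List.replicate n a) i ≡ just a
nth-replicate a (suc n) {zero}  _       = refl
nth-replicate a (suc n) {suc i} (s≤s p) = nth-replicate a n p

nth-tabulate : {A : Set} {n : ℕ} (f : Fin n → A) (i : Fin n) → nth (List.tabulate f) (toℕ i) ≡ just (f i)
nth-tabulate f zero    = refl
nth-tabulate f (suc i) = nth-tabulate (f ∘ suc) i

module _ {A : Set} where

  rows : ∀ {m n} → (Fin m → Fin n → A) → List A
  rows f = concat (List.tabulate λ u → List.tabulate (f u))

  length-rows : ∀ {m n} (f : Fin m → Fin n → A) → length (rows f) ≡ m * n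
  length-rows {zero}  f = refl
  length-rows {suc m} f = trans (length-++ (List.tabulate (f zero)))
    (cong₂ _+_ (length-tabulate (f zero)) (length-rows (f ∘ suc)))

  nth-rows : ∀ {m n} (f : Fin m → Fin n → A) u v → nth (rows f) (n * toℕ u + toℕ v) ≡ just (f u v)
  nth-rows {n = n} f zero    v rewrite *-zeroʳ n =
    trans (nth-++ˡ (List.tabulate (f zero)) _ (subst (toℕ v <_) (sym (length-tabulate (f zero))) (toℕ<n v)))
          (nth-tabulate (f zero) v)
  nth-rows {n = n} f (suc u) v = begin
    nth (rows f) (n * suc (toℕ u) + toℕ v)
      ≡⟨ cong (nth (rows f)) (trans (cong (_+ toℕ v) (*-suc n (toℕ u))) (+-assoc n _ _)) ⟩
    nth (rows f) (n + (n * toℕ u + toℕ v))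
      ≡⟨ cong (λ l → nth (rows f) (l + (n * toℕ u + toℕ v))) (length-tabulate (f zero)) ⟨
    nth (rows f) (length (List.tabulate (f zero)) + (n * toℕ u + toℕ v))
      ≡⟨ nth-++ʳ (List.tabulate (f zero)) _ _ ⟩
    nth (rows (f ∘ suc)) (n * toℕ u + toℕ v)
      ≡⟨ nth-rows (f ∘ suc) u v ⟩
    just (f (suc u) v) ∎
    where open ≡-Reasoning

-- Formulas access words only by position, so the encoding is restated in these terms. The verifier
-- and the reduction both meet `encodeGraphWithBound` through this record and `codes-unique`.
record Codes (N k : ℕ) (a : Fin N → Fin N → Bool) (x : List Bool) : Set where
  field
    length≡   : length x ≡ N + suc (k + suc (N * N))
    order-bit : ∀ i → i < N → nth x i ≡ just true
    order-end : nth x (N + 0) ≡ just false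
    bound-bit : ∀ i → i < k → nth x (N + suc i) ≡ just true
    bound-end : nth x (N + suc (k + 0)) ≡ just false
    entry     : ∀ u v → nth x (N + suc (k + suc (N * toℕ u + toℕ v))) ≡ just (a u v)

<⊎+ : ∀ m i → i < m ⊎ ∃[ j ] i ≡ m + j
<⊎+ m i with i <? m
... | yes i<m = inj₁ i<m
... | no i≮m  = inj₂ (i ∸ m , sym (m+[n∸m]≡n (≮⇒≥ i≮m)))

codes-unique : ∀ {N k a x y} → Codes N k a x → Codes N k a y → x ≡ y
codes-unique {N} {k} {a} {x} {y} X Y = nth-ext same-bit
  where
  module X = Codes X
  module Y = Codes Y
  both : ∀ {i b} → nth x i ≡ just b → nth y i ≡ just b → nth x i ≡ nth y i
  both e f = trans e (sym f)
  same-bit : ∀ i → nth x i ≡ nth y i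
  same-bit i with <⊎+ N i
  ... | inj₁ i<N = both (X.order-bit i i<N) (Y.order-bit i i<N)
  ... | inj₂ (zero  , refl) = both X.order-end Y.order-end
  ... | inj₂ (suc j , refl) with <⊎+ k j
  ...   | inj₁ j<k = both (X.bound-bit j j<k) (Y.bound-bit j j<k)
  ...   | inj₂ (zero  , refl) = both X.bound-end Y.bound-end
  ...   | inj₂ (suc l , refl) with l <? N * N
  ...     | no l≮ = trans (nth-≥ x (beyond X.length≡)) (sym (nth-≥ y (beyond Y.length≡)))
    where
    beyond : ∀ {n} → n ≡ N + suc (k + suc (N * N)) → n ≤ N + suc (k + suc l)
    beyond refl = +-monoʳ-≤ N (s≤s (+-monoʳ-≤ k (s≤s (≮⇒≥ l≮))))
  ...     | yes l< = subst (λ l → nth x (N + suc (k + suc l)) ≡ nth y (N + suc (k + suc l))) l≡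
                       (both (X.entry (proj₁ uv) (proj₂ uv)) (Y.entry (proj₁ uv) (proj₂ uv)))
    where
    uv : Fin N × Fin N
    -- A position within the matrix is a row and a column by division with remainder.
    uv = remQuot {N} N (fromℕ< l<)
    l≡ : N * toℕ (proj₁ uv) + toℕ (proj₂ uv) ≡ l
    l≡ = trans (sym (toℕ-combine (proj₁ uv) (proj₂ uv)))
           (trans (cong toℕ (combine-remQuot {N} N (fromℕ< l<))) (toℕ-fromℕ< l<))

module _ (I : GraphWithBound) where
  open GraphWithBound I
  open Graph graph renaming (sym to adj-sym)

  private
    as bs : List Bool
    as = List.replicate order true
    bs = List.replicate k true
    x : List Bool
    x = encodeGraphWithBound I
    past-order : ∀ j → nth x (order + j) ≡ nth (false ∷ bs ++ false ∷ rows adj) j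
    past-order j = trans (cong (λ n → nth x (n + j)) (sym (length-replicate order))) (nth-++ʳ as _ j)
    past-bound : ∀ j → nth x (order + suc (k + j)) ≡ nth (false ∷ rows adj) j
    past-bound j = trans (past-order (suc (k + j)))
      (trans (cong (λ n → nth (bs ++ false ∷ rows adj) (n + j)) (sym (length-replicate k))) (nth-++ʳ bs _ j))

  encode-codes : Codes order k adj (encodeGraphWithBound I)
  encode-codes = record
    { length≡   = trans (length-++ as) (cong₂ (λ n m → n + suc m) (length-replicate order)
                    (trans (length-++ bs) (cong₂ (λ n m → n + suc m) (length-replicate k) (length-rows adj))))
    ; order-bit = λ i i<n → trans (nth-++ˡ as _ (subst (i <_) (sym (length-replicate order)) i<n)) (nth-replicate true order i<n)
    ; order-end = past-order 0
    ; bound-bit = λ i i<k → trans (past-order (suc i))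
                    (trans (nth-++ˡ bs _ (subst (i <_) (sym (length-replicate k)) i<k)) (nth-replicate true k i<k))
    ; bound-end = past-bound 0
    ; entry     = λ u v → trans (past-bound _) (nth-rows adj u v)
    }

length-bitsOnto : ∀ β n bs → length (bitsOnto β n bs) ≡ n + length bs
length-bitsOnto β zero    bs = refl
length-bitsOnto β (suc n) bs = trans (length-bitsOnto β n (β n ∷ bs)) (+-suc n _)

nth-bitsOnto-≥ : ∀ β n bs j → nth (bitsOnto β n bs) (n + j) ≡ nth bs j
nth-bitsOnto-≥ β zero    bs j = refl
nth-bitsOnto-≥ β (suc n) bs j =
  trans (cong (nth (bitsOnto β n (β n ∷ bs))) (sym (+-suc n j))) (nth-bitsOnto-≥ β n (β n ∷ bs) (suc j))

nth-bitsOnto : ∀ β n bs {i} → i < n → nth (bitsOnto β n bs) i ≡ just (β i)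
nth-bitsOnto β (suc n) bs {i} i<1+n with i ≟ n
... | yes refl = trans (cong (nth (bitsOnto β n (β n ∷ bs))) (sym (+-identityʳ n))) (nth-bitsOnto-≥ β n (β n ∷ bs) 0)
... | no i≢n   = nth-bitsOnto β n (β n ∷ bs) (≤∧≢⇒< (s≤s⁻¹ i<1+n) i≢n)

-- Membership in NP

BipartiteRomDom : DecisionProblem
BipartiteRomDom = TripleRomDom restrictedTo (Bipartite ∘ GraphWithBound.graph)

bitAt : List Bool → ℕ → ℕ
bitAt w i = if just true == nth w i then 1 else 0

-- A labelling is written with five bits for each vertex: the label in unary
-- and the side of the bipartition.
labelAt : List Bool → ℕ → ℕ
labelAt y v = bitAt y (5 * v + 0) + (bitAt y (5 * v + 1) + (bitAt y (5 * v + 2) + bitAt y (5 * v + 3)))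

entryIndex : ∀ {n} → (N k u v : Term n) → Term n
entryIndex N k u v = N ⊞ (lit 1 ⊞ (k ⊞ (lit 1 ⊞ (N ⊠ u ⊞ v))))

edgeT : ∀ {n} → (N k u v : Term n) → Term n
edgeT N k u v = cell (# 0) (just true) (entryIndex N k u v)

labelT sideT : ∀ {n} → Term n → Term n
labelT v = part 0 ⊞ (part 1 ⊞ (part 2 ⊞ part 3))
  where
  part : ℕ → Term _
  part c = cell (# 1) (just true) (lit 5 ⊠ v ⊞ lit c)
sideT v = cell (# 1) (just true) (lit 5 ⊠ v ⊞ lit 4)

v₀ : ∀ {n} → Term (1 + n)
v₀ = var (# 0)
v₁ : ∀ {n} → Term (2 + n)
v₁ = var (suc zero)
v₂ : ∀ {n} → Term (3 + n)
v₂ = var (suc (suc zero))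
v₃ : ∀ {n} → Term (4 + n)
v₃ = var (suc (suc (suc zero)))

-- The variables are the bound `v₀`, the order `v₁` and the input length `v₂`. The matrix entries
-- themselves are not constrained by the format: they define the adjacency, which is then required
-- to be symmetric, loopless and bipartite.
certified : Formula 3
certified =
  v₂ ≐ v₁ ⊞ (lit 1 ⊞ (v₀ ⊞ (lit 1 ⊞ v₁ ⊠ v₁))) ⋏
  lit 1 ≼ v₀ ⋏
  v₀ ≼ v₁ ⋏
  ∀< v₁ (reads (# 0) v₀ (just true)) ⋏
  reads (# 0) (v₁ ⊞ lit 0) (just false) ⋏
  ∀< v₀ (reads (# 0) (v₂ ⊞ (lit 1 ⊞ v₀)) (just true)) ⋏
  reads (# 0) (v₁ ⊞ (lit 1 ⊞ (v₀ ⊞ lit 0))) (just false) ⋏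
  ∀< v₁ (∀< v₂ (edgeT v₃ v₂ v₁ v₀ ≐ edgeT v₃ v₂ v₀ v₁)) ⋏
  ∀< v₁ (edgeT v₂ v₁ v₀ v₀ ≐ lit 0) ⋏
  ∀< v₁ (∀< v₂ (edgeT v₃ v₂ v₁ v₀ ≐ lit 0 ⋎ neg (sideT v₁ ≐ sideT v₀))) ⋏
  ∀< v₁ (lit 3 ≼ labelT v₀ ⋎
         lit 3 ≼ labelT v₀ ⊞ ∑ v₂ (edgeT v₃ v₂ v₁ v₀ ⊠ (labelT v₀ ⊟ lit 1))) ⋏
  ∑ v₁ (labelT v₀) ≼ v₀

certificate : Formula 1
certificate = ∃< (lit 1 ⊞ v₀) (∃< (lit 1 ⊞ v₁) certified)

indicator : Bool → ℕ
indicator b = if b then 1 else 0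

indicator-injective : ∀ {a b} → indicator a ≡ indicator b → a ≡ b
indicator-injective {false} {false} _ = refl
indicator-injective {true}  {true}  _ = refl

indicator-* : ∀ b m → indicator b * m ≡ (if b then m else 0)
indicator-* true  m = +-identityʳ m
indicator-* false m = refl

bitAt-≤ : ∀ y i → bitAt y i ≤ 1
bitAt-≤ y i with just true == nth y i
... | true  = ≤-refl
... | false = z≤n

-- Labels count the ones among four bits, so every guess describes a labelling and no format has to
-- be checked.
labelAt-≤ : ∀ y v → labelAt y v < 5
labelAt-≤ y v = s≤s (+-mono-≤ (bitAt-≤ y (5 * v + 0)) (+-mono-≤ (bitAt-≤ y (5 * v + 1))
  (+-mono-≤ (bitAt-≤ y (5 * v + 2)) (bitAt-≤ y (5 * v + 3)))))

from-Fin : ∀ {n} {P : ℕ → Set} → (∀ (v : Fin n) → P (toℕ v)) → ∀ i → i < n → P i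
from-Fin {P = P} p i i<n = subst P (toℕ-fromℕ< i<n) (p (fromℕ< i<n))

module _ (x y : List Bool) where

  -- The graph is read off from the matrix bits of `x`, and `codes-unique` shows that `x` is indeed
  -- the encoding of this graph.
  certificate-sound : ⟦ certificate ⟧ᶠ (wordsOf x y) (length x ∷ []) → language BipartiteRomDom x
  certificate-sound (N , _ , k , _ , len , 1≤k , k≤N , ones , end , ones′ , end′ , symm , loopless , sides , dom , wt) =
    (I , side , two-sided) ,
    codes-unique (encode-codes I) codes ,
    h , dominated⇒3RDF Γ h dominated , ≤-trans (≤-reflexive weight′) wt
    where
    edge : ℕ → ℕ → Bool
    edge u v = just true == nth x (N + suc (k + suc (N * u + v)))
    Γ : Graph
    Γ = record
      { order  = N
      ; adj    = λ u v → edge (toℕ u) (toℕ v)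
      ; sym    = λ u v → indicator-injective (symm (toℕ u) (toℕ<n u) (toℕ v) (toℕ<n v))
      ; irrefl = λ v → indicator-injective {edge (toℕ v) (toℕ v)} {false} (loopless (toℕ v) (toℕ<n v))
      }
    I : GraphWithBound
    I = record { graph = Γ ; k = k ; k-pos = 1≤k ; k≤order = k≤N }
    side : Fin N → Bool
    side v = just true == nth y (5 * toℕ v + 4)
    two-sided : ∀ u v → T (edge (toℕ u) (toℕ v)) → side u ≢ side v
    two-sided u v e s with sides (toℕ u) (toℕ<n u) (toℕ v) (toℕ<n v)
    ... | inj₁ z = subst T (indicator-injective {edge (toℕ u) (toℕ v)} {false} z) e
    ... | inj₂ d = d (cong indicator s)
    h : Labelling Γ
    h v = fromℕ< (labelAt-≤ y (toℕ v))
    h≡ : ∀ v → toℕ (h v) ≡ labelAt y (toℕ v)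
    h≡ v = toℕ-fromℕ< (labelAt-≤ y (toℕ v))
    surplus≡ : ∀ v → surplus (λ u → edge v (toℕ u)) (toℕ ∘ h) ≡ sumTo N λ u → indicator (edge v u) * (labelAt y u ∸ 1)
    surplus≡ v = trans (sum-cong-≗ {N} λ u → trans (cong (λ m → if edge v (toℕ u) then m ∸ 1 else 0) (h≡ u))
                                                 (sym (indicator-* (edge v (toℕ u)) _)))
                       (sum-sumTo N (λ u → indicator (edge v u) * (labelAt y u ∸ 1)))
    dominated : ∀ v → Dominated Γ h v
    dominated v small with dom (toℕ v) (toℕ<n v)
    ... | inj₁ big = ⊥-elim (<⇒≱ small (≤-trans big (≤-reflexive (sym (h≡ v)))))
    ... | inj₂ d   = ≤-trans d (≤-reflexive (sym (cong₂ _+_ (h≡ v) (surplus≡ (toℕ v)))))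
    weight′ : weight Γ h ≡ sumTo N (labelAt y)
    weight′ = trans (weight≡ Γ h) (trans (sum-cong-≗ {N} h≡) (sum-sumTo N (labelAt y)))
    codes : Codes N k (λ u v → edge (toℕ u) (toℕ v)) x
    codes = record
      { length≡ = len ; order-bit = ones ; order-end = end ; bound-bit = ones′ ; bound-end = end′
      ; entry = λ u v → lemma (subst (N + suc (k + suc (N * toℕ u + toℕ v)) <_) (sym len)
          (+-monoʳ-< N (s≤s (+-monoʳ-< k (s≤s (≤-trans (≤-reflexive (sym (cong suc (toℕ-combine u v))))
             (toℕ<n (combine u v))))))))
      }
      where
      lemma : ∀ {i} → i < length x → nth x i ≡ just (just true == nth x i)
      lemma {i} i< with nth-< x i<
      ... | true  , e rewrite e = refl
      ... | false , e rewrite e = refl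

extend : {A : Set} {n : ℕ} → (Fin n → A) → A → ℕ → A
extend {n = zero}  f d _       = d
extend {n = suc _} f d zero    = f zero
extend {n = suc _} f d (suc i) = extend (f ∘ suc) d i

extend-toℕ : {A : Set} {n : ℕ} (f : Fin n → A) (d : A) (i : Fin n) → extend f d (toℕ i) ≡ f i
extend-toℕ f d zero    = refl
extend-toℕ f d (suc i) = extend-toℕ (f ∘ suc) d i

module _ (I : GraphWithBound) (bipartite : Bipartite (GraphWithBound.graph I))
         (h : Labelling (GraphWithBound.graph I)) where
  open GraphWithBound I renaming (k to K)
  open Graph graph renaming (order to N; sym to adj-sym)

  private
    side : Fin N → Bool
    side = proj₁ bipartite

    x : List Bool
    x = encodeGraphWithBound I

    code : ℕ → Fin 5 → Bool
    code v (suc (suc (suc (suc zero)))) = extend side false v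
    code v c                            = toℕ c <ᵇ toℕ (extend h zero v)

  -- The length of a guess is computed from the input length alone, before the order is known. So
  -- there is a row for each input bit, and the rows beyond the vertices hold default values.
  certificateOf : List Bool
  certificateOf = rows {m = length x} (code ∘ toℕ)

  private
    module X = Codes (encode-codes I)

    N≤n : N ≤ length x
    N≤n = ≤-trans (m≤m+n N _) (≤-reflexive (sym X.length≡))

    K≤n : K ≤ length x
    K≤n = ≤-trans k≤order N≤n

    written : ∀ (v : Fin N) c → nth certificateOf (5 * toℕ v + toℕ c) ≡ just (code (toℕ v) c)
    written v c = subst (λ w → nth certificateOf (5 * w + toℕ c) ≡ just (code w c)) (toℕ-fromℕ< v<n)
                        (nth-rows (code ∘ toℕ) (fromℕ< v<n) c)
      where
      v<n : toℕ v < length x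
      v<n = <-≤-trans (toℕ<n v) N≤n

    unary : ∀ (m : Fin 5) → indicator (0 <ᵇ toℕ m) + (indicator (1 <ᵇ toℕ m) + (indicator (2 <ᵇ toℕ m) + indicator (3 <ᵇ toℕ m))) ≡ toℕ m
    unary zero                         = refl
    unary (suc zero)                   = refl
    unary (suc (suc zero))             = refl
    unary (suc (suc (suc zero)))       = refl
    unary (suc (suc (suc (suc zero)))) = refl

    bit≡ : ∀ (v : Fin N) c → bitAt certificateOf (5 * toℕ v + toℕ c) ≡ indicator (code (toℕ v) c)
    bit≡ v c rewrite written v c with code (toℕ v) c
    ... | true  = refl
    ... | false = refl

    label≡ : ∀ v → labelAt certificateOf (toℕ v) ≡ toℕ (h v)
    label≡ v = trans (cong₂ _+_ (bit≡ v (# 0)) (cong₂ _+_ (bit≡ v (# 1)) (cong₂ _+_ (bit≡ v (# 2)) (bit≡ v (# 3)))))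
      (trans (unary (extend h zero (toℕ v))) (cong toℕ (extend-toℕ h zero v)))

    edge≡ : ∀ u v → bitAt x (N + suc (K + suc (N * toℕ u + toℕ v))) ≡ indicator (adj u v)
    edge≡ u v rewrite X.entry u v with adj u v
    ... | true  = refl
    ... | false = refl

    surplus≡ : ∀ v → sumTo N (λ u → bitAt x (N + suc (K + suc (N * toℕ v + u))) * (labelAt certificateOf u ∸ 1))
                     ≡ surplus (adj v) (toℕ ∘ h)
    surplus≡ v = trans (sym (sum-sumTo N _)) (sum-cong-≗ {N} λ u →
      trans (cong₂ _*_ (edge≡ v u) (cong (_∸ 1) (label≡ u))) (indicator-* (adj v u) _))

  certificate-complete : Is3RDF graph h → weight graph h ≤ K →
    length certificateOf ≡ length x * 5 × ⟦ certificate ⟧ᶠ (wordsOf x certificateOf) (length x ∷ [])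
  certificate-complete r w =
    length-rows {m = length x} (code ∘ toℕ) ,
    N , s≤s N≤n , K , s≤s K≤n ,
    X.length≡ , k-pos , k≤order , X.order-bit , X.order-end , X.bound-bit , X.bound-end ,
    from-Fin (λ u → from-Fin λ v → trans (edge≡ u v) (trans (cong indicator (adj-sym u v)) (sym (edge≡ v u)))) ,
    from-Fin (λ v → trans (edge≡ v v) (cong indicator (irrefl v))) ,
    from-Fin (λ u → from-Fin λ v → sides u v) ,
    from-Fin dom ,
    ≤-trans (≤-reflexive (trans (sym (sum-sumTo N (labelAt certificateOf))) (trans (sum-cong-≗ {N} label≡) (sym (weight≡ graph h))))) w
    where
    sides : ∀ u v → bitAt x (N + suc (K + suc (N * toℕ u + toℕ v))) ≡ 0 ⊎
                    bitAt certificateOf (5 * toℕ u + 4) ≢ bitAt certificateOf (5 * toℕ v + 4)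
    sides u v with adj u v in e
    ... | false = inj₁ (trans (edge≡ u v) (cong indicator e))
    ... | true  = inj₂ λ s → proj₂ bipartite u v (subst T (sym e) _)
      (trans (sym (extend-toℕ side false u)) (trans
        (indicator-injective (trans (sym (bit≡ u (# 4))) (trans s (bit≡ v (# 4))))) (extend-toℕ side false v)))
    dom : ∀ v → 3 ≤ labelAt certificateOf (toℕ v) ⊎
                3 ≤ labelAt certificateOf (toℕ v) + sumTo N (λ u → bitAt x (N + suc (K + suc (N * toℕ v + u))) * (labelAt certificateOf u ∸ 1))
    dom v with toℕ (h v) <? 3
    ... | no  big   = inj₁ (≤-trans (≮⇒≥ big) (≤-reflexive (sym (label≡ v))))
    ... | yes small = inj₂ (≤-trans (3RDF⇒dominated graph h r v small)
                              (≤-reflexive (sym (cong₂ _+_ (label≡ v) (surplus≡ v)))))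

romDom-NP : NP (language BipartiteRomDom)
romDom-NP = Guess.decides (v₀ ⊠ lit 5) certificate _ λ x → mk⇔
  (λ { ((I , b) , refl , h , r , w) → certificateOf I b h , certificate-complete I b h r w })
  (λ { (y , _ , c) → certificate-sound x y c })

-- The gadget graph of a tableau

sum-↑ : ∀ m {n} (f : Fin (m + n) → ℕ) → sum f ≡ sum (f ∘ (_↑ˡ n)) + sum (f ∘ (m ↑ʳ_))
sum-↑ zero    f = refl
sum-↑ (suc m) f = trans (cong (f zero +_) (sum-↑ m (f ∘ suc))) (sym (+-assoc (f zero) _ _))

sum-combine : ∀ m {n} (f : Fin (m * n) → ℕ) → sum f ≡ sum λ i → sum λ j → f (combine {m} i j)
sum-combine zero    f = refl
sum-combine (suc m) {n} f = trans (sum-↑ n f) (cong (sum (f ∘ (_↑ˡ m * n)) +_) (sum-combine m (f ∘ (n ↑ʳ_))))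

sum-zero : ∀ {n} {f : Fin n → ℕ} → (∀ i → f i ≡ 0) → sum f ≡ 0
sum-zero {zero}  z = refl
sum-zero {suc n} z = cong₂ _+_ (z zero) (sum-zero (z ∘ suc))

sum-single : ∀ {n} {f : Fin n → ℕ} i → (∀ j → j ≢ i → f j ≡ 0) → sum f ≡ f i
sum-single {f = f} zero    z = trans (cong (f zero +_) (sum-zero λ j → z (suc j) λ ())) (+-identityʳ _)
sum-single {f = f} (suc i) z = cong₂ _+_ (z zero λ ()) (sum-single i λ j j≢i → z (suc j) (j≢i ∘ Finₚ.suc-injective))

sum-term : ∀ {n} (f : Fin n → ℕ) i → f i ≤ sum f
sum-term f zero    = m≤m+n _ _
sum-term f (suc i) = ≤-trans (sum-term (f ∘ suc) i) (m≤n+m _ (f zero))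

sum-terms : ∀ {n} (f : Fin n → ℕ) {i j} → i ≢ j → f i + f j ≤ sum f
sum-terms f {zero}  {zero}  i≢j = contradiction refl i≢j
sum-terms f {zero}  {suc j} _   = +-monoʳ-≤ (f zero) (sum-term (f ∘ suc) j)
sum-terms f {suc i} {zero}  _   = ≤-trans (≤-reflexive (+-comm (f (suc i)) _)) (+-monoʳ-≤ (f zero) (sum-term (f ∘ suc) i))
sum-terms f {suc i} {suc j} i≢j = ≤-trans (sum-terms (f ∘ suc) (i≢j ∘ cong suc)) (m≤n+m _ (f zero))

sum-positive : ∀ {n} (f : Fin n → ℕ) → 0 < sum f → ∃[ i ] 0 < f i
sum-positive {suc n} f p with f zero in eq
... | suc _ = zero , subst (0 <_) (sym eq) (s≤s z≤n)
... | zero with i , q ← sum-positive (f ∘ suc) p = suc i , q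

sum-<-zero : ∀ {n} (f : Fin n → ℕ) → sum f < n → ∃[ i ] f i ≡ 0
sum-<-zero {suc n} f p with f zero in eq
... | zero = zero , eq
... | suc m with i , e ← sum-<-zero (f ∘ suc) (≤-trans (s≤s (m≤n+m _ m)) (s≤s⁻¹ p)) = suc i , e

sum-≤ : ∀ {n} {f g : Fin n → ℕ} → (∀ i → f i ≤ g i) → sum f ≤ sum g
sum-≤ {zero}  l = z≤n
sum-≤ {suc n} l = +-mono-≤ (l zero) (sum-≤ (l ∘ suc))

sum-const : ∀ n c → sum {n} (λ _ → c) ≡ n * c
sum-const zero    c = refl
sum-const (suc n) c = cong (c +_) (sum-const n c)

-- Bounding all other summands from below leaves at most `c` for each one. This turns the global
-- budget into a local one.
sum-tight : ∀ {n} (f : Fin n → ℕ) {c} → (∀ i → c ≤ f i) → sum f ≤ n * c → ∀ i → f i ≤ c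
sum-tight {suc n} f {c} lo hi = λ where
    zero    → +-cancelʳ-≤ (n * c) (f zero) c (≤-trans (+-monoʳ-≤ (f zero) rest-lo) hi)
    (suc i) → sum-tight (f ∘ suc) (lo ∘ suc) (+-cancelˡ-≤ c _ _ (≤-trans (+-monoˡ-≤ _ (lo zero)) hi)) i
  where
  lower : ∀ n (f : Fin n → ℕ) → (∀ i → c ≤ f i) → n * c ≤ sum f
  lower zero    f l = z≤n
  lower (suc n) f l = +-mono-≤ (l zero) (lower n (f ∘ suc) (l ∘ suc))
  rest-lo : n * c ≤ sum (f ∘ suc)
  rest-lo = lower n (f ∘ suc) (lo ∘ suc)

sum-surplus : ∀ {n} (f : Fin n → ℕ) → sum f ≡ sum (λ i → f i ∸ 1) + sum (λ i → f i ⊓ 1)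
sum-surplus f = trans (sum-cong-≗ λ i → split (f i)) (∑-distrib-+ (λ i → f i ∸ 1) (λ i → f i ⊓ 1))
  where
  split : ∀ m → m ≡ (m ∸ 1) + (m ⊓ 1)
  split zero          = refl
  split (suc zero)    = refl
  split (suc (suc m)) = sym (+-comm (suc m) 1)

module _ {n} (f : Fin n → ℕ) (big : 3 ≤ sum (λ i → f i ∸ 1)) where

  -- A label is its surplus plus one unit if it is positive, and a positive surplus needs at least
  -- one such unit.
  surplus-total : 4 ≤ sum f
  surplus-total with i , p ← sum-positive (λ i → f i ∸ 1) (≤-trans (s≤s z≤n) big) =
    ≤-trans (+-mono-≤ big (≤-trans (unit (f i) p) (sum-term (λ i → f i ⊓ 1) i))) (≤-reflexive (sym (sum-surplus f)))
    where
    unit : ∀ m → 0 < m ∸ 1 → 1 ≤ m ⊓ 1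
    unit (suc m) _ = s≤s z≤n

  -- Two positive labels would add two units to the surplus 3.
  surplus-unique : sum f ≤ 4 → ∀ {i j} → 0 < f i → 0 < f j → i ≡ j
  surplus-unique small {i} {j} p q with i Fin.≟ j
  ... | yes e = e
  ... | no  d = contradiction
    (≤-trans (+-mono-≤ big (≤-trans (+-mono-≤ (⊓-glb p ≤-refl) (⊓-glb q ≤-refl)) (sum-terms (λ i → f i ⊓ 1) d)))
      (≤-trans (≤-reflexive (sym (sum-surplus f))) small)) λ { (s≤s (s≤s (s≤s (s≤s ())))) }

-- Nine guards and nine leaves are one more than a cell of weight 8 can label. A clause stands for a
-- quintuple of values, coded as a function from `Fin 5`.
data Kind (A : ℕ) : Set where
  guard leaf : Fin 9 → Kind A
  hub        : Kind A
  option     : Fin A → Kind A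
  clause     : Fin (A ^ 5) → Kind A

kinds : ℕ → ℕ
kinds A = 9 + (9 + (1 + (A + A ^ 5)))

module _ {A : ℕ} where

  code : Kind A → Fin (kinds A)
  code (guard i)  = i ↑ˡ _
  code (leaf i)   = 9 ↑ʳ (i ↑ˡ _)
  code hub        = 9 ↑ʳ (9 ↑ʳ zero)
  code (option a) = 9 ↑ʳ (9 ↑ʳ suc (a ↑ˡ _))
  code (clause q) = 9 ↑ʳ (9 ↑ʳ suc (A ↑ʳ q))

  decode₃ : Fin (1 + (A + A ^ 5)) → Kind A
  decode₃ zero    = hub
  decode₃ (suc e) = [ option , clause ]′ (splitAt A e)

  decode₂ : Fin (9 + (1 + (A + A ^ 5))) → Kind A
  decode₂ e = [ leaf , decode₃ ]′ (splitAt 9 e)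

  decode : Fin (kinds A) → Kind A
  decode e = [ guard , decode₂ ]′ (splitAt 9 e)

  decode-code : ∀ κ → decode (code κ) ≡ κ
  decode-code (guard i)  = cong [ guard , decode₂ ]′ (splitAt-↑ˡ 9 i _)
  decode-code (leaf i)   = trans (cong [ guard , decode₂ ]′ (splitAt-↑ʳ 9 _ (i ↑ˡ _))) (cong [ leaf , decode₃ ]′ (splitAt-↑ˡ 9 i _))
  decode-code hub        = refl
  decode-code (option a) = cong [ option , clause ]′ (splitAt-↑ˡ A a _)
  decode-code (clause q) = cong [ option , clause ]′ (splitAt-↑ʳ A _ q)

  parts : (Kind A → ℕ) → ℕ
  parts f = sum (f ∘ guard) + (sum (f ∘ leaf) + (f hub + (sum (f ∘ option) + sum (f ∘ clause))))

  module _ (f : Kind A → ℕ) where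

    parts-zero : (∀ κ → f κ ≡ 0) → parts f ≡ 0
    parts-zero z = cong₂ _+_ (sum-zero {f = f ∘ guard} (z ∘ guard)) (cong₂ _+_ (sum-zero {f = f ∘ leaf} (z ∘ leaf))
      (cong₂ _+_ (z hub) (cong₂ _+_ (sum-zero {f = f ∘ option} (z ∘ option)) (sum-zero {f = f ∘ clause} (z ∘ clause)))))

    parts-hub-option : (∀ i → f (guard i) ≡ 0) → (∀ i → f (leaf i) ≡ 0) → (∀ q → f (clause q) ≡ 0) →
                       parts f ≡ f hub + sum (f ∘ option)
    parts-hub-option g l c = cong₂ _+_ (sum-zero {f = f ∘ guard} g) (cong₂ _+_ (sum-zero {f = f ∘ leaf} l)
      (cong (f hub +_) (trans (cong (sum (f ∘ option) +_) (sum-zero {f = f ∘ clause} c)) (+-identityʳ _))))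

  code-decode₃ : ∀ e → code (decode₃ e) ≡ 9 ↑ʳ (9 ↑ʳ e)
  code-decode₃ zero    = refl
  code-decode₃ (suc e) = trans (lemma (splitAt A e)) (cong (λ e → 9 ↑ʳ (9 ↑ʳ suc e)) (join-splitAt A (A ^ 5) e))
    where
    lemma : ∀ x → code ([ option , clause ]′ x) ≡ 9 ↑ʳ (9 ↑ʳ suc (join A (A ^ 5) x))
    lemma (inj₁ _) = refl
    lemma (inj₂ _) = refl

  code-decode₂ : ∀ e → code (decode₂ e) ≡ 9 ↑ʳ e
  code-decode₂ e = trans (lemma (splitAt 9 e)) (cong (9 ↑ʳ_) (join-splitAt 9 (1 + (A + A ^ 5)) e))
    where
    lemma : ∀ x → code ([ leaf , decode₃ ]′ x) ≡ 9 ↑ʳ join 9 (1 + (A + A ^ 5)) x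
    lemma (inj₁ _) = refl
    lemma (inj₂ e) = code-decode₃ e

  code-decode : ∀ e → code (decode e) ≡ e
  code-decode e = trans (lemma (splitAt 9 e)) (join-splitAt 9 (9 + (1 + (A + A ^ 5))) e)
    where
    lemma : ∀ x → code ([ guard , decode₂ ]′ x) ≡ join 9 (9 + (1 + (A + A ^ 5))) x
    lemma (inj₁ _) = refl
    lemma (inj₂ e) = code-decode₂ e

  sum-kinds : (f : Fin (kinds A) → ℕ) → sum f ≡ parts (f ∘ code)
  sum-kinds f = trans (sum-↑ 9 f) (cong (sum (f ∘ code ∘ guard) +_)
    (trans (sum-↑ 9 (f ∘ (9 ↑ʳ_))) (cong (sum (f ∘ code ∘ leaf) +_)
      (cong (f (code hub) +_) (sum-↑ A (λ e → f (9 ↑ʳ (9 ↑ʳ suc e))))))))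

-- The cells that a clause for the cell (t , j) speaks about.
scope : Fin 5 → ℕ → ℕ → ℕ × ℕ
scope zero                         t j = t , 0
scope (suc zero)                   t j = t , pred j
scope (suc (suc zero))             t j = t , j
scope (suc (suc (suc zero)))       t j = t , suc j
scope (suc (suc (suc (suc zero)))) t j = suc t , j

-- A tableau assigns a value to every cell (t , j) with t, j ≤ D. A vertex
-- of the graph belongs to a cell and is one of
--   an option, for a value of the cell,
--   a guard, adjacent to the admissible options of the cell,
--   the hub, adjacent to all options of the cell,
--   a leaf, adjacent to the hub only,
--   a clause, adjacent to the options that differ from the values that the
--   clause forbids in combination.
-- Weight 8 in a cell can only mean label 4 on the hub and on one option.
module Gadget (D A : ℕ) (Ok : ℕ → ℕ → Fin A → Set) (Rule : Vec (Fin A) 5 → Set) where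

  side : ℕ
  side = suc D

  N : ℕ
  N = side * side * kinds A

  Site : Set
  Site = Fin (side * side)

  opaque

    row col : Site → ℕ
    row s = toℕ (proj₁ (remQuot {side} side s))
    col s = toℕ (proj₂ (remQuot {side} side s))

    row≤ : ∀ s → row s ≤ D
    row≤ s = toℕ≤pred[n] (proj₁ (remQuot {side} side s))

    col≤ : ∀ s → col s ≤ D
    col≤ s = toℕ≤pred[n] (proj₂ (remQuot {side} side s))

    site : ∀ {t j} → t ≤ D → j ≤ D → ∃[ s ] row s ≡ t × col s ≡ j
    site {t} {j} t≤ j≤ = combine t′ j′ ,
      trans (cong (toℕ ∘ proj₁) (remQuot-combine t′ j′)) (toℕ-fromℕ< (s≤s t≤)) ,
      trans (cong (toℕ ∘ proj₂) (remQuot-combine t′ j′)) (toℕ-fromℕ< (s≤s j≤))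
      where
      t′ j′ : Fin side
      t′ = fromℕ< (s≤s t≤)
      j′ = fromℕ< (s≤s j≤)

    site-≡ : ∀ {s s′} → row s ≡ row s′ → col s ≡ col s′ → s ≡ s′
    site-≡ {s} {s′} r c = trans (sym (combine-remQuot {side} side s))
      (trans (cong₂ combine (toℕ-injective r) (toℕ-injective c)) (combine-remQuot {side} side s′))

  -- Clause vertices exist for all quintuples and all cells, which makes the vertex set a product.
  -- Those that forbid nothing, because the quintuple obeys the rule or the cell lies on the border,
  -- are adjacent to all options of all cells.
  record Hit (t j : ℕ) (a : Fin A) (t′ j′ : ℕ) (q : Fin (A ^ 5)) : Set where
    constructor hit
    field
      reason : Rule (tabulate (finToFun q)) ⊎ (t′ ≡ D ⊎ j′ ≡ D) ⊎
               (∃[ i ] scope i t′ j′ ≡ (t , j) × a ≢ finToFun q i)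

  -- Links are oriented from options and leaves to guards, hubs and clauses. These are the two sides
  -- of the bipartition.
  Link : ℕ → ℕ → Kind A → ℕ → ℕ → Kind A → Set
  Link t j (option a) t′ j′ (guard _)  = t ≡ t′ × j ≡ j′ × Ok t j a
  Link t j (option a) t′ j′ hub        = t ≡ t′ × j ≡ j′
  Link t j (leaf _)   t′ j′ hub        = t ≡ t′ × j ≡ j′
  Link t j (option a) t′ j′ (clause q) = Hit t j a t′ j′ q
  Link _ _ _          _  _  _          = ⊥

  Tableau : (ℕ → ℕ → Fin A) → Set
  Tableau w = (∀ t j → t ≤ D → j ≤ D → Ok t j (w t j)) ×
              (∀ t j → t < D → j < D → Rule (tabulate λ i → uncurry w (scope i t j)))

  opaque

    siteOf : Fin N → Site
    siteOf v = proj₁ (remQuot {side * side} (kinds A) v)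

    kindOf : Fin N → Kind A
    kindOf v = decode (proj₂ (remQuot {side * side} (kinds A) v))

    vertex : Site → Kind A → Fin N
    vertex s κ = combine s (code κ)

    siteOf-vertex : ∀ s κ → siteOf (vertex s κ) ≡ s
    siteOf-vertex s κ = cong proj₁ (remQuot-combine s (code κ))

    kindOf-vertex : ∀ s κ → kindOf (vertex s κ) ≡ κ
    kindOf-vertex s κ = trans (cong (decode ∘ proj₂) (remQuot-combine s (code κ))) (decode-code κ)

    vertex-of : ∀ v → v ≡ vertex (siteOf v) (kindOf v)
    vertex-of v = trans (sym (combine-remQuot {side * side} (kinds A) v)) (cong (combine (siteOf v)) (sym (code-decode _)))

    parts-of-sum : (f : Fin N → ℕ) → sum f ≡ sum λ s → parts (f ∘ vertex s)
    parts-of-sum f = trans (sum-combine (side * side) f)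
      (sum-cong-≗ {x = λ s → sum (f ∘ combine s)} {λ s → parts (f ∘ vertex s)} λ s → sum-kinds {A} (f ∘ combine s))

  opaque
    unfolding row siteOf

    -- Together with `position`, this describes the numbering of the vertices by arithmetic that a
    -- formula can express.
    located : ∀ (u : Fin N) e {t j} → t < side → j < side → toℕ u ≡ kinds A * (side * t + j) + toℕ e →
              row (siteOf u) ≡ t × col (siteOf u) ≡ j × kindOf u ≡ decode e
    located u e {t} {j} t< j< eq =
      trans (cong row s≡) (trans (cong (toℕ ∘ proj₁) (remQuot-combine (fromℕ< t<) (fromℕ< j<))) (toℕ-fromℕ< t<)) ,
      trans (cong col s≡) (trans (cong (toℕ ∘ proj₂) (remQuot-combine (fromℕ< t<) (fromℕ< j<))) (toℕ-fromℕ< j<)) ,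
      cong (decode ∘ proj₂) split
      where
      s : Site
      s = combine (fromℕ< t<) (fromℕ< j<)
      u≡ : u ≡ combine s e
      u≡ = toℕ-injective (trans eq (sym (trans (toℕ-combine s e) (cong (λ m → kinds A * m + toℕ e)
        (trans (toℕ-combine (fromℕ< t<) (fromℕ< j<)) (cong₂ (λ a b → side * a + b) (toℕ-fromℕ< t<) (toℕ-fromℕ< j<)))))))
      split : remQuot {side * side} (kinds A) u ≡ (s , e)
      split = trans (cong (remQuot {side * side} (kinds A)) u≡) (remQuot-combine s e)
      s≡ : siteOf u ≡ s
      s≡ = cong proj₁ split

    position : ∀ (u : Fin N) → ∃[ e ] toℕ u ≡ kinds A * (side * row (siteOf u) + col (siteOf u)) + toℕ e × kindOf u ≡ decode e
    position u = e , trans (cong toℕ (sym (combine-remQuot {side * side} (kinds A) u)))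
      (trans (toℕ-combine (siteOf u) e) (cong (λ m → kinds A * m + toℕ e)
        (trans (cong toℕ (sym (combine-remQuot {side} side (siteOf u))))
               (toℕ-combine (proj₁ (remQuot {side} side (siteOf u))) (proj₂ (remQuot {side} side (siteOf u))))))) , refl
      where
      e : Fin (kinds A)
      e = proj₂ (remQuot {side * side} (kinds A) u)

  Linked : Fin N → Fin N → Set
  Linked u v = Link (row (siteOf u)) (col (siteOf u)) (kindOf u) (row (siteOf v)) (col (siteOf v)) (kindOf v)

  -- The adjacency is a parameter, so that it can be instantiated by the very bits that the
  -- reduction computes.
  module Graphs (adj : Fin N → Fin N → Bool) (adj⇒ : ∀ u v → T (adj u v) → Linked u v ⊎ Linked v u)
                (adj⇐ : ∀ u v → Linked u v ⊎ Linked v u → T (adj u v)) where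

    isLeft : Kind A → Bool
    isLeft (option _) = true
    isLeft (leaf _)   = true
    isLeft _          = false

    link-sides : ∀ {t j t′ j′} κ κ′ → Link t j κ t′ j′ κ′ → isLeft κ ≡ true × isLeft κ′ ≡ false
    link-sides (option _) (guard _)  _ = refl , refl
    link-sides (option _) hub        _ = refl , refl
    link-sides (option _) (clause _) _ = refl , refl
    link-sides (leaf _)   hub        _ = refl , refl

    T-≡ : ∀ {a b} → (T a → T b) → (T b → T a) → a ≡ b
    T-≡ {false} {false} f g = refl
    T-≡ {false} {true}  f g = ⊥-elim (g _)
    T-≡ {true}  {false} f g = ⊥-elim (f _)
    T-≡ {true}  {true}  f g = refl

    colour : Fin N → Bool
    colour = isLeft ∘ kindOf

    bipartition : ∀ u v → T (adj u v) → colour u ≢ colour v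
    bipartition u v e c with adj⇒ u v e
    ... | inj₁ l with p , q ← link-sides (kindOf u) (kindOf v) l with () ← trans (sym p) (trans c q)
    ... | inj₂ l with p , q ← link-sides (kindOf v) (kindOf u) l with () ← trans (sym p) (trans (sym c) q)

    Γ : Graph
    Γ = record
      { order  = N
      ; adj    = adj
      ; sym    = λ u v → T-≡ (adj⇐ v u ∘ Sum.swap ∘ adj⇒ u v) (adj⇐ u v ∘ Sum.swap ∘ adj⇒ v u)
      ; irrefl = λ v → T-≡ {b = false} (λ e → bipartition v v e refl) ⊥-elim
      }

    bound : ℕ
    bound = side * side * 8

    instance-of : GraphWithBound
    instance-of = record
      -- The guards alone give each cell more than 8 vertices.
      { graph = Γ ; k = bound ; k-pos = s≤s z≤n ; k≤order = *-monoʳ-≤ (side * side) (m≤m+n 8 _) }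

    neighbours : ∀ {s κ s′ κ′} → T (adj (vertex s κ) (vertex s′ κ′)) →
                 Link (row s) (col s) κ (row s′) (col s′) κ′ ⊎ Link (row s′) (col s′) κ′ (row s) (col s) κ
    neighbours {s} {κ} {s′} {κ′} e = back (adj⇒ _ _ e)
      where
      back : Linked (vertex s κ) (vertex s′ κ′) ⊎ Linked (vertex s′ κ′) (vertex s κ) →
             Link (row s) (col s) κ (row s′) (col s′) κ′ ⊎ Link (row s′) (col s′) κ′ (row s) (col s) κ
      back l rewrite siteOf-vertex s κ | kindOf-vertex s κ | siteOf-vertex s′ κ′ | kindOf-vertex s′ κ′ = l

    -- From a light dominating function to a tableau

    module _ (h : Labelling Γ) (dominated : ∀ v → Dominated Γ h v) (light : sum (toℕ ∘ h) ≤ bound) where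

      H : Site → Kind A → ℕ
      H s κ = toℕ (h (vertex s κ))

      cost : Site → ℕ
      cost s = parts (H s)

      excess : Fin N → Fin N → ℕ
      excess v u = if adj v u then toℕ (h u) ∸ 1 else 0

      excess-zero : ∀ {v u} → ¬ T (adj v u) → excess v u ≡ 0
      excess-zero {v} {u} ¬e with adj v u
      ... | true  = contradiction _ ¬e
      ... | false = refl

      excess-≤ : ∀ v u → excess v u ≤ toℕ (h u) ∸ 1
      excess-≤ v u with adj v u
      ... | true  = ≤-refl
      ... | false = z≤n

      excess-positive : ∀ {v u} → 0 < excess v u → T (adj v u) × 0 < toℕ (h u)
      excess-positive {v} {u} p with adj v u
      ... | true = _ , ≤-trans p (m∸n≤m (toℕ (h u)) 1)

      partner : ∀ {s κ} → 0 < surplus (adj (vertex s κ)) (toℕ ∘ h) → ∃₂ λ s′ κ′ → 0 < H s′ κ′ ×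
                (Link (row s) (col s) κ (row s′) (col s′) κ′ ⊎ Link (row s′) (col s′) κ′ (row s) (col s) κ)
      partner {s} {κ} p with u , q ← sum-positive (excess (vertex s κ)) p
                        with e , r ← excess-positive {vertex s κ} {u} q =
        siteOf u , kindOf u , subst (λ u → 0 < toℕ (h u)) (vertex-of u) r ,
        neighbours (subst (T ∘ adj (vertex s κ)) (vertex-of u) e)

      surplus-local : ∀ s κ → (∀ {s′ κ′} → T (adj (vertex s κ) (vertex s′ κ′)) → s′ ≡ s) →
        surplus (adj (vertex s κ)) (toℕ ∘ h) ≡ parts (excess (vertex s κ) ∘ vertex s)
      surplus-local s κ near = trans (parts-of-sum (excess (vertex s κ)))
        (sum-single s λ s′ d → parts-zero (excess (vertex s κ) ∘ vertex s′) λ κ′ → excess-zero (d ∘ near))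

      -- A guard sees nothing but options of its own cell. That these are admissible is forgotten
      -- here and recovered in `chosen`.
      guard-surplus : ∀ s i → surplus (adj (vertex s (guard i))) (toℕ ∘ h) ≤ sum λ a → H s (option a) ∸ 1
      guard-surplus s i = ≤-trans (≤-reflexive (trans (surplus-local s (guard i) near)
        (trans (parts-hub-option (excess v ∘ vertex s) (λ _ → none λ { (inj₁ ()) ; (inj₂ ()) })
                  (λ _ → none λ { (inj₁ ()) ; (inj₂ ()) }) (λ _ → none λ { (inj₁ ()) ; (inj₂ ()) }))
          (cong (_+ sum (excess v ∘ vertex s ∘ option)) (none {hub} λ { (inj₁ ()) ; (inj₂ ()) })))))
        (sum-≤ λ a → excess-≤ v (vertex s (option a)))
        where
        v : Fin N
        v = vertex s (guard i)
        none : ∀ {κ} → ¬ (Link (row s) (col s) (guard i) (row s) (col s) κ ⊎ Link (row s) (col s) κ (row s) (col s) (guard i)) →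
               excess v (vertex s κ) ≡ 0
        none ¬l = excess-zero (¬l ∘ neighbours)
        near′ : ∀ {s′} κ′ → Link (row s) (col s) (guard i) (row s′) (col s′) κ′ ⊎ Link (row s′) (col s′) κ′ (row s) (col s) (guard i) → s′ ≡ s
        near′ (option a) (inj₂ (r , c , _)) = site-≡ r c
        near : ∀ {s′ κ′} → T (adj v (vertex s′ κ′)) → s′ ≡ s
        near {s′} {κ′} e = near′ κ′ (neighbours e)

      leaf-surplus : ∀ s i → surplus (adj (vertex s (leaf i))) (toℕ ∘ h) ≤ H s hub ∸ 1
      leaf-surplus s i = ≤-trans (≤-reflexive (trans (surplus-local s (leaf i) near)
        (trans (parts-hub-option (excess v ∘ vertex s) (λ _ → none λ { (inj₁ ()) ; (inj₂ ()) })
                  (λ _ → none λ { (inj₁ ()) ; (inj₂ ()) }) (λ _ → none λ { (inj₁ ()) ; (inj₂ ()) }))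
          (trans (cong (excess v (vertex s hub) +_) (sum-zero {f = excess v ∘ vertex s ∘ option} λ a → none {option a} λ { (inj₁ ()) ; (inj₂ ()) }))
            (+-identityʳ _)))))
        (excess-≤ v (vertex s hub))
        where
        v : Fin N
        v = vertex s (leaf i)
        none : ∀ {κ} → ¬ (Link (row s) (col s) (leaf i) (row s) (col s) κ ⊎ Link (row s) (col s) κ (row s) (col s) (leaf i)) →
               excess v (vertex s κ) ≡ 0
        none ¬l = excess-zero (¬l ∘ neighbours)
        near′ : ∀ {s′} κ′ → Link (row s) (col s) (leaf i) (row s′) (col s′) κ′ ⊎ Link (row s′) (col s′) κ′ (row s) (col s) (leaf i) → s′ ≡ s
        near′ hub        (inj₁ (r , c)) = sym (site-≡ r c)
        near′ (option _) (inj₂ ())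
        near′ (leaf _)   (inj₂ ())
        near : ∀ {s′ κ′} → T (adj v (vertex s′ κ′)) → s′ ≡ s
        near {s′} {κ′} e = near′ κ′ (neighbours e)

      module _ (s : Site) (cheap : cost s ≤ 8) where

        private
          g l o c : ℕ
          g = sum (H s ∘ guard)
          l = sum (H s ∘ leaf)
          o = sum (H s ∘ option)
          c = sum (H s ∘ clause)

          unlabelled : ∀ {κ} → H s κ ≡ 0 → 3 ≤ surplus (adj (vertex s κ)) (toℕ ∘ h)
          unlabelled {κ} z = ≤-trans (dominated (vertex s κ) (subst (_< 3) (sym z) (s≤s z≤n)))
            (≤-reflexive (cong (_+ surplus (adj (vertex s κ)) (toℕ ∘ h)) z))

          free-guard : ∃[ i ] H s (guard i) ≡ 0
          free-guard = sum-<-zero (H s ∘ guard) (s≤s (≤-trans (m≤m+n g _) cheap))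

          free-leaf : ∃[ i ] H s (leaf i) ≡ 0
          free-leaf = sum-<-zero (H s ∘ leaf) (s≤s (≤-trans (≤-trans (m≤m+n l _) (m≤n+m _ g)) cheap))

          3≤options : 3 ≤ sum λ a → H s (option a) ∸ 1
          3≤options = ≤-trans (unlabelled (proj₂ free-guard)) (guard-surplus s (proj₁ free-guard))

          4≤options : 4 ≤ o
          4≤options = surplus-total (H s ∘ option) 3≤options

          4≤hub : 4 ≤ H s hub
          4≤hub = bump (≤-trans (unlabelled (proj₂ free-leaf)) (leaf-surplus s (proj₁ free-leaf)))
            where
            bump : ∀ {m} → 3 ≤ m ∸ 1 → 4 ≤ m
            bump {suc m} p = s≤s p

          hub+options : H s hub + (o + c) ≤ 8
          hub+options = ≤-trans (≤-trans (m≤n+m _ l) (m≤n+m _ g)) cheap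

          options+clauses : o + c ≤ 4
          options+clauses = +-cancelˡ-≤ 4 _ _ (≤-trans (+-monoˡ-≤ _ 4≤hub) hub+options)

        -- Proved under the assumption that the cost is at most 8, which supplies the unlabelled
        -- guard and leaf; in the other case the bound is immediate.
        expensive : 8 ≤ cost s
        expensive = ≤-trans (+-mono-≤ 4≤hub (≤-trans 4≤options (m≤m+n o c)))
          (≤-trans (m≤n+m _ l) (m≤n+m _ g))

        -- An unlabelled guard has a neighbour with positive label, and its only neighbours are the
        -- admissible options of the cell.
        chosen : ∃[ a ] Ok (row s) (col s) a × 0 < H s (option a)
        chosen = go (partner {s} {guard (proj₁ free-guard)} (≤-trans (s≤s z≤n) (unlabelled (proj₂ free-guard))))
          where
          go : (∃₂ λ s′ κ′ → 0 < H s′ κ′ × (Link (row s) (col s) (guard (proj₁ free-guard)) (row s′) (col s′) κ′ ⊎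
                                            Link (row s′) (col s′) κ′ (row s) (col s) (guard (proj₁ free-guard)))) →
               ∃[ a ] Ok (row s) (col s) a × 0 < H s (option a)
          go (s′ , option a , p , inj₂ (r , c , ok)) =
            a , subst₂ (λ t j → Ok t j a) r c ok , subst (λ s → 0 < H s (option a)) (site-≡ r c) p

        unique : ∀ {a b} → 0 < H s (option a) → 0 < H s (option b) → a ≡ b
        unique = surplus-unique (H s ∘ option) 3≤options (≤-trans (m≤m+n o c) options+clauses)

        -- Options and clauses share a budget of 4 that the options use up. So a clause has label 0
        -- and depends on its neighbours.
        clause-surplus : ∀ q → 0 < surplus (adj (vertex s (clause q))) (toℕ ∘ h)
        clause-surplus q = ≤-trans (s≤s z≤n) (unlabelled (n≤0⇒n≡0
          (≤-trans (sum-term (H s ∘ clause) q) (+-cancelˡ-≤ 4 _ _ (≤-trans (+-monoˡ-≤ c 4≤options) options+clauses)))))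

      cheap : ∀ s → cost s ≤ 8
      cheap = sum-tight cost
        (λ s → [ expensive s , id ]′ (≤-total (cost s) 8))
        (≤-trans (≤-reflexive (sym (parts-of-sum (toℕ ∘ h)))) light)

      -- Coordinates beyond `D` are clamped, so that the tableau is a total function.
      siteAt : ℕ → ℕ → Site
      siteAt t j = proj₁ (site (m⊓n≤n t D) (m⊓n≤n j D))

      row-siteAt : ∀ {t j} → t ≤ D → row (siteAt t j) ≡ t
      row-siteAt {t} {j} t≤ = trans (proj₁ (proj₂ (site (m⊓n≤n t D) (m⊓n≤n j D)))) (m≤n⇒m⊓n≡m t≤)

      col-siteAt : ∀ {t j} → j ≤ D → col (siteAt t j) ≡ j
      col-siteAt {t} {j} j≤ = trans (proj₂ (proj₂ (site (m⊓n≤n t D) (m⊓n≤n j D)))) (m≤n⇒m⊓n≡m j≤)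

      tableauOf : ℕ → ℕ → Fin A
      tableauOf t j = proj₁ (chosen (siteAt t j) (cheap _))

      tableauOf-unique : ∀ {s a} → 0 < H s (option a) → tableauOf (row s) (col s) ≡ a
      tableauOf-unique {s} {a} p = unique s (cheap s)
        (subst (λ s′ → 0 < H s′ (option (tableauOf (row s) (col s))))
          (site-≡ (row-siteAt (row≤ s)) (col-siteAt (col≤ s)))
          (proj₂ (proj₂ (chosen (siteAt (row s) (col s)) (cheap _))))) p

      tableau : Tableau tableauOf
      tableau = ok , obeys
        where
        ok : ∀ t j → t ≤ D → j ≤ D → Ok t j (tableauOf t j)
        ok t j t≤ j≤ = subst₂ (λ t′ j′ → Ok t′ j′ (tableauOf t j)) (row-siteAt t≤) (col-siteAt j≤)
          (proj₁ (proj₂ (chosen (siteAt t j) (cheap _))))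
        obeys : ∀ t j → t < D → j < D → Rule (tabulate λ i → uncurry tableauOf (scope i t j))
        obeys t j t< j< = go (partner {s} {clause q} (clause-surplus s (cheap s) q))
          where
          s : Site
          s = siteAt t j
          q : Fin (A ^ 5)
          -- The clause for the very quintuple found at this place. A labelled option that deviates
          -- from it would contradict the uniqueness of the value in its cell, and the border is
          -- excluded, so the rule holds.
          q = funToFin λ i → uncurry tableauOf (scope i t j)
          r≡ : row s ≡ t
          r≡ = row-siteAt (<⇒≤ t<)
          c≡ : col s ≡ j
          c≡ = col-siteAt (<⇒≤ j<)
          go : (∃₂ λ s′ κ′ → 0 < H s′ κ′ × (Link (row s) (col s) (clause q) (row s′) (col s′) κ′ ⊎
                                            Link (row s′) (col s′) κ′ (row s) (col s) (clause q))) →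
               Rule (tabulate λ i → uncurry tableauOf (scope i t j))
          go (s′ , option a , p , inj₂ (hit (inj₁ r))) =
            subst Rule (tabulate-cong (finToFun-funToFin λ i → uncurry tableauOf (scope i t j))) r
          go (s′ , option a , p , inj₂ (hit (inj₂ (inj₁ (inj₁ e))))) = contradiction (trans (sym r≡) e) (<⇒≢ t<)
          go (s′ , option a , p , inj₂ (hit (inj₂ (inj₁ (inj₂ e))))) = contradiction (trans (sym c≡) e) (<⇒≢ j<)
          go (s′ , option a , p , inj₂ (hit (inj₂ (inj₂ (i , e , d))))) = contradiction
            (sym (trans (finToFun-funToFin (λ i → uncurry tableauOf (scope i t j)) i)
              (trans (cong (uncurry tableauOf) (trans (sym (cong₂ (scope i) r≡ c≡)) e)) (tableauOf-unique p)))) d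

    -- From a tableau to a light dominating function

    module _ (w : ℕ → ℕ → Fin A) (tableau : Tableau w) where

      labelOf : Site → Kind A → Fin 5
      labelOf s hub        = # 4
      labelOf s (option a) = if does (a Fin.≟ w (row s) (col s)) then # 4 else # 0
      labelOf s _          = # 0

      labelling : Labelling Γ
      labelling v = labelOf (siteOf v) (kindOf v)

      labelling-vertex : ∀ s κ → labelling (vertex s κ) ≡ labelOf s κ
      labelling-vertex s κ = cong₂ labelOf (siteOf-vertex s κ) (kindOf-vertex s κ)

      label-chosen : ∀ s → labelOf s (option (w (row s) (col s))) ≡ # 4
      label-chosen s with w (row s) (col s) Fin.≟ w (row s) (col s)
      ... | yes _ = refl
      ... | no  d = contradiction refl d

      label-other : ∀ s {a} → a ≢ w (row s) (col s) → labelOf s (option a) ≡ # 0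
      label-other s {a} d with a Fin.≟ w (row s) (col s)
      ... | yes e = contradiction e d
      ... | no  _ = refl

      light : sum (toℕ ∘ labelling) ≡ bound
      light = trans (parts-of-sum (toℕ ∘ labelling))
        (trans (sum-cong-≗ {x = λ s → parts (toℕ ∘ labelling ∘ vertex s)} {λ _ → 8} eight) (sum-const (side * side) 8))
        where
        value : ∀ s κ → toℕ (labelling (vertex s κ)) ≡ toℕ (labelOf s κ)
        value s κ = cong toℕ (labelling-vertex s κ)
        options : ∀ s → sum (λ a → toℕ (labelling (vertex s (option a)))) ≡ 4
        options s = trans (sum-single {f = λ a → toℕ (labelling (vertex s (option a)))} (w (row s) (col s))
            λ a d → trans (value s (option a)) (cong toℕ (label-other s d)))
          (trans (value s (option (w (row s) (col s)))) (cong toℕ (label-chosen s)))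
        eight : ∀ s → parts (toℕ ∘ labelling ∘ vertex s) ≡ 8
        eight s = trans (parts-hub-option (toℕ ∘ labelling ∘ vertex s) (λ i → value s (guard i)) (λ i → value s (leaf i)) (λ q → value s (clause q)))
          (cong₂ _+_ (value s hub) (options s))

      -- A neighbour with label 4 has surplus 3 and suffices on its own.
      covered : ∀ v s′ κ′ → labelOf s′ κ′ ≡ # 4 →
        Link (row (siteOf v)) (col (siteOf v)) (kindOf v) (row s′) (col s′) κ′ ⊎
        Link (row s′) (col s′) κ′ (row (siteOf v)) (col (siteOf v)) (kindOf v) →
        3 ≤ toℕ (labelling v) + surplus (adj v) (toℕ ∘ labelling)
      covered v s′ κ′ e l = ≤-trans (≤-trans (contribution (adj⇐ v u (linked l)))
          (sum-term (λ u → if adj v u then toℕ (labelling u) ∸ 1 else 0) u)) (m≤n+m _ (toℕ (labelling v)))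
        where
        u : Fin N
        u = vertex s′ κ′
        linked : Link (row (siteOf v)) (col (siteOf v)) (kindOf v) (row s′) (col s′) κ′ ⊎
                 Link (row s′) (col s′) κ′ (row (siteOf v)) (col (siteOf v)) (kindOf v) → Linked v u ⊎ Linked u v
        linked l rewrite siteOf-vertex s′ κ′ | kindOf-vertex s′ κ′ = l
        contribution : T (adj v u) → 3 ≤ (if adj v u then toℕ (labelling u) ∸ 1 else 0)
        contribution a with adj v u
        ... | true rewrite trans (labelling-vertex s′ κ′) e = ≤-refl

      domination : ∀ v → Dominated Γ labelling v
      domination v small = go (kindOf v) refl
        where
        s : Site
        s = siteOf v
        b : Fin A
        b = w (row s) (col s)
        goal : Set
        goal = 3 ≤ toℕ (labelling v) + surplus (adj v) (toℕ ∘ labelling)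
        by : ∀ {κ} → kindOf v ≡ κ → ∀ s′ κ′ → labelOf s′ κ′ ≡ # 4 →
             Link (row s) (col s) κ (row s′) (col s′) κ′ ⊎ Link (row s′) (col s′) κ′ (row s) (col s) κ → goal
        by refl = covered v
        inside : row s < D → col s < D → ∀ i → let t , j = scope i (row s) (col s) in ∃[ s′ ] row s′ ≡ t × col s′ ≡ j
        inside r< c< zero                         = site (row≤ s) z≤n
        inside r< c< (suc zero)                   = site (row≤ s) (≤-trans pred[n]≤n (col≤ s))
        inside r< c< (suc (suc zero))             = site (row≤ s) (col≤ s)
        inside r< c< (suc (suc (suc zero)))       = site (row≤ s) c<
        inside r< c< (suc (suc (suc (suc zero)))) = site r< (col≤ s)
        go : ∀ κ → kindOf v ≡ κ → goal
        go (guard i)  e = by e s (option b) (label-chosen s) (inj₂ (refl , refl , proj₁ tableau _ _ (row≤ s) (col≤ s)))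
        go (leaf i)   e = by e s hub refl (inj₁ (refl , refl))
        go hub        e = contradiction (subst (λ κ → toℕ (labelOf s κ) < 3) e small) λ { (s≤s (s≤s (s≤s ()))) }
        go (option a) e = by e s hub refl (inj₁ (refl , refl))
        go (clause q) e with row s ≟ D | col s ≟ D
        ... | yes r | _     = by e s (option b) (label-chosen s) (inj₂ (hit (inj₂ (inj₁ (inj₁ r)))))
        ... | no _  | yes c = by e s (option b) (label-chosen s) (inj₂ (hit (inj₂ (inj₁ (inj₂ c)))))
        -- Off the border, either the quintuple is the one in the tableau and hence obeys the rule,
        -- or the tableau deviates from it in some cell, whose labelled option is then a neighbour.
        ... | no r  | no c  with all? (λ i → finToFun q i Fin.≟ uncurry w (scope i (row s) (col s)))
        ...   | yes agree = by e s (option b) (label-chosen s) (inj₂ (hit (inj₁ (subst Rule (tabulate-cong (sym ∘ agree))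
                             (proj₂ tableau _ _ (≤∧≢⇒< (row≤ s) r) (≤∧≢⇒< (col≤ s) c))))))
        ...   | no ¬agree with i , d ← ¬∀⟶∃¬ 5 _ (λ i → finToFun q i Fin.≟ uncurry w (scope i (row s) (col s))) ¬agree
                         with s′ , r′ , c′ ← inside (≤∧≢⇒< (row≤ s) r) (≤∧≢⇒< (col≤ s) c) i =
          by e s′ (option (w (row s′) (col s′))) (label-chosen s′)
            (inj₂ (hit (inj₂ (inj₂ (i , sym (cong₂ _,_ r′ c′) , λ agree → d (trans (sym agree) (cong₂ w r′ c′)))))))

    tableau⇔3RDF : ∃ Tableau ⇔ (∃[ h ] Is3RDF Γ h × weight Γ h ≤ bound)
    tableau⇔3RDF = mk⇔
      (λ { (w , t) → labelling w t , dominated⇒3RDF Γ (labelling w t) (domination w t) ,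
                     ≤-reflexive (trans (weight≡ Γ (labelling w t)) (light w t)) })
      (λ { (h , r , l) → let d = 3RDF⇒dominated Γ h r ; l′ = ≤-trans (≤-reflexive (sym (weight≡ Γ h))) l
                         in tableauOf h d l′ , tableau h d l′ })

-- Tableaux of nondeterministic computations

bools : List Bool
bools = true ∷ false ∷ []

bools-complete : ∀ b → b ∈ bools
bools-complete true  = here refl
bools-complete false = there (here refl)

vecs : {A : Set} → List A → ∀ n → List (Vec A n)
vecs as zero    = [] ∷ []
vecs as (suc n) = cartesianProductWith _∷_ as (vecs as n)

vecs-complete : {A : Set} {as : List A} → (∀ a → a ∈ as) → ∀ {n} (v : Vec A n) → v ∈ vecs as n
vecs-complete c []      = here refl
vecs-complete c (a ∷ v) = ∈-cartesianProductWith⁺ _∷_ (c a) (vecs-complete c v)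

module _ {s : ℕ} where

  symbols : List (Symbol s)
  symbols = blank ∷ List.map bit bools ++ List.map work (allFin s)

  symbols-complete : ∀ a → a ∈ symbols
  symbols-complete blank    = here refl
  symbols-complete (bit b)  = there (∈-++⁺ˡ (∈-map⁺ bit (bools-complete b)))
  symbols-complete (work i) = there (∈-++⁺ʳ (List.map bit bools) (∈-map⁺ work (∈-allFin i)))

  _≟ₛ_ : DecidableEquality (Symbol s)
  blank  ≟ₛ blank  = yes refl
  bit a  ≟ₛ bit b  = map′ (cong bit) (λ { refl → refl }) (a Boolₚ.≟ b)
  work i ≟ₛ work j = map′ (cong work) (λ { refl → refl }) (i Fin.≟ j)
  blank  ≟ₛ bit _  = no λ ()
  blank  ≟ₛ work _ = no λ ()
  bit _  ≟ₛ blank  = no λ ()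
  bit _  ≟ₛ work _ = no λ ()
  work _ ≟ₛ blank  = no λ ()
  work _ ≟ₛ bit _  = no λ ()

  -- The contents of a tape at distance j + 1 to the left and to the right of
  -- the head.
  around : ℕ → Tape s → Symbol s × Symbol s
  around j t = at blank (Tape.before t) j , at blank (Tape.after t) j

  newHead : Symbol s × Move → Symbol s × Symbol s → Symbol s
  newHead (a , left)  = proj₁
  newHead (a , stay)  = const a
  newHead (a , right) = proj₂

  -- If the head moves to the left, symbols on the left come one cell closer and those on the right
  -- one cell farther away. Next to the head, the inner cell is the one that has just been written,
  -- and it may end up on either side.
  newAround : Symbol s × Move → (inner here outer : Symbol s × Symbol s) → Symbol s × Symbol s
  newAround (a , left)  i h o = proj₁ o , proj₂ i
  newAround (a , stay)  i h o = h
  newAround (a , right) i h o = proj₁ i , proj₂ o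

  head-act : ∀ a t → Tape.head (act a t) ≡ newHead a (around 0 t)
  head-act (a , left)  (tape []      h rs)       = refl
  head-act (a , left)  (tape (_ ∷ _) h rs)       = refl
  head-act (a , stay)  t                         = refl
  head-act (a , right) (tape ls      h [])       = refl
  head-act (a , right) (tape ls      h (_ ∷ _))  = refl

  inner : Symbol s × Move → ℕ → Tape s → Symbol s × Symbol s
  inner (a , _) zero    t = a , a
  inner _       (suc j) t = around j t

  around-act : ∀ a j t → around j (act a t) ≡ newAround a (inner a j t) (around j t) (around (suc j) t)
  around-act (a , left)  zero    (tape []      h rs)      = refl
  around-act (a , left)  zero    (tape (_ ∷ _) h rs)      = refl
  around-act (a , left)  (suc j) (tape []      h rs)      = refl
  around-act (a , left)  (suc j) (tape (_ ∷ _) h rs)      = refl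
  around-act (a , stay)  j       t                        = refl
  around-act (a , right) zero    (tape ls      h [])      = refl
  around-act (a , right) zero    (tape ls      h (_ ∷ _)) = refl
  around-act (a , right) (suc j) (tape ls      h [])      = refl
  around-act (a , right) (suc j) (tape ls      h (_ ∷ _)) = refl

  newArounds : ∀ {n} → Vec (Symbol s × Move) n → (i h o : Vec (Symbol s × Symbol s) n) → Vec (Symbol s × Symbol s) n
  newArounds []       []      []      []      = []
  newArounds (a ∷ as) (i ∷ is) (h ∷ hs) (o ∷ os) = newAround a i h o ∷ newArounds as is hs os

  heads-act : ∀ {n} (as : Vec (Symbol s × Move) n) ts →
              Vec.map Tape.head (Vec.zipWith act as ts) ≡ Vec.zipWith newHead as (Vec.map (around 0) ts)
  heads-act []       []       = refl
  heads-act (a ∷ as) (t ∷ ts) = cong₂ _∷_ (head-act a t) (heads-act as ts)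

  arounds-act : ∀ {n} (as : Vec (Symbol s × Move) n) j ts →
                Vec.map (around j) (Vec.zipWith act as ts) ≡
                newArounds as (Vec.zipWith (λ a → inner a j) as ts) (Vec.map (around j) ts) (Vec.map (around (suc j)) ts)
  arounds-act []       j []       = refl
  arounds-act (a ∷ as) j (t ∷ ts) = cong₂ _∷_ (around-act a j t) (arounds-act as j ts)

  doubled : Symbol s × Move → Symbol s × Symbol s
  doubled (a , _) = a , a

  inner-zero : ∀ {n} (as : Vec (Symbol s × Move) n) ts → Vec.zipWith (λ a → inner a 0) as ts ≡ Vec.map doubled as
  inner-zero []       []       = refl
  inner-zero (a ∷ as) (t ∷ ts) = cong (_ ∷_) (inner-zero as ts)

  inner-suc : ∀ {n} (as : Vec (Symbol s × Move) n) j ts → Vec.zipWith (λ a → inner a (suc j)) as ts ≡ Vec.map (around j) ts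
  inner-suc []       j []       = refl
  inner-suc (a ∷ as) j (t ∷ ts) = cong (_ ∷_) (inner-suc as j ts)

  idle-act : ∀ {n} (ts : Vec (Tape s) n) → Vec.zipWith act (Vec.map (_, stay) (Vec.map Tape.head ts)) ts ≡ ts
  idle-act []       = refl
  idle-act (t ∷ ts) = cong (t ∷_) (idle-act ts)

  symbolAt : Maybe Bool → Symbol s
  symbolAt = maybe bit blank

  after-load : ∀ x j → around j (load x) ≡ (blank , symbolAt (nth x (suc j)))
  after-load []       j = refl
  after-load (b ∷ x)  j = cong (blank ,_) (bits x j)
    where
    bits : ∀ x j → at blank (List.map bit x) j ≡ symbolAt (nth x j)
    bits []      j       = refl
    bits (_ ∷ x) zero    = refl
    bits (_ ∷ x) (suc j) = bits x j

  head-load : ∀ x → Tape.head (load x) ≡ symbolAt (nth x 0)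
  head-load []      = refl
  head-load (_ ∷ _) = refl

-- Row t of the tableau holds configuration t: cell 0 the choice that is made
-- next, the state and the scanned symbols, cell j + 1 the symbols at distance
-- j + 1 from the heads. Hence a move shifts a row by at most one cell, and no
-- cell depends on the head positions.
module CookLevin (M : NTM) where
  open Machine M

  data Value : Set where
    control : Bool → Fin states → Vec (Symbol workSymbols) tapes → Value
    flanks  : Vec (Symbol workSymbols × Symbol workSymbols) tapes → Value

  values : List Value
  values = cartesianProductWith (uncurry control) (cartesianProduct bools (allFin states)) (vecs symbols tapes)
           ++ List.map flanks (vecs (cartesianProduct symbols symbols) tapes)

  values-complete : ∀ v → v ∈ values
  values-complete (control b q hs) = ∈-++⁺ˡ (∈-cartesianProductWith⁺ (uncurry control)
    (∈-cartesianProduct⁺ (bools-complete b) (∈-allFin q)) (vecs-complete symbols-complete hs))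
  values-complete (flanks fs) = ∈-++⁺ʳ _ (∈-map⁺ flanks
    (vecs-complete (λ (a , b) → ∈-cartesianProduct⁺ (symbols-complete a) (symbols-complete b)) fs))

  _≟ᵥ_ : DecidableEquality Value
  control b q hs ≟ᵥ control b′ q′ hs′ =
    map′ (λ { (refl , refl , refl) → refl }) (λ { refl → refl , refl , refl })
         ((b Boolₚ.≟ b′) ×-dec (q Fin.≟ q′) ×-dec Vecₚ.≡-dec _≟ₛ_ hs hs′)
  flanks fs      ≟ᵥ flanks fs′      = map′ (cong flanks) (λ { refl → refl }) (Vecₚ.≡-dec (Productₚ.≡-dec _≟ₛ_ _≟ₛ_) fs fs′)
  control _ _ _  ≟ᵥ flanks _        = no λ ()
  flanks _       ≟ᵥ control _ _ _   = no λ ()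

  A : ℕ
  A = length values

  val : Fin A → Value
  val = List.lookup values

  index : Value → Fin A
  index v = Any.index (values-complete v)

  val-index : ∀ v → val (index v) ≡ v
  val-index v = sym (lookup-index (values-complete v))

  -- Halting becomes an idle transition, so that the same rule relates all consecutive rows.
  transition : Bool → Fin states → Vec (Symbol workSymbols) tapes → Fin states × Vec (Symbol workSymbols × Move) tapes
  transition c q hs =
    if does ((q Fin.≟ accept) ⊎-dec (q Fin.≟ reject)) then (q , Vec.map (_, stay) hs) else δ c q hs

  step-transition : ∀ c k → let n = transition c (state k) (Vec.map Tape.head (contents k)) in
                    step c k ≡ config (proj₁ n) (Vec.zipWith act (proj₂ n) (contents k))
  step-transition c (config q ts) with does ((q Fin.≟ accept) ⊎-dec (q Fin.≟ reject))
  ... | true  = cong (config q) (sym (idle-act ts))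
  ... | false = refl

  cellValue : Bool → Config → ℕ → Value
  cellValue c k zero    = control c (state k) (Vec.map Tape.head (contents k))
  cellValue c k (suc j) = flanks (Vec.map (around j) (contents k))

  -- The last argument is the next choice; combinations that do not occur in
  -- a tableau get an arbitrary value.
  successor : (origin inward here outward : Value) → Bool → Value
  successor (control c q hs) _                (control _ _ _) (flanks o) c′ =
    control c′ (proj₁ (transition c q hs)) (Vec.zipWith newHead (proj₂ (transition c q hs)) o)
  successor (control c q hs) (control _ _ _) (flanks h)      (flanks o) c′ =
    flanks (newArounds (proj₂ (transition c q hs)) (Vec.map doubled (proj₂ (transition c q hs))) h o)
  successor (control c q hs) (flanks i)      (flanks h)      (flanks o) c′ =
    flanks (newArounds (proj₂ (transition c q hs)) i h o)
  successor v                _               _               _          _  = v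

  successor-step : ∀ c c′ k j → cellValue c′ (step c k) j ≡
    successor (cellValue c k 0) (cellValue c k (pred j)) (cellValue c k j) (cellValue c k (suc j)) c′
  successor-step c c′ k j = trans (cong (λ k → cellValue c′ k j) (step-transition c k)) (lemma j)
    where
    ts = contents k
    n  = transition c (state k) (Vec.map Tape.head ts)
    as = proj₂ n
    lemma : ∀ j → cellValue c′ (config (proj₁ n) (Vec.zipWith act as ts)) j ≡
            successor (cellValue c k 0) (cellValue c k (pred j)) (cellValue c k j) (cellValue c k (suc j)) c′
    lemma zero          = cong (control c′ (proj₁ n)) (heads-act as ts)
    lemma (suc zero)    = cong flanks (trans (arounds-act as 0 ts)
                            (cong (λ i → newArounds as i _ _) (inner-zero as ts)))
    lemma (suc (suc j)) = cong flanks (trans (arounds-act as (suc j) ts)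
                            (cong (λ i → newArounds as i _ _) (inner-suc as j ts)))

  -- The existential quantifier leaves the next choice open; this is how the nondeterminism enters
  -- the tableau.
  Rule : Vec (Fin A) 5 → Set
  Rule (o ∷ l ∷ h ∷ r ∷ v ∷ []) = ∃[ c ] val v ≡ successor (val o) (val l) (val h) (val r) c

  rule? : ∀ w → Dec (Rule w)
  rule? (o ∷ l ∷ h ∷ r ∷ v ∷ []) =
    map′ (λ { (inj₁ e) → true , e ; (inj₂ e) → false , e }) (λ { (true , e) → inj₁ e ; (false , e) → inj₂ e })
      ((val v ≟ᵥ successor (val o) (val l) (val h) (val r) true) ⊎-dec
       (val v ≟ᵥ successor (val o) (val l) (val h) (val r) false))

  firstControl : Bool → Maybe Bool → Value
  firstControl c m = control c start (symbolAt m ∷ Vec.replicate extraTapes blank)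

  firstFlanks : Maybe Bool → Value
  firstFlanks m = flanks ((blank , symbolAt m) ∷ Vec.replicate extraTapes (blank , blank))

  Starts : Maybe Bool → Fin A → Set
  Starts m a = ∃[ c ] val a ≡ firstControl c m

  Accepts : Fin A → Set
  Accepts a = ∃₂ λ c hs → val a ≡ control c accept hs

  -- Choices form an infinite sequence, since the last row also contains a next choice.
  after : (ℕ → Bool) → ℕ → Config → Config
  after ch zero    k = k
  after ch (suc t) k = step (ch t) (after ch t k)

  after-shift : ∀ ch t k → after ch (suc t) k ≡ after (ch ∘ suc) t (step (ch 0) k)
  after-shift ch zero    k = refl
  after-shift ch (suc t) k = cong (step (ch (suc t))) (after-shift ch t k)

  run-after : ∀ ch t k → run (tabulate {n = t} (ch ∘ toℕ)) k ≡ after ch t k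
  run-after ch zero    k = refl
  run-after ch (suc t) k = trans (run-after (ch ∘ suc) t (step (ch 0) k)) (sym (after-shift ch t k))

  -- Tableaux and accepting computations on an input

  module _ (x : List Bool) where

    -- Naming the symbol by an existential quantifier allows a formula to distinguish its three
    -- possible readings.
    Initial : ℕ → Fin A → Set
    Initial j a = ∃[ m ] nth x j ≡ m × ((j ≡ 0 × Starts m a) ⊎ (j ≢ 0 × val a ≡ firstFlanks m))

    -- The disjunctions are implications, in the form that formulas have.
    Admissible : ℕ → ℕ → ℕ → Fin A → Set
    Admissible D t j a = (t ≢ 0 ⊎ Initial j a) × (¬ (t ≡ D × j ≡ 0) ⊎ Accepts a)

    initial-control : ∀ c → cellValue c (initial x) 0 ≡ firstControl c (nth x 0)
    initial-control c = cong (control c start) (cong₂ _∷_ (head-load x) (Vecₚ.map-replicate Tape.head empty extraTapes))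

    initial-flanks : ∀ c j → cellValue c (initial x) (suc j) ≡ firstFlanks (nth x (suc j))
    initial-flanks c j = cong flanks (cong₂ _∷_ (after-load x j) (Vecₚ.map-replicate (around j) empty extraTapes))

    initial-value : ∀ {a} j → Initial j a → ∃[ c ] val a ≡ cellValue c (initial x) j
    initial-value zero    (m , refl , inj₁ (_ , c , e)) = c , trans e (sym (initial-control c))
    initial-value zero    (m , refl , inj₂ (d , _))     = ⊥-elim (d refl)
    initial-value (suc j) (m , refl , inj₂ (_ , e))     = true , trans e (sym (initial-flanks true j))

    value-initial : ∀ {a} c j → val a ≡ cellValue c (initial x) j → Initial j a
    value-initial c zero    e = _ , refl , inj₁ (refl , c , trans e (initial-control c))
    value-initial c (suc j) e = _ , refl , inj₂ ((λ ()) , trans e (initial-flanks c j))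

    configuration : (ℕ → Bool) → ℕ → Config
    configuration ch t = after ch t (initial x)

    module _ (D : ℕ) where

      open Gadget D A (Admissible D) Rule using (Tableau)

      choiceOf : Value → Bool
      choiceOf (control c _ _) = c
      choiceOf (flanks _)      = true

      module _ (w : ℕ → ℕ → Fin A) (tableau : Tableau w) where

        choices : ℕ → Bool
        choices t = choiceOf (val (w t 0))

        settle : ∀ {c t k} j → val (w t j) ≡ cellValue c k j → val (w t j) ≡ cellValue (choices t) k j
        settle         zero    e = trans e (cong (λ c → control c _ _) (sym (cong choiceOf e)))
        settle         (suc j) e = e

        -- Column `D` obeys no rule, and a cell depends on its right neighbour one row earlier.
        -- Hence each row loses one reliable column, and the triangle is what the induction on `t`
        -- preserves.
        faithful : ∀ t j → t + j ≤ D → val (w t j) ≡ cellValue (choices t) (configuration choices t) j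
        faithful zero    j j≤D with proj₁ (proj₁ tableau 0 j z≤n j≤D)
        ... | inj₁ d = ⊥-elim (d refl)
        ... | inj₂ i = settle j (proj₂ (initial-value j i))
        faithful (suc t) j le = settle j (begin
          val (w (suc t) j)
            ≡⟨ proj₂ rule ⟩
          successor (val (w t 0)) (val (w t (pred j))) (val (w t j)) (val (w t (suc j))) (proj₁ rule)
            ≡⟨ cong (λ o → successor o (val (w t (pred j))) (val (w t j)) (val (w t (suc j))) (proj₁ rule))
                 (faithful t 0 (below (≤-trans (≤-reflexive (+-identityʳ t)) (m≤m+n t j)))) ⟩
          successor (V 0) (val (w t (pred j))) (val (w t j)) (val (w t (suc j))) (proj₁ rule)
            ≡⟨ cong (λ l → successor (V 0) l (val (w t j)) (val (w t (suc j))) (proj₁ rule))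
                 (faithful t (pred j) (below (+-monoʳ-≤ t pred[n]≤n))) ⟩
          successor (V 0) (V (pred j)) (val (w t j)) (val (w t (suc j))) (proj₁ rule)
            ≡⟨ cong₂ (λ h r → successor (V 0) (V (pred j)) h r (proj₁ rule))
                 (faithful t j (below ≤-refl)) (faithful t (suc j) (≤-trans (≤-reflexive (+-suc t j)) le)) ⟩
          successor (V 0) (V (pred j)) (V j) (V (suc j)) (proj₁ rule)
            ≡⟨ successor-step (choices t) (proj₁ rule) (configuration choices t) j ⟨
          cellValue (proj₁ rule) (configuration choices (suc t)) j ∎)
          where
          open ≡-Reasoning
          V : ℕ → Value
          V = cellValue (choices t) (configuration choices t)
          below : ∀ {n} → n ≤ t + j → n ≤ D
          below n≤ = ≤-trans n≤ (<⇒≤ le)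
          rule : ∃[ c ] val (w (suc t) j) ≡ successor (val (w t 0)) (val (w t (pred j))) (val (w t j)) (val (w t (suc j))) c
          rule = proj₂ tableau t j (≤-trans (s≤s (m≤m+n t j)) le) (≤-trans (s≤s (m≤n+m j t)) le)

        tableau-accepts : Accepting (configuration choices D)
        tableau-accepts with proj₂ (proj₁ tableau D 0 ≤-refl z≤n)
        ... | inj₁ d = ⊥-elim (d (refl , refl))
        ... | inj₂ (c , hs , e) = state≡ (trans (sym e) (faithful D 0 (≤-reflexive (+-identityʳ D))))
          where
          state≡ : ∀ {c hs c′ q hs′} → control c accept hs ≡ control c′ q hs′ → q ≡ accept
          state≡ refl = refl

      module _ (ch : ℕ → Bool) (accepting : Accepting (configuration ch D)) where

        tableauOf : ℕ → ℕ → Fin A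
        tableauOf t j = index (cellValue (ch t) (configuration ch t) j)

        tableauOf-tableau : Tableau tableauOf
        tableauOf-tableau = (λ t j _ _ → first t j , last t j) , λ t j _ _ → ch (suc t) , (begin
          val (tableauOf (suc t) j)
            ≡⟨ val-index _ ⟩
          cellValue (ch (suc t)) (configuration ch (suc t)) j
            ≡⟨ successor-step (ch t) (ch (suc t)) (configuration ch t) j ⟩
          successor (V t 0) (V t (pred j)) (V t j) (V t (suc j)) (ch (suc t))
            ≡⟨ cong₂ (λ o l → successor o l (V t j) (V t (suc j)) (ch (suc t))) (val-index _) (val-index _) ⟨
          successor (val (tableauOf t 0)) (val (tableauOf t (pred j))) (V t j) (V t (suc j)) (ch (suc t))
            ≡⟨ cong₂ (λ h r → successor (val (tableauOf t 0)) (val (tableauOf t (pred j))) h r (ch (suc t))) (val-index _) (val-index _) ⟨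
          successor (val (tableauOf t 0)) (val (tableauOf t (pred j))) (val (tableauOf t j)) (val (tableauOf t (suc j))) (ch (suc t)) ∎)
          where
          open ≡-Reasoning
          V : ℕ → ℕ → Value
          V t = cellValue (ch t) (configuration ch t)
          first : ∀ t j → t ≢ 0 ⊎ Initial j (tableauOf t j)
          first zero    j = inj₂ (value-initial (ch 0) j (val-index _))
          first (suc t) j = inj₁ λ ()
          last : ∀ t j → ¬ (t ≡ D × j ≡ 0) ⊎ Accepts (tableauOf t j)
          last t j with t ≟ D | j ≟ 0
          ... | no d     | _        = inj₁ (d ∘ proj₁)
          ... | yes _    | no d     = inj₁ (d ∘ proj₂)
          ... | yes refl | yes refl = inj₂ (ch D , _ , trans (val-index _) (cong (λ q → control (ch D) q (Vec.map Tape.head (contents (configuration ch D)))) accepting))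

      accepting⇔tableau : (∃[ cs ] Accepting (run {D} cs (initial x))) ⇔ ∃ Tableau
      accepting⇔tableau = mk⇔
        (λ { (cs , a) → let ch = at false (Vec.toList cs) in
               tableauOf ch (subst Accepting (trans (sym (cong (λ cs → run cs (initial x)) (restored cs))) (run-after ch D (initial x))) a) ,
               tableauOf-tableau ch (subst Accepting (trans (sym (cong (λ cs → run cs (initial x)) (restored cs))) (run-after ch D (initial x))) a) })
        (λ { (w , t) → tabulate (choices w t ∘ toℕ) ,
               subst Accepting (sym (run-after (choices w t) D (initial x))) (tableau-accepts w t) })
        where
        restored : ∀ {n} (cs : Vec Bool n) → tabulate (at false (Vec.toList cs) ∘ toℕ) ≡ cs
        restored []       = refl
        restored (c ∷ cs) = cong (c ∷_) (restored cs)

-- The reduction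

-- The order is the position of the first `false`.
codes-order : ∀ {N N′ k k′ a a′ x} → Codes N k a x → Codes N′ k′ a′ x → N ≡ N′
codes-order {N} {N′} {x = x} c c′ with <-cmp N N′
... | tri≈ _ e _ = e
... | tri< N<N′ _ _ with () ← trans (sym (Codes.order-bit c′ N N<N′)) (trans (cong (nth x) (sym (+-identityʳ N))) (Codes.order-end c))
... | tri> _ _ N′<N with () ← trans (sym (Codes.order-bit c N′ N′<N)) (trans (cong (nth x) (sym (+-identityʳ N′))) (Codes.order-end c′))

codes-bound : ∀ {N k k′ a a′ x} → Codes N k a x → Codes N k′ a′ x → k ≡ k′
codes-bound {N} {k} {k′} {x = x} c c′ with <-cmp k k′
... | tri≈ _ e _ = e
... | tri< k<k′ _ _ with () ← trans (sym (Codes.bound-bit c′ k k<k′))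
                                (trans (cong (λ k → nth x (N + suc k)) (sym (+-identityʳ k))) (Codes.bound-end c))
... | tri> _ _ k′<k with () ← trans (sym (Codes.bound-bit c k′ k′<k))
                                (trans (cong (λ k → nth x (N + suc k)) (sym (+-identityʳ k′))) (Codes.bound-end c′))

codes-entry : ∀ {N k a a′ x} → Codes N k a x → Codes N k a′ x → ∀ u v → a u v ≡ a′ u v
codes-entry c c′ u v = just-injective (trans (sym (Codes.entry c u v)) (Codes.entry c′ u v))

-- Equal codes give pointwise equal adjacency, but not equal records, as these contain functions and
-- proofs. So the solution is transported instead of the instance.
encode-yes : ∀ {I I′} → encodeGraphWithBound I ≡ encodeGraphWithBound I′ →
             DecisionProblem.Yes TripleRomDom I → DecisionProblem.Yes TripleRomDom I′
encode-yes {I} {I′} e = transport I I′ (encode-codes I) (subst (Codes _ _ _) (sym e) (encode-codes I′))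
  where
  transport : ∀ I I′ {x} → let open GraphWithBound in
    Codes (Graph.order (graph I)) (k I) (Graph.adj (graph I)) x →
    Codes (Graph.order (graph I′)) (k I′) (Graph.adj (graph I′)) x →
    DecisionProblem.Yes TripleRomDom I → DecisionProblem.Yes TripleRomDom I′
  transport (record { graph = Γ@record { order = N ; adj = a } ; k = k })
            (record { graph = Γ′@record { order = N′ ; adj = a′ } ; k = k′ }) c c′ (h , r , w)
    with refl ← codes-order c c′ with refl ← codes-bound c c′ =
    h , dominated⇒3RDF Γ′ h (λ v small → ≤-trans (3RDF⇒dominated Γ h r v small)
          (≤-reflexive (cong (toℕ (h v) +_) (sum-cong-≗ {N} λ u → cong (if_then toℕ (h u) ∸ 1 else 0) (codes-entry c c′ v u))))) ,
    ≤-trans (≤-reflexive (trans (weight≡ Γ′ h) (sym (weight≡ Γ h)))) w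

-- Conditions on tableau values depend on the machine only and are decided while the formula is
-- built.
decided : ∀ {n} {P : Set} → Dec P → Formula n
decided (yes _) = lit 0 ≼ lit 0
decided (no _)  = lit 1 ≼ lit 0

decided⇔ : ∀ {n P} (d : Dec P) {W} {v : Vec ℕ n} → ⟦ decided d ⟧ᶠ W v ⇔ P
decided⇔ (yes p) = mk⇔ (λ _ → p) (λ _ → z≤n)
decided⇔ (no ¬p) = mk⇔ (λ ()) (λ p → contradiction p ¬p)

same⇔ : ∀ {P : Set} → P ⇔ P
same⇔ = mk⇔ id id

letters : Fin 3 → Maybe Bool
letters zero             = nothing
letters (suc zero)       = just true
letters (suc (suc zero)) = just false

never : (1 ≤ 0) ⇔ ⊥
never = mk⇔ (λ ()) λ ()

letter : ∀ m → ∃[ i ] letters i ≡ m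
letter nothing      = zero , refl
letter (just true)  = suc zero , refl
letter (just false) = suc (suc zero) , refl

polyT : ∀ {n} → Polynomial → Term n → Term n
polyT []      t = lit 0
polyT (a ∷ p) t = lit a ⊞ t ⊠ polyT p t

⟦polyT⟧ : ∀ {n} p (t : Term n) {W v} → ⟦ polyT p t ⟧ W v ≡ eval p (⟦ t ⟧ W v)
⟦polyT⟧ []      t = refl
⟦polyT⟧ (a ∷ p) t {W} {v} = cong (λ m → a + ⟦ t ⟧ W v * m) (⟦polyT⟧ p t)

module Reduction (M : NTM) (p : Polynomial) where
  open CookLevin M

  horizonT sideLengthT orderT boundT : Term 1
  horizonT    = polyT p v₀
  sideLengthT = lit 1 ⊞ horizonT
  orderT      = sideLengthT ⊠ sideLengthT ⊠ lit (kinds A)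
  boundT      = sideLengthT ⊠ sideLengthT ⊠ lit 8

  up₃ : ∀ {n} → Term n → Term (3 + n)
  up₃ = wk ∘ wk ∘ wk

  up₄ : ∀ {n} → Term n → Term (4 + n)
  up₄ = wk ∘ up₃

  starts? : ∀ m a → Dec (Starts m a)
  starts? m a = map′ (λ { (inj₁ e) → true , e ; (inj₂ e) → false , e }) (λ { (true , e) → inj₁ e ; (false , e) → inj₂ e })
    ((val a ≟ᵥ firstControl true m) ⊎-dec (val a ≟ᵥ firstControl false m))

  accepts? : ∀ a → Dec (Accepts a)
  accepts? a with val a
  ... | flanks _       = no λ ()
  ... | control c q hs = map′ (λ { refl → c , hs , refl }) (λ { (_ , _ , refl) → refl }) (q Fin.≟ Machine.accept M)

  -- The context is column and row of the second vertex, column and row of the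
  -- first one, the two vertices, the output position and the input length.
  initialF : Fin A → Formula 8
  initialF a = ⋁ 3 λ i → reads (# 0) v₂ (letters i) ⋏
    (v₂ ≐ lit 0 ⋏ decided (starts? (letters i) a) ⋎
     neg (v₂ ≐ lit 0) ⋏ decided (val a ≟ᵥ firstFlanks (letters i)))

  admissibleF : Fin A → Formula 8
  admissibleF a = (neg (v₃ ≐ lit 0) ⋎ initialF a) ⋏
                  (neg (v₃ ≐ up₄ (up₃ horizonT) ⋏ v₂ ≐ lit 0) ⋎ decided (accepts? a))

  scopeT : Fin 5 → Term 8 × Term 8
  scopeT zero                         = v₁ , lit 0
  scopeT (suc zero)                   = v₁ , v₀ ⊟ lit 1
  scopeT (suc (suc zero))             = v₁ , v₀
  scopeT (suc (suc (suc zero)))       = v₁ , lit 1 ⊞ v₀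
  scopeT (suc (suc (suc (suc zero)))) = lit 1 ⊞ v₁ , v₀

  hitF : Fin A → Fin (A ^ 5) → Formula 8
  hitF a q = decided (rule? (tabulate (finToFun q))) ⋎
    (v₁ ≐ up₄ (up₃ horizonT) ⋎ v₀ ≐ up₄ (up₃ horizonT)) ⋎
    ⋁ 5 λ i → (proj₁ (scopeT i) ≐ v₃ ⋏ proj₂ (scopeT i) ≐ v₂) ⋏ decided (¬? (a Fin.≟ finToFun q i))

  kindsF : Kind A → Kind A → Formula 8
  kindsF (option a) (guard _)  = v₃ ≐ v₁ ⋏ v₂ ≐ v₀ ⋏ admissibleF a
  kindsF (option a) hub        = v₃ ≐ v₁ ⋏ v₂ ≐ v₀
  kindsF (leaf _)   hub        = v₃ ≐ v₁ ⋏ v₂ ≐ v₀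
  kindsF (option a) (clause q) = hitF a q
  kindsF _          _          = lit 1 ≼ lit 0

  placeT : (t j : Term 8) → Fin (kinds A) → Term 8
  placeT t j e = lit (kinds A) ⊠ (up₄ (up₃ sideLengthT) ⊠ t ⊞ j) ⊞ lit (toℕ e)

  opaque

    -- Terms have no division, so a vertex is decoded by searching for coordinates and a kind that
    -- yield its number.
    linkF : (u v : Term 4) → Formula 4
    linkF u v = ⋁ (kinds A) λ e → ⋁ (kinds A) λ e′ →
      ∃< (up₃ sideLengthT) (∃< (up₄ sideLengthT) (∃< (wk (up₄ sideLengthT)) (∃< (wk (wk (up₄ sideLengthT)))
        (up₄ u ≐ placeT v₃ v₂ e ⋏ up₄ v ≐ placeT v₁ v₀ e′ ⋏ kindsF (decode e) (decode e′)))))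

  adjF : Formula 4
  adjF = linkF v₁ v₀ ⋎ linkF v₀ v₁

  lengthT : Term 1
  lengthT = orderT ⊞ (lit 1 ⊞ (boundT ⊞ (lit 1 ⊞ orderT ⊠ orderT)))

  opaque

    -- Only the positions of ones are described: the order, the bound and the edges. The separators
    -- are false because no disjunct reaches them.
    bitF : Formula 2
    bitF = lit 1 ⊞ v₀ ≼ wk orderT ⋎
      ∃< (wk boundT) (v₁ ≐ wk (wk orderT) ⊞ (lit 1 ⊞ v₀)) ⋎
      ∃< (wk orderT) (∃< (wk (wk orderT))
        (v₂ ≐ up₃ orderT ⊞ (lit 1 ⊞ (up₃ boundT ⊞ (lit 1 ⊞ (up₃ orderT ⊠ v₁ ⊞ v₀)))) ⋏ adjF))

  module _ (x : List Bool) where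

    n D : ℕ
    n = length x
    W : ℕ → List Bool
    W = wordsOf x []
    D = ⟦ horizonT ⟧ W (n ∷ [])

    open Gadget D A (Admissible x D) Rule

    module _ {t j t′ j′ a b i : ℕ} where

      private
        env : Vec ℕ 8
        env = j′ ∷ t′ ∷ j ∷ t ∷ a ∷ b ∷ i ∷ n ∷ []

      initial⇔ : ∀ a → ⟦ initialF a ⟧ᶠ W env ⇔ Initial x j a
      initial⇔ a = mk⇔
        (λ { (i , e , h) → letters i , e , Equivalence.to (inside (letters i)) h })
        (λ { (m , e , h) → let i , l = letter m in
               i , trans e (sym l) , Equivalence.from (inside (letters i))
                 (subst (λ m → (j ≡ 0 × Starts m a) ⊎ (j ≢ 0 × val a ≡ firstFlanks m)) (sym l) h) })
        where
        inside : ∀ m → ⟦ v₂ ≐ lit 0 ⋏ decided (starts? m a) ⋎ neg (v₂ ≐ lit 0) ⋏ decided (val a ≟ᵥ firstFlanks m) ⟧ᶠ W env ⇔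
                       ((j ≡ 0 × Starts m a) ⊎ (j ≢ 0 × val a ≡ firstFlanks m))
        inside m = (same⇔ ×-⇔ decided⇔ (starts? m a)) ⊎-⇔ (same⇔ ×-⇔ decided⇔ (val a ≟ᵥ firstFlanks m))

      admissible⇔ : ∀ a → ⟦ admissibleF a ⟧ᶠ W env ⇔ Admissible x D t j a
      admissible⇔ a = (same⇔ ⊎-⇔ initial⇔ a) ×-⇔ (same⇔ ⊎-⇔ decided⇔ (accepts? a))

      scope⇔ : ∀ i → (⟦ proj₁ (scopeT i) ⟧ W env ≡ t × ⟦ proj₂ (scopeT i) ⟧ W env ≡ j) ⇔ (scope i t′ j′ ≡ (t , j))
      scope⇔ i = mk⇔ (λ (r , c) → trans (scoped i) (cong₂ _,_ r c)) (λ e → Productₚ.,-injective (trans (sym (scoped i)) e))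
        where
        scoped : ∀ i → scope i t′ j′ ≡ (⟦ proj₁ (scopeT i) ⟧ W env , ⟦ proj₂ (scopeT i) ⟧ W env)
        scoped zero                         = refl
        scoped (suc zero)                   = cong (t′ ,_) (pred≡ j′)
          where
          pred≡ : ∀ m → pred m ≡ m ∸ 1
          pred≡ zero    = refl
          pred≡ (suc _) = refl
        scoped (suc (suc zero))             = refl
        scoped (suc (suc (suc zero)))       = refl
        scoped (suc (suc (suc (suc zero)))) = refl

      hit⇔ : ∀ a q → ⟦ hitF a q ⟧ᶠ W env ⇔ Hit t j a t′ j′ q
      hit⇔ a q = mk⇔ (λ h → hit (Equivalence.to whole h)) (λ { (hit h) → Equivalence.from whole h })
        where
        one : ∀ i → (⟦ proj₁ (scopeT i) ≐ v₃ ⋏ proj₂ (scopeT i) ≐ v₂ ⟧ᶠ W env × ⟦ decided {8} (¬? (a Fin.≟ finToFun q i)) ⟧ᶠ W env) ⇔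
                    (scope i t′ j′ ≡ (t , j) × a ≢ finToFun q i)
        one i = scope⇔ i ×-⇔ decided⇔ (¬? (a Fin.≟ finToFun q i))
        whole : ⟦ hitF a q ⟧ᶠ W env ⇔ (Rule (tabulate (finToFun q)) ⊎ (t′ ≡ D ⊎ j′ ≡ D) ⊎
                                       (∃[ i ] scope i t′ j′ ≡ (t , j) × a ≢ finToFun q i))
        whole = decided⇔ (rule? (tabulate (finToFun q))) ⊎-⇔ (same⇔ ⊎-⇔
                mk⇔ (λ (i , h) → i , Equivalence.to (one i) h) (λ (i , h) → i , Equivalence.from (one i) h))

      kinds⇔ : ∀ κ κ′ → ⟦ kindsF κ κ′ ⟧ᶠ W env ⇔ Link t j κ t′ j′ κ′
      kinds⇔ (option a) (guard _)  = same⇔ ×-⇔ (same⇔ ×-⇔ admissible⇔ a)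
      kinds⇔ (option a) hub        = same⇔
      kinds⇔ (option a) (clause q) = hit⇔ a q
      kinds⇔ (option _) (leaf _)   = never
      kinds⇔ (option _) (option _) = never
      kinds⇔ (leaf _)   hub        = same⇔
      kinds⇔ (leaf _)   (guard _)  = never
      kinds⇔ (leaf _)   (leaf _)   = never
      kinds⇔ (leaf _)   (option _) = never
      kinds⇔ (leaf _)   (clause _) = never
      kinds⇔ (guard _)  _          = never
      kinds⇔ hub        _          = never
      kinds⇔ (clause _) _          = never

    link-resp : ∀ {t₁ t₂ j₁ j₂ κ₁ κ₂ t₁′ t₂′ j₁′ j₂′ κ₁′ κ₂′} → t₁ ≡ t₂ → j₁ ≡ j₂ → κ₁ ≡ κ₂ →
                t₁′ ≡ t₂′ → j₁′ ≡ j₂′ → κ₁′ ≡ κ₂′ → Link t₁ j₁ κ₁ t₁′ j₁′ κ₁′ → Link t₂ j₂ κ₂ t₂′ j₂′ κ₂′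
    link-resp refl refl refl refl refl refl l = l

    module _ (u v : Fin N) {a b i : ℕ} (s t : Term 4)
             (s≡ : ⟦ s ⟧ W (a ∷ b ∷ i ∷ n ∷ []) ≡ toℕ u) (t≡ : ⟦ t ⟧ W (a ∷ b ∷ i ∷ n ∷ []) ≡ toℕ v) where

      opaque
        unfolding linkF

        linkF-sound : ⟦ linkF s t ⟧ᶠ W (a ∷ b ∷ i ∷ n ∷ []) → Linked u v
        linkF-sound (e , e′ , r , r< , c , c< , r′ , r′< , c′ , c′< , p , p′ , l) =
          let r≡ , c≡ , k≡    = located u e r< c< (trans (sym s≡) p)
              r′≡ , c′≡ , k′≡ = located v e′ r′< c′< (trans (sym t≡) p′)
          in link-resp (sym r≡) (sym c≡) (sym k≡) (sym r′≡) (sym c′≡) (sym k′≡)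
               (Equivalence.to (kinds⇔ {a = a} {b} {i} (decode e) (decode e′)) l)

        linkF-complete : Linked u v → ⟦ linkF s t ⟧ᶠ W (a ∷ b ∷ i ∷ n ∷ [])
        linkF-complete l =
          let e , p , k    = position u
              e′ , p′ , k′ = position v
          in e , e′ ,
             row (siteOf u) , s≤s (row≤ (siteOf u)) , col (siteOf u) , s≤s (col≤ (siteOf u)) ,
             row (siteOf v) , s≤s (row≤ (siteOf v)) , col (siteOf v) , s≤s (col≤ (siteOf v)) ,
             trans s≡ p , trans t≡ p′ ,
             Equivalence.from (kinds⇔ {a = a} {b} {i} (decode e) (decode e′))
               (subst₂ (λ κ κ′ → Link (row (siteOf u)) (col (siteOf u)) κ (row (siteOf v)) (col (siteOf v)) κ′) k k′ l)

    adjacent⇔ : ∀ u v i → ⟦ adjF ⟧ᶠ W (toℕ v ∷ toℕ u ∷ i ∷ n ∷ []) ⇔ (Linked u v ⊎ Linked v u)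
    adjacent⇔ u v i =
      mk⇔ (linkF-sound u v {toℕ v} {toℕ u} {i} v₁ v₀ refl refl) (linkF-complete u v {toℕ v} {toℕ u} {i} v₁ v₀ refl refl) ⊎-⇔
      mk⇔ (linkF-sound v u {toℕ v} {toℕ u} {i} v₀ v₁ refl refl) (linkF-complete v u {toℕ v} {toℕ u} {i} v₀ v₁ refl refl)

    -- The output position does not matter for adjacency.
    adjacency : Fin N → Fin N → Bool
    adjacency u v = holds (⟦ truth adjF ⟧ W (toℕ v ∷ toℕ u ∷ 0 ∷ n ∷ []))

    T-holds : ∀ {m} → T (holds m) → 0 < m
    T-holds {suc m} _ = s≤s z≤n

    holds-T : ∀ {m} → 0 < m → T (holds m)
    holds-T (s≤s _) = _

    adjacency⇒ : ∀ u v → T (adjacency u v) → Linked u v ⊎ Linked v u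
    adjacency⇒ u v e = Equivalence.to (adjacent⇔ u v 0)
      (sound adjF {W} {toℕ v ∷ toℕ u ∷ 0 ∷ n ∷ []} (T-holds {⟦ truth adjF ⟧ W (toℕ v ∷ toℕ u ∷ 0 ∷ n ∷ [])} e))

    adjacency⇐ : ∀ u v → Linked u v ⊎ Linked v u → T (adjacency u v)
    adjacency⇐ u v l = holds-T {⟦ truth adjF ⟧ W (toℕ v ∷ toℕ u ∷ 0 ∷ n ∷ [])}
      (complete adjF {W} {toℕ v ∷ toℕ u ∷ 0 ∷ n ∷ []} (Equivalence.from (adjacent⇔ u v 0) l))

    module G = Graphs adjacency adjacency⇒ adjacency⇐

    β : ℕ → Bool
    β i = holds (⟦ truth bitF ⟧ W (i ∷ n ∷ []))

    L : ℕ
    L = ⟦ lengthT ⟧ W (n ∷ [])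

    opaque

      word : List Bool
      word = bitsOnto β L []

      word-bits : word ≡ bitsOnto β L []
      word-bits = refl

    ¬T⇒false : ∀ {b} → ¬ T b → b ≡ false
    ¬T⇒false {false} _ = refl
    ¬T⇒false {true}  f = ⊥-elim (f _)

    T⇒true : ∀ {b} → T b → b ≡ true
    T⇒true {true} _ = refl

    Bit : ℕ → Set
    Bit i = suc i ≤ N ⊎ (∃[ j ] j < G.bound × i ≡ N + suc j) ⊎
            (∃[ u ] u < N × ∃[ v ] v < N × i ≡ N + suc (G.bound + suc (N * u + v)) × ⟦ adjF ⟧ᶠ W (v ∷ u ∷ i ∷ n ∷ []))

    opaque
      unfolding bitF

      bitF⇔ : ∀ i → ⟦ bitF ⟧ᶠ W (i ∷ n ∷ []) ⇔ Bit i
      bitF⇔ i = same⇔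

    private
      bit⇒ : ∀ {i} → T (β i) → Bit i
      bit⇒ {i} b = Equivalence.to (bitF⇔ i) (sound bitF {W} {i ∷ n ∷ []} (T-holds {⟦ truth bitF ⟧ W (i ∷ n ∷ [])} b))

      bit⇐ : ∀ {i} → Bit i → T (β i)
      bit⇐ {i} h = holds-T {⟦ truth bitF ⟧ W (i ∷ n ∷ [])} (complete bitF {W} {i ∷ n ∷ []} (Equivalence.from (bitF⇔ i) h))

      nth-word : ∀ {i} → i < L → nth word i ≡ just (β i)
      nth-word i<L = trans (cong (λ w → nth w _) word-bits) (nth-bitsOnto β L [] i<L)

      inside-< : ∀ {j} → j ≤ G.bound + suc (N * N) → N + j < L
      inside-< {j} le = ≤-trans (≤-reflexive (sym (+-suc N j))) (+-monoʳ-≤ N (s≤s le))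

      -- A matrix position lies beyond the two unary blocks and determines its row and column, so
      -- only the adjacency of `u` and `v` can make this bit true.
      entry≡ : ∀ u v → β (N + suc (G.bound + suc (N * toℕ u + toℕ v))) ≡ adjacency u v
      entry≡ u v = G.T-≡ (to ∘ bit⇒) λ e →
        bit⇐ (inj₂ (inj₂ (toℕ u , toℕ<n u , toℕ v , toℕ<n v , refl ,
          Equivalence.from (adjacent⇔ u v _) (adjacency⇒ u v e))))
        where
        i : ℕ
        i = N + suc (G.bound + suc (N * toℕ u + toℕ v))
        to : Bit i → T (adjacency u v)
        to (inj₁ i<N) = contradiction i<N (≤⇒≯ (m≤m+n N _))
        to (inj₂ (inj₁ (j , j<k , e))) = contradiction
          (subst (_< G.bound) (sym (suc-injective (+-cancelˡ-≡ N _ _ e))) j<k) (≤⇒≯ (m≤m+n G.bound _))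
        to (inj₂ (inj₂ (u′ , u′< , v′ , v′< , e , a))) = adjacency⇐ u v
          (Equivalence.to (adjacent⇔ u v i) (subst₂ (λ a b → ⟦ adjF ⟧ᶠ W (b ∷ a ∷ i ∷ n ∷ []))
            (trans (sym (toℕ-fromℕ< u′<)) (sym (cong toℕ (proj₁ uv≡)))) (trans (sym (toℕ-fromℕ< v′<)) (sym (cong toℕ (proj₂ uv≡)))) a))
          where
          uv≡ : u ≡ fromℕ< u′< × v ≡ fromℕ< v′<
          uv≡ = combine-injective u v (fromℕ< u′<) (fromℕ< v′<) (toℕ-injective (trans (toℕ-combine u v)
            (trans (suc-injective (+-cancelˡ-≡ G.bound _ _ (suc-injective (+-cancelˡ-≡ N _ _ e))))
              (sym (trans (toℕ-combine (fromℕ< u′<) (fromℕ< v′<)) (cong₂ (λ a b → N * a + b) (toℕ-fromℕ< u′<) (toℕ-fromℕ< v′<)))))))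

    word-codes : Codes N G.bound adjacency word
    word-codes = record
      { length≡   = trans (cong length word-bits) (trans (length-bitsOnto β L []) (+-identityʳ L))
      ; order-bit = λ i i<N → trans (nth-word (≤-trans i<N (m≤m+n N _))) (cong just (T⇒true (bit⇐ (inj₁ i<N))))
      ; order-end = trans (nth-word (inside-< z≤n)) (cong just (¬T⇒false (order-end ∘ bit⇒)))
      ; bound-bit = λ i i<k → trans (nth-word (inside-< (≤-trans i<k (m≤m+n G.bound _))))
                                    (cong just (T⇒true (bit⇐ (inj₂ (inj₁ (i , i<k , refl))))))
      ; bound-end = trans (nth-word (inside-< (≤-trans (≤-reflexive (sym (+-suc G.bound 0))) (+-monoʳ-≤ G.bound (s≤s z≤n)))))
                          (cong just (¬T⇒false (bound-end ∘ bit⇒)))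
      ; entry     = λ u v → trans (nth-word (inside-< (≤-trans (≤-reflexive (sym (+-suc G.bound _)))
                              (+-monoʳ-≤ G.bound (s≤s (≤-trans (≤-reflexive (cong suc (sym (toℕ-combine u v)))) (toℕ<n (combine u v))))))))
                            (cong just (entry≡ u v))
      }
      where
      order-end : ¬ Bit (N + 0)
      order-end (inj₁ N<N) = <⇒≱ N<N (m≤m+n N 0)
      order-end (inj₂ (inj₁ (_ , _ , e))) with () ← +-cancelˡ-≡ N 0 _ e
      order-end (inj₂ (inj₂ (_ , _ , _ , _ , e , _))) with () ← +-cancelˡ-≡ N 0 _ e
      bound-end : ¬ Bit (N + suc (G.bound + 0))
      bound-end (inj₁ N<N) = <⇒≱ N<N (m≤m+n N _)
      bound-end (inj₂ (inj₁ (j , j<k , e))) = <⇒≱ j<k (≤-trans (m≤m+n G.bound 0) (≤-reflexive (suc-injective (+-cancelˡ-≡ N _ _ e))))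
      bound-end (inj₂ (inj₂ (_ , _ , _ , _ , e , _))) with () ← +-cancelˡ-≡ G.bound 0 _ (suc-injective (+-cancelˡ-≡ N _ _ e))

    word≡ : word ≡ encodeGraphWithBound G.instance-of
    word≡ = codes-unique word-codes (encode-codes G.instance-of)

    horizon≡ : D ≡ eval p (length x)
    horizon≡ = ⟦polyT⟧ p v₀

    AcceptedWithin : ℕ → Set
    AcceptedWithin d = ∃[ cs ] Machine.Accepting M (Machine.run M {d} cs (Machine.initial M x))

    Solvable : Set
    Solvable = ∃[ h ] Is3RDF G.Γ h × weight G.Γ h ≤ G.bound

    accepted⇔solvable : AcceptedWithin D ⇔ Solvable
    accepted⇔solvable = mk⇔ (Equivalence.to G.tableau⇔3RDF ∘ Equivalence.to (accepting⇔tableau x D))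
                            (Equivalence.from (accepting⇔tableau x D) ∘ Equivalence.from G.tableau⇔3RDF)

    solvable⇒yes : Solvable → language BipartiteRomDom word
    solvable⇒yes solution = (G.instance-of , G.colour , G.bipartition) , sym word≡ , solution

    -- The language may contain the word because of another instance with the same code, hence the
    -- detour through `encode-yes`.
    yes⇒solvable : language BipartiteRomDom word → Solvable
    yes⇒solvable ((I , _) , e , solution) = encode-yes {I} {G.instance-of} (trans e word≡) solution

    reduces : AcceptedWithin (eval p (length x)) ⇔ language BipartiteRomDom word
    reduces = mk⇔
      (solvable⇒yes ∘ Equivalence.to accepted⇔solvable ∘ subst AcceptedWithin (sym horizon≡))
      (subst AcceptedWithin horizon≡ ∘ Equivalence.from accepted⇔solvable ∘ yes⇒solvable)

  computable : PolyTimeComputable word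
  computable = Output.outputs lengthT bitF word word-bits

romDom-hard : NPHard (language BipartiteRomDom)
romDom-hard L (M , p , decides) = Reduction.word M p , Reduction.computable M p , λ x →
  mk⇔ (Equivalence.to (Reduction.reduces M p x) ∘ Equivalence.to (proj₂ (decides x)))
      (Equivalence.from (proj₂ (decides x)) ∘ Equivalence.from (Reduction.reduces M p x))

theorem1 : NPComplete (language (TripleRomDom restrictedTo (Bipartite ∘ GraphWithBound.graph)))
theorem1 = romDom-NP , romDom-hard
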